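{- Let $n\geq 9$ be an integer divisible by $3$, and let $N$ be a positive integer. Write $\mathrm{Aut}(G_N)$ for the automorphism group of the Fibonacci-sum graph $G_N$ and $\mathrm{id}$ for the identity map on $\{1,\dots,N\}$. Then: (1) If $N \in \left[F_n, \tfrac{3}{2} F_n \right)\cup \left[\tfrac{1}{2}F_{n+3},\, F_{n+2}+\tfrac{1}{2}F_{n-3} \right)\cup \left[F_{n+3}-\tfrac{1}{2}F_n,\, F_{n+3} \right)$, then $\mathrm{Aut}(G_N)=\{\mathrm{id}\}$. (2) If $N \in \left[\tfrac{3}{2}F_{n},\, \tfrac{1}{2}F_{n+3}\right)$, then $\mathrm{Aut}(G_N)=\{\mathrm{id}, \phi\}$, where $\phi$ interchanges the vertices $\tfrac{1}{2}F_n$ and $\tfrac{3}{2}F_n$ and fixes all other vertices. (3) If $N \in \left[F_{n+2}+\tfrac{1}{2}F_{n-3},\, F_{n+3}-\tfrac{1}{2}F_{n}\right)$, then $\mathrm{Aut}(G_N)=\{\mathrm{id}, \phi\}$, where $\phi$ interchanges $\tfrac{1}{2}F_n$ with $\tfrac{3}{2}F_n$, interchanges $F_{n+2}+\tfrac{1}{2}F_{n-3}$ with $\tfrac{1}{2}F_{n+3}$, and fixes all other vertices.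
   Context: The Fibonacci numbers are defined by $F_0=0$, $F_1=1$ and $F_m=F_{m-1}+F_{m-2}$ for $m\geq 2$. For each integer $N\geq 1$, the Fibonacci-sum graph $G_N$ is the simple graph with vertex set $\{1,2,\dots,N\}$ in which distinct vertices $i,j$ are adjacent if and only if $i+j$ is a Fibonacci number. (When $3\mid n$, $F_n$, $F_{n-3}$ and $F_{n+3}$ are even, so all the displayed quantities are integers.) Intervals here are intervals of integers. -}

module Defs where

open import Data.Nat using (ℕ; zero; suc; _+_; _*_; _≤_; _<_; _/_)
open import Data.Fin using (Fin; toℕ)
open import Data.Fin.Permutation using (Permutation′; _⟨$⟩ʳ_)
open import Data.Product using (∃; _×_)
open import Data.Bool using (if_then_else_)
open import Relation.Binary.PropositionalEquality using (_≡_; _≢_)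
open import Relation.Nullary.Decidable using (⌊_⌋)
open import Function.Bundles using (_⇔_)
import Data.Nat as ℕ

F : ℕ → ℕ
F 0 = 0
F 1 = 1
F (suc (suc m)) = F (suc m) + F m

IsFibonacci : ℕ → Set
IsFibonacci m = ∃ λ k → F k ≡ m

-- Vertex set {1,…,N} of G_N is encoded as Fin N; index i stands for vertex toℕ i + 1.
vertex : ∀ {N} → Fin N → ℕ
vertex i = suc (toℕ i)

Adj : (N : ℕ) → Fin N → Fin N → Set
Adj N i j = (i ≢ j) × IsFibonacci (vertex i + vertex j)

IsAutomorphism : (N : ℕ) → Permutation′ N → Set
IsAutomorphism N σ = ∀ i j → Adj N i j ⇔ Adj N (σ ⟨$⟩ʳ i) (σ ⟨$⟩ʳ j)

swapℕ : ℕ → ℕ → ℕ → ℕ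
swapℕ a b v = if ⌊ v ℕ.≟ a ⌋ then b else (if ⌊ v ℕ.≟ b ⌋ then a else v)

AutTrivial : ℕ → Set
AutTrivial N = ∀ (σ : Permutation′ N) → IsAutomorphism N σ → ∀ i → σ ⟨$⟩ʳ i ≡ i

AutIsIdAnd : (N : ℕ) → (ℕ → ℕ) → Set
AutIsIdAnd N φ =
  (∃ λ (σ : Permutation′ N) → IsAutomorphism N σ × (∀ i → vertex (σ ⟨$⟩ʳ i) ≡ φ (vertex i)))
  × (∀ (σ : Permutation′ N) → IsAutomorphism N σ →
       (∀ i → σ ⟨$⟩ʳ i ≡ i) ⊎' (∀ i → vertex (σ ⟨$⟩ʳ i) ≡ φ (vertex i)))
  where open import Data.Sum using () renaming (_⊎_ to _⊎'_)

-- Let σ be an automorphism of G_N. The degree of u is, up to a loop, the number of Fibonacci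
-- numbers in (u, N + u], so degrees decide most of what happens to 1 and 2, and σ fixes both.
-- Let v be the least vertex moved by σ, F (2 + c) ≤ v < F (3 + c), let w = σ v, and let
-- x = F (3 + c) - v be the smallest neighbour of v. Since x is fixed, x + w = F m for some
-- m > 3 + c. Comparing the ways v and w are joined to vertices below v, and their degrees,
-- leaves only 2 v = F (4 + c) and w = 3 v; moreover N < F (7 + c) - x, since otherwise a path
-- of length 3 from w to x has no preimage. For F n ≤ N < F (n + 3) with 3 ∣ n, parity of
-- Fibonacci numbers now gives 4 + c = n. Counting the neighbours of v and 3 v excludes this in
-- the ranges of part (1). In the other ranges φ is an automorphism exchanging v and 3 v, so
-- φ ∘ σ fixes v and is therefore the identity.
module Submission where

-- What makes h = F n / 2 exceptional is its loop: h + h = F n is no edge. With t = 3 h, the vertex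
-- k = F (n - 3) / 2 satisfies k + h = F (n - 1) and k + t = F (n + 1), and g = F (n - 1) + h
-- satisfies g + h = F (n + 1) and g + t = F (n + 2), so h and t share the neighbours k and g. As N
-- grows, h next acquires s = F (n + 2) - h, then t acquires r = F (n + 3) - t, then h acquires F (n
-- + 3) - h. The five ranges are cut at t, s, r and this last vertex: h and t can be exchanged
-- exactly when t is present, s and r are both present or both absent, and the last vertex is
-- absent. While it is absent, s and r have no neighbours but h and t, so they move along with them.
--
-- Every F (k + c) with k fixed is a fixed combination of F c and F (1 + c). The size estimates are
-- therefore linear inequalities, discharged by lists of natural weights. The genuinely arithmetic
-- input is which sums F i + F j = F l + F m can coincide.

open import Defs
open import Data.Bool using (Bool; true; T; _∧_)
open import Data.Empty using (⊥; ⊥-elim)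
open import Data.Nat using (ℕ; zero; suc; _+_; _*_; _≤_; _<_; _/_; _∸_; _≤ᵇ_; z≤n; s≤s)
open import Data.Nat.Divisibility using (_∣_; divides)
open import Data.Nat.DivMod using (m*n/n≡m)
open import Data.Nat.Properties
open import Data.Fin using (Fin; zero; suc; toℕ; fromℕ<)
open import Data.Fin.Permutation using (Permutation′; permutation; _⟨$⟩ʳ_; _⟨$⟩ˡ_; inverseˡ; inverseʳ)
open import Data.Fin.Properties using (toℕ-injective; toℕ<n; toℕ-fromℕ<; fromℕ<-toℕ; injective⇒≤; all?)
open import Data.List using (List; []; _∷_)
open import Data.Vec using (Vec; []; _∷_; lookup; replicate; zipWith; map; allFin)
open import Data.Vec.N-ary using (N-ary; _$ⁿ_)
open import Data.Product using (∃; _×_; _,_; proj₁; proj₂)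
open import Data.Sum using (_⊎_; inj₁; inj₂; [_,_]′; map₁; map₂)
open import Data.Unit using (tt)
open import Function using (_∘_)
open import Function.Bundles using (mk⇔; Equivalence)
open import Relation.Binary using (tri<; tri≈; tri>)
open import Relation.Binary.PropositionalEquality
open import Relation.Nullary using (Dec; yes; no; contradiction)
open import Relation.Nullary.Decidable using (True; toWitness; from-yes; _→-dec_; _⊎-dec_; ¬?)
open import Data.Nat.Tactic.RingSolver using (solve-∀)

-- Linear arithmetic over ℕ with certificates

infixl 7 _⊕_
infix 6 _≼_
infix 4 _⊢_ _⊨_ _⊨⇒_ _⊑_

-- 𝔽 k a b is the k-th term of the Fibonacci recurrence started at b, a, so that
-- 𝔽 k evaluates to F (k + c) definitionally when a and b stand for F (1 + c) and F c.
data Exp (n : ℕ) : Set where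
  var : Fin n → Exp n
  κ   : ℕ → Exp n
  _⊕_ : Exp n → Exp n → Exp n
  𝔽   : ℕ → Exp n → Exp n → Exp n

record Inequality (n : ℕ) : Set where
  constructor _≼_
  field lower upper : Exp n

record Entailment (n : ℕ) : Set where
  constructor _⊢_
  field
    hypotheses : List (Inequality n)
    conclusion : Inequality n

fibFrom : ℕ → ℕ → ℕ → ℕ
fibFrom 0             a b = b
fibFrom 1             a b = a
fibFrom (suc (suc k)) a b = fibFrom (suc k) a b + fibFrom k a b

⟦_⟧ : ∀ {n} → Exp n → Vec ℕ n → ℕ
⟦ var i ⟧ ρ = lookup ρ i
⟦ κ k ⟧ ρ = k
⟦ d ⊕ e ⟧ ρ = ⟦ d ⟧ ρ + ⟦ e ⟧ ρ
⟦ 𝔽 k a b ⟧ ρ = fibFrom k (⟦ a ⟧ ρ) (⟦ b ⟧ ρ)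

_⊨_ : ∀ {n} → Vec ℕ n → Inequality n → Set
ρ ⊨ l ≼ r = ⟦ l ⟧ ρ ≤ ⟦ r ⟧ ρ

_⊨⇒_ : ∀ {n} → Vec ℕ n → Entailment n → Set
ρ ⊨⇒ ([] ⊢ g) = ρ ⊨ g
ρ ⊨⇒ (h ∷ hs ⊢ g) = ρ ⊨ h → ρ ⊨⇒ (hs ⊢ g)

infixl 6 _⊞_
infixl 7 _⊡_

_⊞_ : ∀ {n} → Vec ℕ n → Vec ℕ n → Vec ℕ n
_⊞_ = zipWith _+_

_⊡_ : ∀ {n} → ℕ → Vec ℕ n → Vec ℕ n
k ⊡ u = map (k *_) u

unit : ∀ {n} → Fin n → Vec ℕ n
unit zero    = 1 ∷ replicate _ 0
unit (suc i) = 0 ∷ unit i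

dot : ∀ {n} → Vec ℕ n → Vec ℕ n → ℕ
dot []      []      = 0
dot (a ∷ u) (x ∷ ρ) = a * x + dot u ρ

fibVec : ∀ {n} → ℕ → Vec ℕ n → Vec ℕ n → Vec ℕ n
fibVec 0             a b = b
fibVec 1             a b = a
fibVec (suc (suc k)) a b = fibVec (suc k) a b ⊞ fibVec k a b

-- The head of a coefficient vector is the constant term.
coeffs : ∀ {n} → Exp n → Vec ℕ (suc n)
coeffs (var i) = unit (suc i)
coeffs (κ k) = k ∷ replicate _ 0
coeffs (d ⊕ e) = coeffs d ⊞ coeffs e
coeffs (𝔽 k a b) = fibVec k (coeffs a) (coeffs b)

_⊑_ : ∀ {n} → Vec ℕ n → Vec ℕ n → Bool
[]      ⊑ []      = true
(a ∷ u) ⊑ (b ∷ v) = (a ≤ᵇ b) ∧ (u ⊑ v)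

dot-0 : ∀ {n} (ρ : Vec ℕ n) → dot (replicate n 0) ρ ≡ 0
dot-0 []      = refl
dot-0 (x ∷ ρ) = dot-0 ρ

dot-unit : ∀ {n} (i : Fin n) ρ → dot (unit i) ρ ≡ lookup ρ i
dot-unit zero    (x ∷ ρ) = trans (cong₂ _+_ (+-identityʳ x) (dot-0 ρ)) (+-identityʳ x)
dot-unit (suc i) (x ∷ ρ) = dot-unit i ρ

dot-⊞ : ∀ {n} (u v ρ : Vec ℕ n) → dot (u ⊞ v) ρ ≡ dot u ρ + dot v ρ
dot-⊞ []      []      []      = refl
dot-⊞ (a ∷ u) (b ∷ v) (x ∷ ρ) =
  trans (cong ((a + b) * x +_) (dot-⊞ u v ρ)) (regroup a b x (dot u ρ) (dot v ρ))
  where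
  regroup : ∀ a b x p q → (a + b) * x + (p + q) ≡ a * x + p + (b * x + q)
  regroup = solve-∀

dot-⊡ : ∀ {n} k (u ρ : Vec ℕ n) → dot (k ⊡ u) ρ ≡ k * dot u ρ
dot-⊡ k []      []      = sym (*-zeroʳ k)
dot-⊡ k (a ∷ u) (x ∷ ρ) =
  trans (cong (k * a * x +_) (dot-⊡ k u ρ)) (regroup k a x (dot u ρ))
  where
  regroup : ∀ k a x p → k * a * x + k * p ≡ k * (a * x + p)
  regroup = solve-∀

-- Comparing coefficients suffices because all variables take nonnegative values.
dot-mono : ∀ {n} (u v ρ : Vec ℕ n) → T (u ⊑ v) → dot u ρ ≤ dot v ρ
dot-mono []      []      []      _ = z≤n
dot-mono (a ∷ u) (b ∷ v) (x ∷ ρ) t with a ≤ᵇ b in eq | u ⊑ v in eq′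
... | true | true =
  +-mono-≤ (*-monoˡ-≤ x (≤ᵇ⇒≤ a b (subst T (sym eq) tt)))
           (dot-mono u v ρ (subst T (sym eq′) tt))

dot-fibVec : ∀ {n} k (a b ρ : Vec ℕ n) → dot (fibVec k a b) ρ ≡ fibFrom k (dot a ρ) (dot b ρ)
dot-fibVec 0             a b ρ = refl
dot-fibVec 1             a b ρ = refl
dot-fibVec (suc (suc k)) a b ρ =
  trans (dot-⊞ (fibVec (suc k) a b) (fibVec k a b) ρ)
        (cong₂ _+_ (dot-fibVec (suc k) a b ρ) (dot-fibVec k a b ρ))

dot-coeffs : ∀ {n} (e : Exp n) ρ → dot (coeffs e) (1 ∷ ρ) ≡ ⟦ e ⟧ ρ
dot-coeffs (var i) ρ = dot-unit i ρ
dot-coeffs (κ k) ρ = trans (cong₂ _+_ (*-identityʳ k) (dot-0 ρ)) (+-identityʳ k)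
dot-coeffs (d ⊕ e) ρ =
  trans (dot-⊞ (coeffs d) (coeffs e) _) (cong₂ _+_ (dot-coeffs d ρ) (dot-coeffs e ρ))
dot-coeffs (𝔽 k a b) ρ =
  trans (dot-fibVec k (coeffs a) (coeffs b) _)
        (cong₂ (fibFrom k) (dot-coeffs a ρ) (dot-coeffs b ρ))

-- The weighted hypotheses are added with their upper sides to l and their lower sides to r;
-- then l may exceed r only by a slack of d in the constant term.
certifies : ∀ {n} → ℕ → Vec ℕ (suc n) → Vec ℕ (suc n) → List (Inequality n) → List ℕ → Bool
certifies d l r (lo ≼ up ∷ hs) (w ∷ ws) =
  certifies d (l ⊞ w ⊡ coeffs up) (r ⊞ w ⊡ coeffs lo) hs ws
certifies d l (b ∷ r) _ _ = l ⊑ (b + d ∷ r)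

-- d + 1 is the weight of the conclusion; over ℕ, a slack of d is harmless.
valid : ∀ {n} → ℕ → List ℕ → Entailment n → Bool
valid d ws (hs ⊢ l ≼ r) = certifies d (suc d ⊡ coeffs l) (suc d ⊡ coeffs r) hs ws

-- The accumulators hold the conclusion together with the weighted hypotheses consumed so far. Each
-- step cancels the weighted upper side of one hypothesis, so the continuation always receives the
-- original inequality.
entails : ∀ {n} d ws (hs : List (Inequality n)) g (l r : Vec ℕ (suc n)) ρ →
          T (certifies d l r hs ws) →
          (dot l (1 ∷ ρ) ≤ dot r (1 ∷ ρ) + d → ρ ⊨ g) →
          ρ ⊨⇒ (hs ⊢ g)
entails d ws [] g l (b ∷ r) ρ t k = k (≤-trans (dot-mono l (b + d ∷ r) _ t) (≤-reflexive (move b d (dot r ρ))))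
  where
  move : ∀ b d p → (b + d) * 1 + p ≡ b * 1 + p + d
  move = solve-∀
entails d [] (h ∷ hs) g l (b ∷ r) ρ t k _ = entails d [] hs g l (b ∷ r) ρ (skip hs) k
  where
  skip : ∀ hs → T (certifies d l (b ∷ r) hs [])
  skip []      = t
  skip (_ ∷ _) = t
entails d (w ∷ ws) (lo ≼ up ∷ hs) g l r ρ t k lo≤up =
  entails d ws hs g (l ⊞ w ⊡ coeffs up) (r ⊞ w ⊡ coeffs lo) ρ t λ p →
    k (+-cancelʳ-≤ (w * ⟦ up ⟧ ρ) _ _ (begin
      dot l ρ′ + w * ⟦ up ⟧ ρ            ≡⟨ expand l up ⟨
      dot (l ⊞ w ⊡ coeffs up) ρ′         ≤⟨ p ⟩
      dot (r ⊞ w ⊡ coeffs lo) ρ′ + d     ≡⟨ cong (_+ d) (expand r lo) ⟩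
      dot r ρ′ + w * ⟦ lo ⟧ ρ + d        ≤⟨ +-monoˡ-≤ d (+-monoʳ-≤ (dot r ρ′) (*-monoʳ-≤ w lo≤up)) ⟩
      dot r ρ′ + w * ⟦ up ⟧ ρ + d        ≡⟨ swap (dot r ρ′) _ d ⟩
      dot r ρ′ + d + w * ⟦ up ⟧ ρ        ∎))
  where
  open ≤-Reasoning
  ρ′ = 1 ∷ ρ
  expand : ∀ u e → dot (u ⊞ w ⊡ coeffs e) ρ′ ≡ dot u ρ′ + w * ⟦ e ⟧ ρ
  expand u e = trans (dot-⊞ u _ ρ′) (cong (dot u ρ′ +_)
                 (trans (dot-⊡ w (coeffs e) ρ′) (cong (w *_) (dot-coeffs e ρ))))
  swap : ∀ a b c → a + b + c ≡ a + c + b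
  swap = solve-∀

-- Abstract: unfolding these proofs during with-abstraction is prohibitively slow.
abstract
  linear : ∀ {n} (ρ : Vec ℕ n) (P : N-ary n (Exp n) (Entailment n)) d ws →
           let E = P $ⁿ map var (allFin n) in {T (valid d ws E)} → ρ ⊨⇒ E
  linear {n} ρ P d ws {t} = go (P $ⁿ map var (allFin n)) t
    where
    go : ∀ E → T (valid d ws E) → ρ ⊨⇒ E
    go (hs ⊢ l ≼ r) t = entails d ws hs (l ≼ r) (suc d ⊡ coeffs l) (suc d ⊡ coeffs r) ρ t λ p →
      ≤-pred (*-cancelˡ-< (suc d) _ _ (begin-strict
        suc d * ⟦ l ⟧ ρ          ≡⟨ scaled l ⟨
        dot (suc d ⊡ coeffs l) (1 ∷ ρ)   ≤⟨ p ⟩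
        dot (suc d ⊡ coeffs r) (1 ∷ ρ) + d ≡⟨ cong (_+ d) (scaled r) ⟩
        suc d * ⟦ r ⟧ ρ + d      <⟨ +-monoʳ-< (suc d * ⟦ r ⟧ ρ) (n<1+n d) ⟩
        suc d * ⟦ r ⟧ ρ + suc d  ≡⟨ +-comm _ (suc d) ⟩
        suc d + suc d * ⟦ r ⟧ ρ  ≡⟨ *-suc (suc d) (⟦ r ⟧ ρ) ⟨
        suc d * suc (⟦ r ⟧ ρ)    ∎))
      where
      open ≤-Reasoning
      scaled : ∀ e → dot (suc d ⊡ coeffs e) (1 ∷ ρ) ≡ suc d * ⟦ e ⟧ ρ
      scaled e = trans (dot-⊡ (suc d) (coeffs e) _) (cong (suc d *_) (dot-coeffs e ρ))

-- Fibonacci numbers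

F-step : ∀ m → F m ≤ F (suc m)
F-step 0             = z≤n
F-step 1             = ≤-refl
F-step (suc (suc m)) = linear (F (suc m) ∷ F m ∷ [])
          (λ F₁ F₀ → [] ⊢ 𝔽 2 F₁ F₀ ≼ 𝔽 3 F₁ F₀)
          0 []

F-mono : ∀ {m n} → m ≤ n → F m ≤ F n
F-mono {n = n} m≤n with m≤n⇒m<n∨m≡n m≤n
F-mono {n = suc n} m≤n | inj₁ (s≤s m≤n′) = ≤-trans (F-mono m≤n′) (F-step n)
... | inj₂ refl = ≤-refl

F-pos : ∀ {m} → 1 ≤ m → 1 ≤ F m
F-pos = F-mono

F-strict : ∀ {m n} → 2 ≤ m → m < n → F m < F n
F-strict {suc (suc m)} (s≤s (s≤s _)) m<n = ≤-trans (linear (F (suc m) ∷ F m ∷ [])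
          (λ F₁ F₀ → κ 1 ≼ F₁ ∷ [] ⊢ κ 1 ⊕ 𝔽 2 F₁ F₀ ≼ 𝔽 3 F₁ F₀)
          0 (1 ∷ []) (F-pos {suc m} (s≤s z≤n))) (F-mono m<n)

F-cancel-< : ∀ {m n} → F m < F n → m < n
F-cancel-< p = ≰⇒> λ n≤m → <⇒≱ p (F-mono n≤m)

F-injective : ∀ {m n} → 2 ≤ m → 2 ≤ n → F m ≡ F n → m ≡ n
F-injective {m} {n} 2≤m 2≤n eq with <-cmp m n
... | tri< m<n _ _ = ⊥-elim (<⇒≢ (F-strict 2≤m m<n) eq)
... | tri≈ _ m≡n _ = m≡n
... | tri> _ _ n<m = ⊥-elim (<⇒≢ (F-strict 2≤n n<m) (sym eq))

between-not-Fibonacci : ∀ k {y} → F k < y → y < F (suc k) → ∀ j → F j ≢ y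
between-not-Fibonacci k lo hi j refl = <⇒≱ (F-cancel-< {k} {j} lo) (≤-pred (F-cancel-< {j} {suc k} hi))

locate : ∀ v → 1 ≤ v → ∃ λ k → 2 ≤ k × F k ≤ v × v < F (suc k)
locate 1 _ = 2 , ≤-refl , ≤-refl , ≤-refl
locate (suc (suc v)) _ with locate (suc v) (s≤s z≤n)
... | k , 2≤k , lo , hi with m≤n⇒m<n∨m≡n hi
...   | inj₁ hi′ = k , 2≤k , m≤n⇒m≤1+n lo , hi′
...   | inj₂ eq  = suc k , m≤n⇒m≤1+n 2≤k , ≤-reflexive (sym eq) ,
                   (linear (v ∷ F (suc k) ∷ F k ∷ [])
                             (λ v F₁ F₀ → κ 1 ⊕ (κ 1 ⊕ v) ≼ F₁ ∷ κ 1 ≼ F₀ ∷ []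
                               ⊢ κ 1 ⊕ (κ 1 ⊕ (κ 1 ⊕ v)) ≼ 𝔽 2 F₁ F₀)
                             0 (1 ∷ 1 ∷ []) (≤-reflexive eq) (F-pos (≤-trans (s≤s z≤n) 2≤k)))

-- Normalises the index: 1 = F 1 = F 2 is the only repeated value, so from index 2 on `F-injective`
-- applies.
index : ∀ {m} → IsFibonacci m → 1 ≤ m → ∃ λ k → 2 ≤ k × m ≡ F k
index (0 , refl) ()
index (1 , refl) _           = 2 , ≤-refl , refl
index (suc (suc k) , refl) _ = suc (suc k) , s≤s (s≤s z≤n) , refl

-- Up to F 1 = F 2, the only coincidence in question is F (k + 3) + F k = 2 F (k + 2).
-- Lemmas two-sums and two-large-sums stand in for uniqueness of Zeckendorf representations.
two-sums : ∀ {a i j m} → 2 ≤ a → a < m → m < j → F j + F a ≡ F i + F m →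
           j ≡ suc m × ∃ λ k → m ≡ 2 + k × F a ≡ F k
two-sums {a} {i} {suc (suc j)} {m} 2≤a a<m m<j eq =
  cases (m≤n⇒m<n∨m≡n (≤-pred i<2+j)) (m≤n⇒m<n∨m≡n (≤-pred m<j))
  where
  F-a-pos : 1 ≤ F a
  F-a-pos = F-pos (≤-trans (s≤s z≤n) 2≤a)
  i<2+j : i < suc (suc j)
  i<2+j = F-cancel-< {i} {suc (suc j)} (linear (F i ∷ F m ∷ F (suc j) ∷ F j ∷ F a ∷ [])
            (λ F₀ G₀ H₁ H₀ K₀ → F₀ ⊕ G₀ ≼ 𝔽 2 H₁ H₀ ⊕ K₀ ∷ κ 1 ⊕ K₀ ≼ G₀ ∷ []
              ⊢ κ 1 ⊕ F₀ ≼ 𝔽 2 H₁ H₀)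
            0 (1 ∷ 1 ∷ []) (≤-reflexive (sym eq)) (F-strict 2≤a a<m))
  -- With `i` one below the top index, the recurrence cancels `F (suc j)` on both sides; what is
  -- left forces `m` to be `suc j` and one more cancellation identifies `F a`.
  reduced : i ≡ suc j → F j + F a ≡ F m
  reduced i≡1+j = +-cancelˡ-≡ (F (suc j)) _ _ (begin
    F (suc j) + (F j + F a) ≡⟨ +-assoc (F (suc j)) (F j) (F a) ⟨
    F (suc (suc j)) + F a   ≡⟨ eq ⟩
    F i + F m               ≡⟨ cong (λ i → F i + F m) i≡1+j ⟩
    F (suc j) + F m         ∎)
    where open ≡-Reasoning
  last : ∀ j → F j + F a ≡ F m → m ≡ suc j → ∃ λ k → m ≡ 2 + k × F a ≡ F k
  last zero    _ m≡1   = ⊥-elim (n≮0 (linear (a ∷ m ∷ [])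
            (λ a m → κ 2 ≼ a ∷ κ 1 ⊕ a ≼ m ∷ m ≼ κ 1 ∷ [] ⊢ κ 1 ≼ κ 0)
            0 (1 ∷ 1 ∷ 1 ∷ []) 2≤a a<m (≤-reflexive m≡1)))
  last (suc k) p m≡2+k = k , m≡2+k , +-cancelˡ-≡ (F (suc k)) _ _ (trans p (cong F m≡2+k))
  cases : i < suc j ⊎ i ≡ suc j → m < suc j ⊎ m ≡ suc j →
          suc (suc j) ≡ suc m × ∃ λ k → m ≡ 2 + k × F a ≡ F k
  cases (inj₁ i<1+j) _ =
    ⊥-elim (n≮0 (linear (F (suc j) ∷ F j ∷ F a ∷ F i ∷ F m ∷ [])
              (λ F₁ F₀ G₀ H₀ K₀ → 𝔽 2 F₁ F₀ ⊕ G₀ ≼ H₀ ⊕ K₀ ∷ H₀ ≼ F₀ ∷ K₀ ≼ F₁ ∷ κ 1 ≼ G₀ ∷ []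
                ⊢ κ 1 ≼ κ 0)
              0 (1 ∷ 1 ∷ 1 ∷ 1 ∷ []) (≤-reflexive eq) (F-mono (≤-pred i<1+j)) (F-mono (≤-pred m<j)) F-a-pos))
  cases (inj₂ i≡1+j) (inj₁ m<1+j) = ⊥-elim (n≮0 (linear (F j ∷ F a ∷ F m ∷ [])
            (λ F₀ G₀ H₀ → F₀ ⊕ G₀ ≼ H₀ ∷ H₀ ≼ F₀ ∷ κ 1 ≼ G₀ ∷ [] ⊢ κ 1 ≼ κ 0)
            0 (1 ∷ 1 ∷ 1 ∷ []) (≤-reflexive (reduced i≡1+j)) (F-mono (≤-pred m<1+j)) F-a-pos))
  cases (inj₂ i≡1+j) (inj₂ m≡1+j) = cong suc (sym m≡1+j) , last j (reduced i≡1+j) m≡1+j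
two-sums {j = suc zero} 2≤a a<m (s≤s m≤0) eq = ⊥-elim (n≮0 (≤-trans a<m m≤0))

two-large-sums : ∀ {i j l m} → 3 ≤ m → m < i → i ≤ j → F i + F j ≡ F l + F m → i ≡ j × i ≡ 2 + m
two-large-sums {suc zero} 3≤m (s≤s m≤0) _ _ = ⊥-elim (n≮0 (≤-trans 3≤m m≤0))
two-large-sums {suc (suc i)} {suc zero} _ _ (s≤s ()) _
two-large-sums {suc (suc i)} {suc (suc j)} {l} {m} 3≤m m<i i≤j eq =
  cases (m≤n⇒m<n∨m≡n i≤j) (m≤n⇒m<n∨m≡n j<l)
  where
  F-m-big : 2 ≤ F m
  F-m-big = F-mono 3≤m
  2≤m : 2 ≤ m
  2≤m = ≤-trans (s≤s (s≤s z≤n)) 3≤m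
  j<l : suc (suc j) < l
  j<l = F-cancel-< {suc (suc j)} {l} (linear (F (suc i) ∷ F i ∷ F (suc j) ∷ F j ∷ F l ∷ F m ∷ [])
            (λ F₁ F₀ G₁ G₀ H₀ K₀ → 𝔽 2 F₁ F₀ ⊕ 𝔽 2 G₁ G₀ ≼ H₀ ⊕ K₀ ∷ κ 1 ⊕ K₀ ≼ 𝔽 2 F₁ F₀ ∷ []
              ⊢ κ 1 ⊕ 𝔽 2 G₁ G₀ ≼ H₀)
            0 (1 ∷ 1 ∷ []) (≤-reflexive eq) (F-strict 2≤m m<i))
  cases : suc (suc i) < suc (suc j) ⊎ suc (suc i) ≡ suc (suc j) → 3 + j < l ⊎ 3 + j ≡ l →
          suc (suc i) ≡ suc (suc j) × suc (suc i) ≡ 2 + m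
  cases (inj₁ i<j) _ = ⊥-elim (n≮0 (linear (F l ∷ F m ∷ F (suc i) ∷ F i ∷ F (suc j) ∷ F j ∷ [])
            (λ F₀ G₀ H₁ H₀ K₁ K₀ →
              F₀ ⊕ G₀ ≼ 𝔽 2 H₁ H₀ ⊕ 𝔽 2 K₁ K₀ ∷ 𝔽 2 H₁ H₀ ≼ K₁ ∷ 𝔽 3 K₁ K₀ ≼ F₀ ∷ κ 2 ≼ G₀ ∷ []
              ⊢ κ 1 ≼ κ 0)
            0 (1 ∷ 1 ∷ 1 ∷ 1 ∷ []) (≤-reflexive (sym eq)) (F-mono (≤-pred i<j)) (F-mono j<l) F-m-big))
  cases (inj₂ refl) (inj₁ 1+j<l) = ⊥-elim (n≮0 (linear (F l ∷ F m ∷ F (suc i) ∷ F i ∷ [])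
            (λ F₀ G₀ H₁ H₀ → F₀ ⊕ G₀ ≼ 𝔽 2 H₁ H₀ ⊕ 𝔽 2 H₁ H₀ ∷ 𝔽 4 H₁ H₀ ≼ F₀ ∷ κ 2 ≼ G₀ ∷ []
              ⊢ κ 1 ≼ κ 0)
            0 (1 ∷ 1 ∷ 1 ∷ []) (≤-reflexive (sym eq)) (F-mono 1+j<l) F-m-big))
  -- The identity 2 F (i + 2) = F (i + 3) + F i reduces the equation to F i = F m.
  cases (inj₂ refl) (inj₂ refl) =
    refl , cong (2 +_) (F-injective (<⇒≤ (F-cancel-< {2} {j} (linear (F m ∷ F i ∷ [])
              (λ F₀ G₀ → κ 2 ≼ F₀ ∷ F₀ ≼ G₀ ∷ [] ⊢ κ 2 ≼ G₀)
              0 (1 ∷ 1 ∷ []) F-m-big (≤-reflexive (sym Fj≡Fm))))) 2≤m Fj≡Fm)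
    where
    Fj≡Fm : F j ≡ F m
    Fj≡Fm = ≤-antisym (linear (F (suc i) ∷ F i ∷ F m ∷ [])
              (λ F₁ F₀ G₀ → 𝔽 2 F₁ F₀ ⊕ 𝔽 2 F₁ F₀ ≼ 𝔽 3 F₁ F₀ ⊕ G₀ ∷ [] ⊢ F₀ ≼ G₀)
              0 (1 ∷ []) (≤-reflexive eq))
            (linear (F (suc i) ∷ F i ∷ F m ∷ [])
              (λ F₁ F₀ G₀ → 𝔽 3 F₁ F₀ ⊕ G₀ ≼ 𝔽 2 F₁ F₀ ⊕ 𝔽 2 F₁ F₀ ∷ [] ⊢ G₀ ≼ F₀)
              0 (1 ∷ []) (≤-reflexive (sym eq)))

-- Automorphisms, as inverse functions on ℕ whose values outside {1,…,N} are irrelevant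

In : ℕ → ℕ → Set
In N u = 1 ≤ u × u ≤ N

record Auto (N : ℕ) : Set where
  field
    to from  : ℕ → ℕ
    to-in    : ∀ {u} → In N u → In N (to u)
    from-in  : ∀ {u} → In N u → In N (from u)
    from-to  : ∀ {u} → In N u → from (to u) ≡ u
    to-from  : ∀ {u} → In N u → to (from u) ≡ u
    to-adj   : ∀ {u v} → In N u → In N v → u ≢ v → IsFibonacci (u + v) → IsFibonacci (to u + to v)
    from-adj : ∀ {u v} → In N u → In N v → u ≢ v → IsFibonacci (u + v) → IsFibonacci (from u + from v)

inverse : ∀ {N} → Auto N → Auto N
inverse A = record
  { to = from ; from = to ; to-in = from-in ; from-in = to-in ; from-to = to-from
  ; to-from = from-to ; to-adj = from-adj ; from-adj = to-adj }
  where open Auto A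

_⊙_ : ∀ {N} → Auto N → Auto N → Auto N
_⊙_ {N} B A = record
  { to       = B.to ∘ A.to
  ; from     = A.from ∘ B.from
  ; to-in    = B.to-in ∘ A.to-in
  ; from-in  = A.from-in ∘ B.from-in
  ; from-to  = λ i → trans (cong A.from (B.from-to (A.to-in i))) (A.from-to i)
  ; to-from  = λ i → trans (cong B.to (A.to-from (B.from-in i))) (B.to-from i)
  ; to-adj   = λ i j u≢v p → B.to-adj (A.to-in i) (A.to-in j)
                 (λ eq → u≢v (trans (sym (A.from-to i)) (trans (cong A.from eq) (A.from-to j))))
                 (A.to-adj i j u≢v p)
  ; from-adj = λ i j u≢v p → A.from-adj (B.from-in i) (B.from-in j)
                 (λ eq → u≢v (trans (sym (B.to-from i)) (trans (cong B.to eq) (B.to-from j))))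
                 (B.from-adj i j u≢v p)
  }
  where
  module A = Auto A
  module B = Auto B

-- Images of edges and comparison of degrees

module Images {N : ℕ} (A : Auto N) where
  open Auto A public

  to-injective : ∀ {u v} → In N u → In N v → to u ≡ to v → u ≡ v
  to-injective i j eq = trans (sym (from-to i)) (trans (cong from eq) (from-to j))

  adjacent : ∀ {u v} i → In N u → In N v → u ≢ v → u + v ≡ F i →
             ∃ λ j → 2 ≤ j × to u + to v ≡ F j
  adjacent {u} {v} i iu iv u≢v eq =
    index (to-adj iu iv u≢v (i , sym eq)) (≤-trans (proj₁ (to-in iu)) (m≤m+n (to u) (to v)))

  adjacent-to : ∀ {u v v′} i → In N u → In N v → u ≢ v → to v ≡ v′ → u + v ≡ F i →
                ∃ λ j → 2 ≤ j × to u + v′ ≡ F j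
  adjacent-to i iu iv u≢v refl eq = adjacent i iu iv u≢v eq

  -- A neighbour u of v is counted by the index i of the Fibonacci number u + v = F i.
  degree : ∀ {v a J b B} → In N v → 2 ≤ a → a ≤ J →
           (∀ i → a ≤ i → i ≤ J → v < F i × F i ≤ N + v × v + v ≢ F i) →
           (∀ {i j u} → a ≤ i → i ≤ J → In N u → u ≢ v → u + v ≡ F i →
             to u + to v ≡ F j → b ≤ j × j ≤ B) →
           J + b ≤ B + a
  -- Pigeonhole between the index intervals from `a` to `J` and from `b` to `B`. The bounds for the
  -- first index also show `b ≤ B`, so that `B ∸ b` is a true difference.
  degree {v} {a} {J} {b} {B} iv 2≤a a≤J ok target = linear (J ∸ a ∷ B ∸ b ∷ J ∷ a ∷ b ∷ B ∷ [])
            (λ t₁ t₂ J a b B → t₁ ≼ t₂ ∷ J ≼ t₁ ⊕ a ∷ t₂ ⊕ b ≼ B ∷ [] ⊢ J ⊕ b ≼ B ⊕ a)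
            0 (1 ∷ 1 ∷ 1 ∷ []) (≤-pred (injective⇒≤ φ-injective)) (≤-reflexive (sym (m∸n+n≡m a≤J))) (≤-reflexive (m∸n+n≡m (≤-trans (proj₁ (bounds zero)) (proj₂ (bounds zero)))))
    where
    module _ (k : Fin (suc (J ∸ a))) where
      i = a + toℕ k
      a≤i : a ≤ i
      a≤i = m≤m+n a (toℕ k)
      i≤J : i ≤ J
      i≤J = linear (toℕ k ∷ J ∸ a ∷ a ∷ J ∷ [])
                (λ t₁ t₂ a J → t₁ ≼ t₂ ∷ t₂ ⊕ a ≼ J ∷ [] ⊢ a ⊕ t₁ ≼ J)
                0 (1 ∷ 1 ∷ []) (≤-pred (toℕ<n k)) (≤-reflexive (m∸n+n≡m a≤J))
      good = ok i a≤i i≤J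
      u = F i ∸ v
      u+v : u + v ≡ F i
      u+v = m∸n+n≡m (<⇒≤ (proj₁ good))
      iu : In N u
      iu = (linear (F (a + toℕ k) ∷ F (a + toℕ k) ∸ v ∷ v ∷ [])
                (λ F₀ t₁ v → F₀ ≼ t₁ ⊕ v ∷ κ 1 ⊕ v ≼ F₀ ∷ [] ⊢ κ 1 ≼ t₁)
                0 (1 ∷ 1 ∷ []) (≤-reflexive (sym u+v)) (proj₁ good)) , (linear (F (a + toℕ k) ∸ v ∷ v ∷ F (a + toℕ k) ∷ N ∷ [])
                (λ t₁ v F₀ N → t₁ ⊕ v ≼ F₀ ∷ F₀ ≼ N ⊕ v ∷ [] ⊢ t₁ ≼ N)
                0 (1 ∷ 1 ∷ []) (≤-reflexive u+v) (proj₁ (proj₂ good)))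
      u≢v : u ≢ v
      u≢v eq = proj₂ (proj₂ good) (trans (cong (_+ v) (sym eq)) u+v)
      image = adjacent i iu iv u≢v u+v
      j = proj₁ image
      bounds = target a≤i i≤J iu u≢v u+v (proj₂ (proj₂ image))
    φ : Fin (suc (J ∸ a)) → Fin (suc (B ∸ b))
    φ k = fromℕ< (s≤s (∸-monoˡ-≤ b (proj₂ (bounds k))))
    -- The index `j` determines the neighbour `to u` of `to v`, hence `u`, hence `F i`, and `i`
    -- itself since `2 ≤ a`.
    φ-injective : ∀ {k l} → φ k ≡ φ l → k ≡ l
    φ-injective {k} {l} eq = toℕ-injective (+-cancelˡ-≡ a _ _ (F-injective
      (≤-trans 2≤a (a≤i k)) (≤-trans 2≤a (a≤i l))
      (trans (sym (u+v k)) (trans (cong (_+ v) same-u) (u+v l)))))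
      where
      same-j : j k ≡ j l
      same-j = ∸-cancelʳ-≡ (proj₁ (bounds k)) (proj₁ (bounds l))
        (trans (sym (toℕ-fromℕ< _)) (trans (cong toℕ eq) (toℕ-fromℕ< _)))
      same-u : u k ≡ u l
      same-u = to-injective (iu k) (iu l) (+-cancelʳ-≡ (to v) _ _
        (trans (proj₂ (proj₂ (image k))) (trans (cong F same-j) (sym (proj₂ (proj₂ (image l)))))))

-- v is the least vertex moved by A, and F (2 + c) ≤ v < F (3 + c). Comparing v and its
-- image w through their smallest common neighbour x leaves only w = 3 v, 2 v = F (4 + c).
module LeastMoved {N : ℕ} (A : Auto N) {c v : ℕ} (2≤c : 2 ≤ c) (iv : In N v)
                  (lo : F (2 + c) ≤ v) (hi : v < F (3 + c))
                  (fixed : ∀ {u} → 1 ≤ u → u < v → Auto.to A u ≡ u)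
                  {w : ℕ} (to-v : Auto.to A v ≡ w) (moved : w ≢ v)
                  {x : ℕ} (x+v : x + v ≡ F (3 + c)) where
  open Images A public
  module A⁻¹ = Images (inverse A)

  F-c-pos : 1 ≤ F c
  F-c-pos = F-pos (≤-trans (s≤s z≤n) 2≤c)

  F-c-< : F c < F (1 + c)
  F-c-< = F-strict 2≤c ≤-refl

  1≤x : 1 ≤ x
  1≤x = linear (F (suc c) ∷ F c ∷ x ∷ v ∷ [])
            (λ F₁ F₀ x v → 𝔽 3 F₁ F₀ ≼ x ⊕ v ∷ κ 1 ⊕ v ≼ 𝔽 3 F₁ F₀ ∷ [] ⊢ κ 1 ≼ x)
            0 (1 ∷ 1 ∷ []) (≤-reflexive (sym x+v)) hi

  x≤ : x ≤ F (1 + c)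
  x≤ = linear (x ∷ v ∷ F (suc c) ∷ F c ∷ [])
            (λ x v F₁ F₀ → x ⊕ v ≼ 𝔽 3 F₁ F₀ ∷ 𝔽 2 F₁ F₀ ≼ v ∷ [] ⊢ x ≼ F₁)
            0 (1 ∷ 1 ∷ []) (≤-reflexive x+v) lo

  x<v : x < v
  x<v = linear (x ∷ F (suc c) ∷ F c ∷ v ∷ [])
            (λ x F₁ F₀ v → x ≼ F₁ ∷ 𝔽 2 F₁ F₀ ≼ v ∷ κ 1 ≼ F₀ ∷ [] ⊢ κ 1 ⊕ x ≼ v)
            0 (1 ∷ 1 ∷ 1 ∷ []) x≤ lo F-c-pos

  ix : In N x
  ix = 1≤x , ≤-trans (<⇒≤ x<v) (proj₂ iv)

  iw : In N w
  iw = subst (In N) to-v (to-in iv)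

  from-w : from w ≡ v
  from-w = trans (cong from (sym to-v)) (from-to iv)

  to-x : to x ≡ x
  to-x = fixed 1≤x x<v

  v<w : v < w
  v<w with <-cmp v w
  ... | tri< v<w _ _ = v<w
  ... | tri≈ _ v≡w _ = ⊥-elim (moved (sym v≡w))
  ... | tri> _ _ w<v = ⊥-elim (moved (to-injective iw iv (trans (fixed (proj₁ iw) w<v) (sym to-v))))

  from-fixed : ∀ {u} → 1 ≤ u → u < v → from u ≡ u
  from-fixed 1≤u u<v =
    trans (cong from (sym (fixed 1≤u u<v))) (from-to (1≤u , ≤-trans (<⇒≤ u<v) (proj₂ iv)))

  shift : ∃ λ e → c ≤ e × x + w ≡ F (4 + e)
  shift with adjacent-to (3 + c) ix iv (<⇒≢ x<v) to-v x+v
  ... | m , _ , eq with m≤n⇒∃[o]m+o≡n (F-cancel-< {3 + c} {m} (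
          ≤-trans (≤-reflexive (cong suc (sym x+v))) (≤-trans (+-monoʳ-< x v<w)
            (≤-reflexive (trans (cong (_+ w) (sym to-x)) eq)))))
  ...   | o , refl = c + o , m≤m+n c o , trans (cong (_+ w) (sym to-x)) eq

  -- The edge x + v = F (3 + c) is carried to x + w = F (4 + e), so e - c measures how far indices
  -- are shifted. The lemmas below refute everything except 2 x = F (1 + c) with e = 1 + c.
  module Shifted {e : ℕ} (c≤e : c ≤ e) (x+w : x + w ≡ F (4 + e)) where

    F-c-≤ : F c ≤ F e
    F-c-≤ = F-mono c≤e

    F-1+c-≤ : F (1 + c) ≤ F (1 + e)
    F-1+c-≤ = F-mono (s≤s c≤e)

    F≤w : F (3 + e) ≤ w
    F≤w = linear (x ∷ F (suc c) ∷ F (suc e) ∷ F e ∷ w ∷ [])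
              (λ x F₁ G₁ G₀ w → x ≼ F₁ ∷ 𝔽 4 G₁ G₀ ≼ x ⊕ w ∷ F₁ ≼ G₁ ∷ [] ⊢ 𝔽 3 G₁ G₀ ≼ w)
              0 (1 ∷ 1 ∷ 1 ∷ []) x≤ (≤-reflexive (sym x+w)) F-1+c-≤

    w<F : w < F (4 + e)
    w<F = linear (x ∷ w ∷ F (suc e) ∷ F e ∷ [])
              (λ x w F₁ F₀ → x ⊕ w ≼ 𝔽 4 F₁ F₀ ∷ κ 1 ≼ x ∷ [] ⊢ κ 1 ⊕ w ≼ 𝔽 4 F₁ F₀)
              0 (1 ∷ 1 ∷ []) (≤-reflexive x+w) 1≤x

    image-index : ∀ {u j} → In N u → to u + w ≡ F j → 4 + e ≤ j
    image-index {j = j} iu eq =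
      F-cancel-< {3 + e} {j} (linear (F (suc e) ∷ F e ∷ w ∷ _ ∷ F j ∷ [])
                (λ F₁ F₀ w t₁ G₀ → 𝔽 3 F₁ F₀ ≼ w ∷ t₁ ⊕ w ≼ G₀ ∷ κ 1 ≼ t₁ ∷ []
                  ⊢ κ 1 ⊕ 𝔽 3 F₁ F₀ ≼ G₀)
                0 (1 ∷ 1 ∷ 1 ∷ []) F≤w (≤-reflexive eq) (proj₁ (to-in iu)))

    -- The lowest index 4 + e at `w` is used up by `x`, which is fixed.
    other-image-index : ∀ {u j} → In N u → u ≢ x → to u + w ≡ F j → 5 + e ≤ j
    other-image-index {u} iu u≢x eq with m≤n⇒m<n∨m≡n (image-index iu eq)
    ... | inj₁ 4+e<j = 4+e<j
    ... | inj₂ refl  = ⊥-elim (u≢x (to-injective iu ix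
            (trans (+-cancelʳ-≡ w _ _ (trans eq (sym x+w))) (sym to-x))))

    -- Otherwise F (2 + c) + x is a second neighbour of `v` below `v`, hence fixed. Its sum with `w`
    -- is F (2 + c) + F (4 + e), strictly between F (4 + e) and F (5 + e).
    one-lower-neighbour : v ≤ F (2 + c) + x
    one-lower-neighbour = ≮⇒≥ λ q<v →
      let iq = ≤-trans 1≤x (m≤n+m x (F (2 + c))) , ≤-trans (<⇒≤ q<v) (proj₂ iv)
          j , _ , w-q = adjacent-to (4 + c) iq iv (<⇒≢ q<v) to-v q+v
      in between-not-Fibonacci (4 + e) above below j
           (trans (sym w-q) (cong (_+ w) (fixed (proj₁ iq) q<v)))
      where
      q+v : F (2 + c) + x + v ≡ F (4 + c)
      q+v = ≤-antisym (linear (x ∷ v ∷ F (suc c) ∷ F c ∷ [])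
                (λ x v F₁ F₀ → x ⊕ v ≼ 𝔽 3 F₁ F₀ ∷ [] ⊢ 𝔽 2 F₁ F₀ ⊕ x ⊕ v ≼ 𝔽 4 F₁ F₀)
                0 (1 ∷ []) (≤-reflexive x+v))
              (linear (F (suc c) ∷ F c ∷ x ∷ v ∷ [])
                (λ F₁ F₀ x v → 𝔽 3 F₁ F₀ ≼ x ⊕ v ∷ [] ⊢ 𝔽 4 F₁ F₀ ≼ 𝔽 2 F₁ F₀ ⊕ x ⊕ v)
                0 (1 ∷ []) (≤-reflexive (sym x+v)))
      above : F (4 + e) < F (2 + c) + x + w
      above = linear (F (suc e) ∷ F e ∷ x ∷ w ∷ F c ∷ F (suc c) ∷ [])
                (λ F₁ F₀ x w G₀ G₁ → 𝔽 4 F₁ F₀ ≼ x ⊕ w ∷ κ 1 ≼ G₀ ∷ []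
                  ⊢ κ 1 ⊕ 𝔽 4 F₁ F₀ ≼ 𝔽 2 G₁ G₀ ⊕ x ⊕ w)
                0 (1 ∷ 1 ∷ []) (≤-reflexive (sym x+w)) F-c-pos
      below : F (2 + c) + x + w < F (5 + e)
      below = linear (x ∷ w ∷ F (suc e) ∷ F e ∷ F (suc c) ∷ F c ∷ [])
                (λ x w F₁ F₀ G₁ G₀ → x ⊕ w ≼ 𝔽 4 F₁ F₀ ∷ κ 1 ⊕ 𝔽 2 G₁ G₀ ≼ 𝔽 3 F₁ F₀ ∷ []
                  ⊢ κ 1 ⊕ (𝔽 2 G₁ G₀ ⊕ x ⊕ w) ≼ 𝔽 5 F₁ F₀)
                0 (1 ∷ 1 ∷ []) (≤-reflexive x+w) (F-strict (s≤s (s≤s z≤n)) (s≤s (s≤s (s≤s c≤e))))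

    -- The vertex y = F (2 + c) + x is joined to `v` and to the fixed vertex `z`. Since w - z = F (4
    -- + e) - F (1 + c), the two image edges give F j + F (1 + c) = F i + F (4 + e). By `two-sums`
    -- this needs F (1 + c) = F (2 + e), impossible for c ≤ e.
    not-generic : v < F (2 + c) + x → ∀ {z} → 1 ≤ z → z + x ≡ F (1 + c) → ⊥
    not-generic v<y {z} 1≤z z+x =
      let j , _ , y-w = adjacent-to (4 + c) iy iv (>⇒≢ v<y) to-v y+v
          i , _ , y-z = adjacent-to (3 + c) iy iz (>⇒≢ (<-trans z<v v<y)) (fixed 1≤z z<v) y+z
          _ , k , 4+e≡ , F≡ = two-sums {1 + c} {i} {j} {4 + e} (m≤n⇒m≤1+n 2≤c)
            (s≤s (s≤s (≤-trans c≤e (m≤n⇒m≤1+n (n≤1+n e)))))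
            (other-image-index {j = j} iy (>⇒≢ (<-trans x<v v<y)) y-w)
            (sums {i} {j} y-w y-z)
      in F≢ (trans F≡ (cong F (sym (suc-injective (suc-injective 4+e≡)))))
      where
      y : ℕ
      y = F (2 + c) + x
      y+v : y + v ≡ F (4 + c)
      y+v = ≤-antisym (linear (x ∷ v ∷ F (suc c) ∷ F c ∷ [])
                (λ x v F₁ F₀ → x ⊕ v ≼ 𝔽 3 F₁ F₀ ∷ [] ⊢ 𝔽 2 F₁ F₀ ⊕ x ⊕ v ≼ 𝔽 4 F₁ F₀)
                0 (1 ∷ []) (≤-reflexive x+v))
              (linear (F (suc c) ∷ F c ∷ x ∷ v ∷ [])
                (λ F₁ F₀ x v → 𝔽 3 F₁ F₀ ≼ x ⊕ v ∷ [] ⊢ 𝔽 4 F₁ F₀ ≼ 𝔽 2 F₁ F₀ ⊕ x ⊕ v)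
                0 (1 ∷ []) (≤-reflexive (sym x+v)))
      -- As `y` lies above `v`, its presence must be derived: y ≤ w, because w = F (4 + e) - x and
      -- `x` is at most F (1 + c).
      iy : In N y
      iy = ≤-trans 1≤x (m≤n+m x (F (2 + c))) ,
           (linear (w ∷ N ∷ F (suc e) ∷ F e ∷ x ∷ F (suc c) ∷ F c ∷ [])
                     (λ w N F₁ F₀ x G₁ G₀ →
                       w ≼ N ∷ 𝔽 4 F₁ F₀ ≼ x ⊕ w ∷ x ≼ G₁ ∷ G₀ ≼ F₀ ∷ G₁ ≼ F₁ ∷ []
                       ⊢ 𝔽 2 G₁ G₀ ⊕ x ≼ N)
                     0 (1 ∷ 1 ∷ 2 ∷ 1 ∷ 3 ∷ []) (proj₂ iw) (≤-reflexive (sym x+w)) x≤ F-c-≤ F-1+c-≤)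
      z<v : z < v
      z<v = linear (z ∷ x ∷ F (suc c) ∷ F c ∷ v ∷ [])
                (λ z x F₁ F₀ v → z ⊕ x ≼ F₁ ∷ κ 1 ≼ x ∷ 𝔽 2 F₁ F₀ ≼ v ∷ κ 1 ≼ F₀ ∷ []
                  ⊢ κ 1 ⊕ z ≼ v)
                0 (1 ∷ 1 ∷ 1 ∷ 1 ∷ []) (≤-reflexive z+x) 1≤x lo F-c-pos
      iz : In N z
      iz = 1≤z , ≤-trans (<⇒≤ z<v) (proj₂ iv)
      y+z : y + z ≡ F (3 + c)
      y+z = ≤-antisym (linear (z ∷ x ∷ F (suc c) ∷ F c ∷ [])
                (λ z x F₁ F₀ → z ⊕ x ≼ F₁ ∷ [] ⊢ 𝔽 2 F₁ F₀ ⊕ x ⊕ z ≼ 𝔽 3 F₁ F₀)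
                0 (1 ∷ []) (≤-reflexive z+x))
              (linear (F (suc c) ∷ z ∷ x ∷ F c ∷ [])
                (λ F₁ z x F₀ → F₁ ≼ z ⊕ x ∷ [] ⊢ 𝔽 3 F₁ F₀ ≼ 𝔽 2 F₁ F₀ ⊕ x ⊕ z)
                0 (1 ∷ []) (≤-reflexive (sym z+x)))
      sums : ∀ {i j} → to y + w ≡ F j → to y + z ≡ F i → F j + F (1 + c) ≡ F i + F (4 + e)
      sums {i} {j} y-w y-z = ≤-antisym (linear (F j ∷ _ ∷ w ∷ z ∷ F i ∷ F (suc c) ∷ x ∷ F (suc e) ∷ F e ∷ [])
                (λ F₀ t₁ w z G₀ H₁ x K₁ K₀ →
                  F₀ ≼ t₁ ⊕ w ∷ t₁ ⊕ z ≼ G₀ ∷ H₁ ≼ z ⊕ x ∷ x ⊕ w ≼ 𝔽 4 K₁ K₀ ∷ []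
                  ⊢ F₀ ⊕ H₁ ≼ G₀ ⊕ 𝔽 4 K₁ K₀)
                0 (1 ∷ 1 ∷ 1 ∷ 1 ∷ []) (≤-reflexive (sym y-w)) (≤-reflexive y-z) (≤-reflexive (sym z+x)) (≤-reflexive x+w))
              (linear (_ ∷ w ∷ F j ∷ F i ∷ z ∷ x ∷ F (suc c) ∷ F (suc e) ∷ F e ∷ [])
                (λ t₁ w F₀ G₀ z x H₁ K₁ K₀ →
                  t₁ ⊕ w ≼ F₀ ∷ G₀ ≼ t₁ ⊕ z ∷ z ⊕ x ≼ H₁ ∷ 𝔽 4 K₁ K₀ ≼ x ⊕ w ∷ []
                  ⊢ G₀ ⊕ 𝔽 4 K₁ K₀ ≼ F₀ ⊕ H₁)
                0 (1 ∷ 1 ∷ 1 ∷ 1 ∷ []) (≤-reflexive y-w) (≤-reflexive (sym y-z)) (≤-reflexive z+x) (≤-reflexive (sym x+w)))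
      F≢ : F (1 + c) ≢ F (2 + e)
      F≢ eq = n≮0 (linear (F (suc e) ∷ F e ∷ F (suc c) ∷ F c ∷ [])
                (λ F₁ F₀ G₁ G₀ → 𝔽 2 F₁ F₀ ≼ G₁ ∷ G₁ ≼ F₁ ∷ G₀ ≼ F₀ ∷ κ 1 ≼ G₀ ∷ [] ⊢ κ 1 ≼ κ 0)
                0 (1 ∷ 1 ∷ 1 ∷ 1 ∷ []) (≤-reflexive (sym eq)) F-1+c-≤ F-c-≤ F-c-pos)

    4+e≤J : ∀ {J} → N + v < F (1 + J) → 4 + e ≤ J
    4+e≤J {J} N+v< = ≤-pred (F-cancel-< {4 + e} {1 + J} (linear (N ∷ v ∷ F (suc J) ∷ F (suc e) ∷ F e ∷ x ∷ w ∷ [])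
              (λ N v F₁ G₁ G₀ x w →
                κ 1 ⊕ (N ⊕ v) ≼ F₁ ∷ 𝔽 4 G₁ G₀ ≼ x ⊕ w ∷ w ≼ N ∷ κ 1 ⊕ x ≼ v ∷ []
                ⊢ κ 1 ⊕ 𝔽 4 G₁ G₀ ≼ F₁)
              0 (1 ∷ 1 ∷ 1 ∷ 1 ∷ []) N+v< (≤-reflexive (sym x+w)) (proj₂ iw) x<v))

    -- Since w < F (4 + e) ≤ F J, the sum N + w stays below F (1 + J) + F J. So moving from `v` to
    -- `w` raises the top index by at most one.
    overrun : ∀ {J B} → N + v < F (1 + J) → F B ≤ N + w → B < 2 + J
    overrun {J} {B} N+v< ≤N+w = ≰⇒> λ J≤B →
      (n≮0 (linear (N ∷ v ∷ F (suc J) ∷ F B ∷ w ∷ F J ∷ F (suc e) ∷ F e ∷ [])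
                (λ N v F₁ G₀ w F₀ H₁ H₀ →
                  κ 1 ⊕ (N ⊕ v) ≼ F₁ ∷ G₀ ≼ N ⊕ w ∷ 𝔽 2 F₁ F₀ ≼ G₀ ∷ κ 1 ⊕ w ≼ 𝔽 4 H₁ H₀ ∷
                  𝔽 4 H₁ H₀ ≼ F₀ ∷ []
                  ⊢ κ 1 ≼ κ 0)
                0 (1 ∷ 1 ∷ 1 ∷ 1 ∷ 1 ∷ []) N+v< ≤N+w (F-mono J≤B) w<F (F-mono (4+e≤J {J} N+v<))))

    -- Here v = F (2 + c), and 2 v is not Fibonacci, so every index from 3 + c to `J` gives a
    -- neighbour. The images start at 4 + e, so preserving the degree would raise the top index by
    -- at least two, against `overrun`.
    not-shifted-far : x ≡ F (1 + c) → 1 + c ≤ e → ⊥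
    not-shifted-far x≡ c<e with locate (N + v) (m≤n⇒m≤o+n N (proj₁ iv)) | locate (N + w) (m≤n⇒m≤o+n N (proj₁ iw))
    ... | J , _ , J-lo , J-hi | B , _ , B-lo , B-hi = gap-contradiction (degree {v} {3 + c} {J} {4 + e} {B} iv
            (s≤s (s≤s z≤n)) 3+c≤J good target)
      where
      3+c≤J : 3 + c ≤ J
      3+c≤J = ≤-trans (s≤s (s≤s (s≤s (≤-trans c≤e (n≤1+n e))))) (4+e≤J {J} J-hi)
      v≡ : v ≡ F (2 + c)
      v≡ = ≤-antisym (linear (x ∷ v ∷ F (suc c) ∷ F c ∷ [])
                (λ x v F₁ F₀ → x ⊕ v ≼ 𝔽 3 F₁ F₀ ∷ F₁ ≼ x ∷ [] ⊢ v ≼ 𝔽 2 F₁ F₀)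
                0 (1 ∷ 1 ∷ []) (≤-reflexive x+v) (≤-reflexive (sym x≡)))
              (linear (F (suc c) ∷ F c ∷ x ∷ v ∷ [])
                (λ F₁ F₀ x v → 𝔽 3 F₁ F₀ ≼ x ⊕ v ∷ x ≼ F₁ ∷ [] ⊢ 𝔽 2 F₁ F₀ ≼ v)
                0 (1 ∷ 1 ∷ []) (≤-reflexive (sym x+v)) (≤-reflexive x≡))
      good : ∀ i → 3 + c ≤ i → i ≤ J → v < F i × F i ≤ N + v × v + v ≢ F i
      good i lo′ hi′ = <-≤-trans hi (F-mono lo′) , ≤-trans (F-mono hi′) J-lo ,
        λ eq → between-not-Fibonacci (3 + c) (linear (F (suc c) ∷ F c ∷ v ∷ [])
                  (λ F₁ F₀ v → 𝔽 2 F₁ F₀ ≼ v ∷ κ 1 ≼ F₀ ∷ [] ⊢ κ 1 ⊕ 𝔽 3 F₁ F₀ ≼ v ⊕ v)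
                  0 (2 ∷ 1 ∷ []) (≤-reflexive (sym v≡)) F-c-pos) (linear (v ∷ F (suc c) ∷ F c ∷ [])
                  (λ v F₁ F₀ → v ≼ 𝔽 2 F₁ F₀ ∷ κ 1 ⊕ F₀ ≼ F₁ ∷ [] ⊢ κ 1 ⊕ (v ⊕ v) ≼ 𝔽 4 F₁ F₀)
                  0 (2 ∷ 1 ∷ []) (≤-reflexive v≡) F-c-<) i (sym eq)
      target : ∀ {i j u} → 3 + c ≤ i → i ≤ J → In N u → u ≢ v → u + v ≡ F i →
               to u + to v ≡ F j → 4 + e ≤ j × j ≤ B
      target {j = j} _ _ iu _ _ eq rewrite to-v = image-index iu eq ,
        ≤-pred (F-cancel-< {j} {1 + B} (linear (F j ∷ _ ∷ w ∷ N ∷ F (suc B) ∷ [])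
                  (λ F₀ t₁ w N G₁ → F₀ ≼ t₁ ⊕ w ∷ t₁ ≼ N ∷ κ 1 ⊕ (N ⊕ w) ≼ G₁ ∷ []
                    ⊢ κ 1 ⊕ F₀ ≼ G₁)
                  0 (1 ∷ 1 ∷ 1 ∷ []) (≤-reflexive (sym eq)) (proj₂ (to-in iu)) B-hi))
      gap-contradiction : J + (4 + e) ≤ B + (3 + c) → ⊥
      gap-contradiction p = <⇒≱ (overrun {J} {B} J-hi B-lo) (linear (J ∷ e ∷ B ∷ c ∷ [])
                (λ J e B c →
                  J ⊕ (κ 1 ⊕ (κ 1 ⊕ (κ 1 ⊕ (κ 1 ⊕ e)))) ≼ B ⊕ (κ 1 ⊕ (κ 1 ⊕ (κ 1 ⊕ c))) ∷
                  κ 1 ⊕ c ≼ e ∷ []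
                  ⊢ κ 1 ⊕ (κ 1 ⊕ J) ≼ B)
                0 (1 ∷ 1 ∷ []) p c<e)

    -- Now 2 v = F (4 + c) is a loop, so the count starts just above it, at 5 + c. This omits `x`
    -- too, and the images then start at 5 + e: the top index would rise by e - c, which is at least
    -- two.
    not-shifted-far′ : x + x ≡ F (1 + c) → 2 + c ≤ e → ⊥
    not-shifted-far′ 2x≡ c<e with locate (N + v) (m≤n⇒m≤o+n N (proj₁ iv)) | locate (N + w) (m≤n⇒m≤o+n N (proj₁ iw))
    ... | J , _ , J-lo , J-hi | B , _ , B-lo , B-hi = gap-contradiction (degree {v} {5 + c} {J} {5 + e} {B} iv
            (s≤s (s≤s z≤n)) 5+c≤J good target)
      where
      5+c≤J : 5 + c ≤ J
      5+c≤J = ≤-trans (linear (c ∷ e ∷ [])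
                (λ c e → κ 1 ⊕ (κ 1 ⊕ c) ≼ e ∷ []
                  ⊢ κ 1 ⊕ (κ 1 ⊕ (κ 1 ⊕ (κ 1 ⊕ (κ 1 ⊕ c)))) ≼ κ 1 ⊕ (κ 1 ⊕ (κ 1 ⊕ (κ 1 ⊕ e))))
                0 (1 ∷ []) c<e) (4+e≤J {J} J-hi)
      2v≡ : v + v ≡ F (4 + c)
      2v≡ = ≤-antisym (linear (x ∷ v ∷ F (suc c) ∷ F c ∷ [])
                (λ x v F₁ F₀ → x ⊕ v ≼ 𝔽 3 F₁ F₀ ∷ F₁ ≼ x ⊕ x ∷ [] ⊢ v ⊕ v ≼ 𝔽 4 F₁ F₀)
                0 (2 ∷ 1 ∷ []) (≤-reflexive x+v) (≤-reflexive (sym 2x≡)))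
              (linear (F (suc c) ∷ F c ∷ x ∷ v ∷ [])
                (λ F₁ F₀ x v → 𝔽 3 F₁ F₀ ≼ x ⊕ v ∷ x ⊕ x ≼ F₁ ∷ [] ⊢ 𝔽 4 F₁ F₀ ≼ v ⊕ v)
                0 (2 ∷ 1 ∷ []) (≤-reflexive (sym x+v)) (≤-reflexive 2x≡))
      good : ∀ i → 5 + c ≤ i → i ≤ J → v < F i × F i ≤ N + v × v + v ≢ F i
      good i lo′ hi′ = <-≤-trans (linear (v ∷ F (suc c) ∷ F c ∷ [])
                (λ v F₁ F₀ → κ 1 ⊕ v ≼ 𝔽 3 F₁ F₀ ∷ κ 1 ≼ F₀ ∷ [] ⊢ κ 1 ⊕ v ≼ 𝔽 5 F₁ F₀)
                1 (5 ∷ 1 ∷ []) hi F-c-pos) (F-mono lo′) , ≤-trans (F-mono hi′) J-lo ,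
        <⇒≢ (<-≤-trans (linear (v ∷ F (suc c) ∷ F c ∷ [])
                  (λ v F₁ F₀ → v ⊕ v ≼ 𝔽 4 F₁ F₀ ∷ κ 1 ⊕ F₀ ≼ F₁ ∷ κ 1 ≼ F₀ ∷ []
                    ⊢ κ 1 ⊕ (v ⊕ v) ≼ 𝔽 5 F₁ F₀)
                  0 (1 ∷ 2 ∷ 3 ∷ []) (≤-reflexive 2v≡) F-c-< F-c-pos) (F-mono lo′))
      target : ∀ {i j u} → 5 + c ≤ i → i ≤ J → In N u → u ≢ v → u + v ≡ F i →
               to u + to v ≡ F j → 5 + e ≤ j × j ≤ B
      target {i} {j} {u} lo′ _ iu _ u+v eq rewrite to-v =
        other-image-index iu (λ u≡x → (n≮0 (linear (u ∷ v ∷ x ∷ F (suc c) ∷ F c ∷ F i ∷ [])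
                  (λ u v x F₁ F₀ G₀ →
                    u ⊕ v ≼ x ⊕ v ∷ x ⊕ v ≼ 𝔽 3 F₁ F₀ ∷ G₀ ≼ u ⊕ v ∷ 𝔽 5 F₁ F₀ ≼ G₀ ∷ κ 1 ≼ F₀ ∷ []
                    ⊢ κ 1 ≼ κ 0)
                  0 (1 ∷ 1 ∷ 1 ∷ 1 ∷ 2 ∷ []) (≤-reflexive (cong (_+ v) u≡x)) (≤-reflexive x+v) (≤-reflexive (sym u+v)) (F-mono lo′) F-c-pos))) eq ,
        ≤-pred (F-cancel-< {j} {1 + B} (linear (F j ∷ _ ∷ w ∷ N ∷ F (suc B) ∷ [])
                  (λ F₀ t₁ w N G₁ → F₀ ≼ t₁ ⊕ w ∷ t₁ ≼ N ∷ κ 1 ⊕ (N ⊕ w) ≼ G₁ ∷ []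
                    ⊢ κ 1 ⊕ F₀ ≼ G₁)
                  0 (1 ∷ 1 ∷ 1 ∷ []) (≤-reflexive (sym eq)) (proj₂ (to-in iu)) B-hi))
      gap-contradiction : J + (5 + e) ≤ B + (5 + c) → ⊥
      gap-contradiction p = <⇒≱ (overrun {J} {B} J-hi B-lo) (linear (J ∷ e ∷ B ∷ c ∷ [])
                (λ J e B c →
                  J ⊕ (κ 1 ⊕ (κ 1 ⊕ (κ 1 ⊕ (κ 1 ⊕ (κ 1 ⊕ e))))) ≼ B ⊕ (κ 1 ⊕ (κ 1 ⊕ (κ 1 ⊕ (κ 1 ⊕ (κ 1 ⊕ c))))) ∷
                  κ 1 ⊕ (κ 1 ⊕ c) ≼ e ∷ []
                  ⊢ κ 1 ⊕ (κ 1 ⊕ J) ≼ B)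
                0 (1 ∷ 1 ∷ []) p c<e)

    -- The vertex u = F (3 + c) + F (1 + c) is joined to `w` and to F c, so its preimage is joined
    -- to v = F (2 + c) and to the fixed F c. By `two-sums` the first edge has sum F (3 + c), which
    -- makes the preimage `x`; but `x` is fixed.
    not-shifted-once : x ≡ F (1 + c) → e ≢ c
    not-shifted-once x≡ refl =
      let j , _ , y-w = adjacent-to (4 + c) iy iv (>⇒≢ hi) to-v y+v
          iu = 1≤u , u≤N {j} y-w (other-image-index {j = j} iy (>⇒≢ (<-trans x<v hi)) y-w)
          i , _ , p-v = A⁻¹.adjacent-to (5 + c) iu iw (>⇒≢ w<u) from-w u+w
          l , _ , p-F = A⁻¹.adjacent-to (4 + c) iu iF (>⇒≢ (<-trans F-c<v (<-trans v<w w<u)))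
                          (from-fixed F-c-pos F-c<v) (+-assoc (F (3 + c)) _ _)
          i≡ , _ = two-sums {c} {l} {i} {2 + c} 2≤c (n≤1+n (1 + c))
            (F-cancel-< {2 + c} {i} (above {i = i} p-v (proj₁ (from-in iu)))) (sums {i = i} {l} p-v p-F)
          p≡x = +-cancelʳ-≡ v (from u) x (trans p-v (trans (cong F i≡) (sym x+v)))
      in u≢x (trans (sym (to-from iu)) (trans (cong to p≡x) to-x))
      where
      u : ℕ
      u = F (3 + c) + F (1 + c)
      y+v : F (3 + c) + v ≡ F (4 + c)
      y+v = ≤-antisym (linear (x ∷ v ∷ F (suc c) ∷ F c ∷ [])
                (λ x v F₁ F₀ → x ⊕ v ≼ 𝔽 3 F₁ F₀ ∷ F₁ ≼ x ∷ [] ⊢ 𝔽 3 F₁ F₀ ⊕ v ≼ 𝔽 4 F₁ F₀)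
                0 (1 ∷ 1 ∷ []) (≤-reflexive x+v) (≤-reflexive (sym x≡)))
              (linear (F (suc c) ∷ F c ∷ x ∷ v ∷ [])
                (λ F₁ F₀ x v → 𝔽 3 F₁ F₀ ≼ x ⊕ v ∷ x ≼ F₁ ∷ [] ⊢ 𝔽 4 F₁ F₀ ≼ 𝔽 3 F₁ F₀ ⊕ v)
                0 (1 ∷ 1 ∷ []) (≤-reflexive (sym x+v)) (≤-reflexive x≡))
      iy : In N (F (3 + c))
      iy = ≤-trans (proj₁ iv) (<⇒≤ hi) , (linear (w ∷ N ∷ F (suc c) ∷ F c ∷ x ∷ [])
                (λ w N F₁ F₀ x → w ≼ N ∷ 𝔽 4 F₁ F₀ ≼ x ⊕ w ∷ x ≼ F₁ ∷ [] ⊢ 𝔽 3 F₁ F₀ ≼ N)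
                0 (1 ∷ 1 ∷ 1 ∷ []) (proj₂ iw) (≤-reflexive (sym x+w)) (≤-reflexive x≡))
      u+w : u + w ≡ F (5 + c)
      u+w = ≤-antisym (linear (x ∷ w ∷ F (suc c) ∷ F c ∷ [])
                (λ x w F₁ F₀ → x ⊕ w ≼ 𝔽 4 F₁ F₀ ∷ F₁ ≼ x ∷ [] ⊢ 𝔽 3 F₁ F₀ ⊕ F₁ ⊕ w ≼ 𝔽 5 F₁ F₀)
                0 (1 ∷ 1 ∷ []) (≤-reflexive x+w) (≤-reflexive (sym x≡)))
              (linear (F (suc c) ∷ F c ∷ x ∷ w ∷ [])
                (λ F₁ F₀ x w → 𝔽 4 F₁ F₀ ≼ x ⊕ w ∷ x ≼ F₁ ∷ [] ⊢ 𝔽 5 F₁ F₀ ≼ 𝔽 3 F₁ F₀ ⊕ F₁ ⊕ w)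
                0 (1 ∷ 1 ∷ []) (≤-reflexive (sym x+w)) (≤-reflexive x≡))
      w<u : w < u
      w<u = linear (x ∷ w ∷ F (suc c) ∷ F c ∷ [])
                (λ x w F₁ F₀ → x ⊕ w ≼ 𝔽 4 F₁ F₀ ∷ F₁ ≼ x ∷ κ 1 ⊕ F₀ ≼ F₁ ∷ []
                  ⊢ κ 1 ⊕ w ≼ 𝔽 3 F₁ F₀ ⊕ F₁)
                0 (1 ∷ 1 ∷ 1 ∷ []) (≤-reflexive x+w) (≤-reflexive (sym x≡)) F-c-<
      1≤u : 1 ≤ u
      1≤u = linear (F c ∷ F (suc c) ∷ [])
                (λ F₀ F₁ → κ 1 ≼ F₀ ∷ [] ⊢ κ 1 ≼ 𝔽 3 F₁ F₀ ⊕ F₁)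
                0 (1 ∷ []) F-c-pos
      -- F (3 + c) is a neighbour of `v` other than `x`, so its image is a neighbour of `w` at index
      -- 5 + c or more. Such a neighbour is at least F (5 + c) - w = u.
      u≤N : ∀ {j} → to (F (3 + c)) + w ≡ F j → 5 + c ≤ j → u ≤ N
      u≤N {j} y-w 5+c≤j = linear (x ∷ w ∷ F (suc c) ∷ F c ∷ _ ∷ N ∷ F j ∷ [])
                (λ x w F₁ F₀ t₁ N G₀ →
                  x ⊕ w ≼ 𝔽 4 F₁ F₀ ∷ F₁ ≼ x ∷ t₁ ≼ N ∷ G₀ ≼ t₁ ⊕ w ∷ 𝔽 5 F₁ F₀ ≼ G₀ ∷ []
                  ⊢ 𝔽 3 F₁ F₀ ⊕ F₁ ≼ N)
                0 (1 ∷ 1 ∷ 1 ∷ 1 ∷ 1 ∷ []) (≤-reflexive x+w) (≤-reflexive (sym x≡)) (proj₂ (to-in iy)) (≤-reflexive (sym y-w)) (F-mono 5+c≤j)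
      u≢x : u ≢ x
      u≢x eq = n≮0 (linear (F (suc c) ∷ F c ∷ x ∷ [])
                (λ F₁ F₀ x → 𝔽 3 F₁ F₀ ⊕ F₁ ≼ x ∷ x ≼ F₁ ∷ κ 1 ≼ F₀ ∷ [] ⊢ κ 1 ≼ κ 0)
                0 (1 ∷ 1 ∷ 1 ∷ []) (≤-reflexive eq) (≤-reflexive x≡) F-c-pos)
      F-c<v : F c < v
      F-c<v = linear (F (suc c) ∷ F c ∷ v ∷ [])
                (λ F₁ F₀ v → 𝔽 2 F₁ F₀ ≼ v ∷ κ 1 ⊕ F₀ ≼ F₁ ∷ [] ⊢ κ 1 ⊕ F₀ ≼ v)
                0 (1 ∷ 1 ∷ []) lo F-c-<
      iF : In N (F c)
      iF = F-c-pos , ≤-trans (<⇒≤ F-c<v) (proj₂ iv)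
      above : ∀ {p i} → p + v ≡ F i → 1 ≤ p → F (2 + c) < F i
      above {p} {i} p-v 1≤p = linear (p ∷ v ∷ F i ∷ F (suc c) ∷ F c ∷ x ∷ [])
                (λ p v F₀ G₁ G₀ x → p ⊕ v ≼ F₀ ∷ 𝔽 3 G₁ G₀ ≼ x ⊕ v ∷ x ≼ G₁ ∷ κ 1 ≼ p ∷ []
                  ⊢ κ 1 ⊕ 𝔽 2 G₁ G₀ ≼ F₀)
                0 (1 ∷ 1 ∷ 1 ∷ 1 ∷ []) (≤-reflexive p-v) (≤-reflexive (sym x+v)) (≤-reflexive x≡) 1≤p
      sums : ∀ {p i l} → p + v ≡ F i → p + F c ≡ F l → F i + F c ≡ F l + F (2 + c)
      sums {p} {i} {l} p-v p-F = ≤-antisym (linear (F i ∷ p ∷ v ∷ F c ∷ F l ∷ x ∷ F (suc c) ∷ [])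
                (λ F₀ p v G₀ H₀ x G₁ → F₀ ≼ p ⊕ v ∷ p ⊕ G₀ ≼ H₀ ∷ x ⊕ v ≼ 𝔽 3 G₁ G₀ ∷ G₁ ≼ x ∷ []
                  ⊢ F₀ ⊕ G₀ ≼ H₀ ⊕ 𝔽 2 G₁ G₀)
                0 (1 ∷ 1 ∷ 1 ∷ 1 ∷ []) (≤-reflexive (sym p-v)) (≤-reflexive p-F) (≤-reflexive x+v) (≤-reflexive (sym x≡)))
              (linear (p ∷ v ∷ F i ∷ F l ∷ F c ∷ F (suc c) ∷ x ∷ [])
                (λ p v F₀ G₀ H₀ H₁ x → p ⊕ v ≼ F₀ ∷ G₀ ≼ p ⊕ H₀ ∷ 𝔽 3 H₁ H₀ ≼ x ⊕ v ∷ x ≼ H₁ ∷ []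
                  ⊢ G₀ ⊕ 𝔽 2 H₁ H₀ ≼ F₀ ⊕ H₀)
                0 (1 ∷ 1 ∷ 1 ∷ 1 ∷ []) (≤-reflexive p-v) (≤-reflexive (sym p-F)) (≤-reflexive (sym x+v)) (≤-reflexive x≡))

    -- The vertex y = F (3 + c) + x is joined to `w` and to the fixed vertex z = F (2 + c) - x, so
    -- its preimage is joined to `v` and `z`, whose difference is F (3 + c) - F (2 + c). If the edge
    -- to `v` has sum F (3 + c), the preimage is `x`; any larger sum is excluded by `two-sums`.
    not-shifted-once′ : x + x ≡ F (1 + c) → ∀ {z} → z + x ≡ F (2 + c) → e ≢ c
    not-shifted-once′ 2x≡ {z} z+x refl =
      let i , _ , q-v = A⁻¹.adjacent-to (5 + c) iy iw y≢w from-w y+w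
          j , _ , q-z = A⁻¹.adjacent-to (4 + c) iy iz y≢z (from-fixed 1≤z z<v) y+z
          3+c≤i = F-cancel-< {2 + c} {i} (above {i = i} q-v (proj₁ (from-in iy)))
          _ , k , 3+c≡ , F≡ = two-sums {2 + c} {j} {i} {3 + c} (s≤s (s≤s z≤n)) ≤-refl
            (≤∧≢⇒< 3+c≤i (λ 3+c≡i → q≢x (+-cancelʳ-≡ v (from y) x
              (trans q-v (trans (cong F (sym 3+c≡i)) (sym x+v))))))
            (sums {i = i} {j} q-v q-z)
      in F≢ (trans F≡ (cong F (sym (suc-injective (suc-injective 3+c≡)))))
      where
      y : ℕ
      y = F (3 + c) + x
      1≤z : 1 ≤ z
      1≤z = linear (F (suc c) ∷ F c ∷ z ∷ x ∷ [])
                (λ F₁ F₀ z x → 𝔽 2 F₁ F₀ ≼ z ⊕ x ∷ x ≼ F₁ ∷ κ 1 ≼ F₀ ∷ [] ⊢ κ 1 ≼ z)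
                0 (1 ∷ 1 ∷ 1 ∷ []) (≤-reflexive (sym z+x)) x≤ F-c-pos
      z<v : z < v
      z<v = linear (z ∷ x ∷ F (suc c) ∷ F c ∷ v ∷ [])
                (λ z x F₁ F₀ v → z ⊕ x ≼ 𝔽 2 F₁ F₀ ∷ 𝔽 2 F₁ F₀ ≼ v ∷ κ 1 ≼ x ∷ [] ⊢ κ 1 ⊕ z ≼ v)
                0 (1 ∷ 1 ∷ 1 ∷ []) (≤-reflexive z+x) lo 1≤x
      iz : In N z
      iz = 1≤z , ≤-trans (<⇒≤ z<v) (proj₂ iv)
      iy : In N y
      iy = ≤-trans 1≤x (m≤n+m x (F (3 + c))) , (linear (w ∷ N ∷ F (suc c) ∷ F c ∷ x ∷ [])
                (λ w N F₁ F₀ x → w ≼ N ∷ 𝔽 4 F₁ F₀ ≼ x ⊕ w ∷ x ⊕ x ≼ F₁ ∷ [] ⊢ 𝔽 3 F₁ F₀ ⊕ x ≼ N)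
                0 (1 ∷ 1 ∷ 1 ∷ []) (proj₂ iw) (≤-reflexive (sym x+w)) (≤-reflexive 2x≡))
      y+w : y + w ≡ F (5 + c)
      y+w = ≤-antisym (linear (x ∷ w ∷ F (suc c) ∷ F c ∷ [])
                (λ x w F₁ F₀ → x ⊕ w ≼ 𝔽 4 F₁ F₀ ∷ [] ⊢ 𝔽 3 F₁ F₀ ⊕ x ⊕ w ≼ 𝔽 5 F₁ F₀)
                0 (1 ∷ []) (≤-reflexive x+w))
              (linear (F (suc c) ∷ F c ∷ x ∷ w ∷ [])
                (λ F₁ F₀ x w → 𝔽 4 F₁ F₀ ≼ x ⊕ w ∷ [] ⊢ 𝔽 5 F₁ F₀ ≼ 𝔽 3 F₁ F₀ ⊕ x ⊕ w)
                0 (1 ∷ []) (≤-reflexive (sym x+w)))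
      y+z : y + z ≡ F (4 + c)
      y+z = ≤-antisym (linear (z ∷ x ∷ F (suc c) ∷ F c ∷ [])
                (λ z x F₁ F₀ → z ⊕ x ≼ 𝔽 2 F₁ F₀ ∷ [] ⊢ 𝔽 3 F₁ F₀ ⊕ x ⊕ z ≼ 𝔽 4 F₁ F₀)
                0 (1 ∷ []) (≤-reflexive z+x))
              (linear (F (suc c) ∷ F c ∷ z ∷ x ∷ [])
                (λ F₁ F₀ z x → 𝔽 2 F₁ F₀ ≼ z ⊕ x ∷ [] ⊢ 𝔽 4 F₁ F₀ ≼ 𝔽 3 F₁ F₀ ⊕ x ⊕ z)
                0 (1 ∷ []) (≤-reflexive (sym z+x)))
      y≢w : y ≢ w
      y≢w eq = n≮0 (linear (w ∷ F (suc c) ∷ F c ∷ x ∷ [])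
                (λ w F₁ F₀ x → w ≼ 𝔽 3 F₁ F₀ ⊕ x ∷ 𝔽 4 F₁ F₀ ≼ x ⊕ w ∷ x ⊕ x ≼ F₁ ∷ κ 1 ≼ F₀ ∷ []
                  ⊢ κ 1 ≼ κ 0)
                0 (1 ∷ 1 ∷ 1 ∷ 1 ∷ []) (≤-reflexive (sym eq)) (≤-reflexive (sym x+w)) (≤-reflexive 2x≡) F-c-pos)
      y≢z : y ≢ z
      y≢z eq = n≮0 (linear (F (suc c) ∷ F c ∷ x ∷ z ∷ [])
                (λ F₁ F₀ x z → 𝔽 3 F₁ F₀ ⊕ x ≼ z ∷ z ⊕ x ≼ 𝔽 2 F₁ F₀ ∷ κ 1 ⊕ F₀ ≼ F₁ ∷ []
                  ⊢ κ 1 ≼ κ 0)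
                0 (1 ∷ 1 ∷ 1 ∷ []) (≤-reflexive eq) (≤-reflexive z+x) F-c-<)
      above : ∀ {q i} → q + v ≡ F i → 1 ≤ q → F (2 + c) < F i
      above {q} {i} q-v 1≤q = linear (q ∷ v ∷ F i ∷ F (suc c) ∷ F c ∷ [])
                (λ q v F₀ G₁ G₀ → q ⊕ v ≼ F₀ ∷ 𝔽 2 G₁ G₀ ≼ v ∷ κ 1 ≼ q ∷ []
                  ⊢ κ 1 ⊕ 𝔽 2 G₁ G₀ ≼ F₀)
                0 (1 ∷ 1 ∷ 1 ∷ []) (≤-reflexive q-v) lo 1≤q
      q≢x : from y ≢ x
      q≢x q≡x = y≢x (trans (sym (to-from iy)) (trans (cong to q≡x) to-x))
        where
        y≢x : y ≢ x
        y≢x eq = n≮0 (linear (F (suc c) ∷ F c ∷ x ∷ [])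
                  (λ F₁ F₀ x → 𝔽 3 F₁ F₀ ⊕ x ≼ x ∷ κ 1 ≼ F₀ ∷ [] ⊢ κ 1 ≼ κ 0)
                  0 (1 ∷ 1 ∷ []) (≤-reflexive eq) F-c-pos)
      sums : ∀ {q i j} → q + v ≡ F i → q + z ≡ F j → F i + F (2 + c) ≡ F j + F (3 + c)
      sums {q} {i} {j} q-v q-z = ≤-antisym (linear (F i ∷ q ∷ v ∷ z ∷ F j ∷ F (suc c) ∷ F c ∷ x ∷ [])
                (λ F₀ q v z G₀ H₁ H₀ x →
                  F₀ ≼ q ⊕ v ∷ q ⊕ z ≼ G₀ ∷ 𝔽 2 H₁ H₀ ≼ z ⊕ x ∷ x ⊕ v ≼ 𝔽 3 H₁ H₀ ∷ []
                  ⊢ F₀ ⊕ 𝔽 2 H₁ H₀ ≼ G₀ ⊕ 𝔽 3 H₁ H₀)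
                0 (1 ∷ 1 ∷ 1 ∷ 1 ∷ []) (≤-reflexive (sym q-v)) (≤-reflexive q-z) (≤-reflexive (sym z+x)) (≤-reflexive x+v))
              (linear (q ∷ v ∷ F i ∷ F j ∷ z ∷ x ∷ F (suc c) ∷ F c ∷ [])
                (λ q v F₀ G₀ z x H₁ H₀ →
                  q ⊕ v ≼ F₀ ∷ G₀ ≼ q ⊕ z ∷ z ⊕ x ≼ 𝔽 2 H₁ H₀ ∷ 𝔽 3 H₁ H₀ ≼ x ⊕ v ∷ []
                  ⊢ G₀ ⊕ 𝔽 3 H₁ H₀ ≼ F₀ ⊕ 𝔽 2 H₁ H₀)
                0 (1 ∷ 1 ∷ 1 ∷ 1 ∷ []) (≤-reflexive q-v) (≤-reflexive (sym q-z)) (≤-reflexive z+x) (≤-reflexive (sym x+v)))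
      F≢ : F (2 + c) ≢ F (1 + c)
      F≢ eq = n≮0 (linear (F (suc c) ∷ F c ∷ [])
                (λ F₁ F₀ → 𝔽 2 F₁ F₀ ≼ F₁ ∷ κ 1 ≼ F₀ ∷ [] ⊢ κ 1 ≼ κ 0)
                0 (1 ∷ 1 ∷ []) (≤-reflexive eq) F-c-pos)

  -- Comparing `v` with F (2 + c) + x leaves two boundary cases: x = F (1 + c), where no shift
  -- survives, and v = F (2 + c) + x, where 2 x = F (1 + c) and only a shift by one more than the
  -- minimum survives.
  tripled : x + x ≡ F (1 + c) × x + w ≡ F (5 + c)
  tripled with shift
  ... | e , c≤e , x+w = cases (<-cmp v (F (2 + c) + x)) (m≤n⇒m<n∨m≡n x≤)
    where
    open Shifted c≤e x+w
    halved : v ≡ F (2 + c) + x → x + x ≡ F (1 + c)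
    halved v≡ = ≤-antisym (linear (x ∷ v ∷ F (suc c) ∷ F c ∷ [])
              (λ x v F₁ F₀ → x ⊕ v ≼ 𝔽 3 F₁ F₀ ∷ 𝔽 2 F₁ F₀ ⊕ x ≼ v ∷ [] ⊢ x ⊕ x ≼ F₁)
              0 (1 ∷ 1 ∷ []) (≤-reflexive x+v) (≤-reflexive (sym v≡)))
            (linear (F (suc c) ∷ F c ∷ x ∷ v ∷ [])
              (λ F₁ F₀ x v → 𝔽 3 F₁ F₀ ≼ x ⊕ v ∷ v ≼ 𝔽 2 F₁ F₀ ⊕ x ∷ [] ⊢ F₁ ≼ x ⊕ x)
              0 (1 ∷ 1 ∷ []) (≤-reflexive (sym x+v)) (≤-reflexive v≡))
    cases : _ → x < F (1 + c) ⊎ x ≡ F (1 + c) → x + x ≡ F (1 + c) × x + w ≡ F (5 + c)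
    cases (tri> _ _ y<v) _ = ⊥-elim (<⇒≱ y<v one-lower-neighbour)
    cases (tri< v<y _ _) (inj₁ x<) = ⊥-elim (not-generic v<y (m<n⇒0<n∸m x<) (m∸n+n≡m (<⇒≤ x<)))
    cases (tri< _ _ _) (inj₂ x≡) with m≤n⇒m<n∨m≡n c≤e
    ... | inj₁ c<e = ⊥-elim (not-shifted-far x≡ c<e)
    ... | inj₂ c≡e = ⊥-elim (not-shifted-once x≡ (sym c≡e))
    cases (tri≈ _ v≡y _) _ with m≤n⇒m<n∨m≡n c≤e
    ... | inj₂ c≡e = ⊥-elim (not-shifted-once′ (halved v≡y)
        (m∸n+n≡m (≤-trans x≤ (F-step (1 + c)))) (sym c≡e))
    ... | inj₁ c<e with m≤n⇒m<n∨m≡n c<e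
    ...   | inj₁ 1+c<e = ⊥-elim (not-shifted-far′ (halved v≡y) 1+c<e)
    ...   | inj₂ 1+c≡e = halved v≡y , trans x+w (cong (λ e → F (4 + e)) (sym 1+c≡e))

-- The bound on `N` says that F (7 + c) - x, the far neighbour of `x` used in the forbidden path, is
-- not a vertex.
least-moved : ∀ {N} (A : Auto N) {c v} → 2 ≤ c → In N v → F (2 + c) ≤ v → v < F (3 + c) →
              (∀ {u} → 1 ≤ u → u < v → Auto.to A u ≡ u) →
              ∀ {w} → Auto.to A v ≡ w → w ≢ v → ∀ {x} → x + v ≡ F (3 + c) →
              x + x ≡ F (1 + c) × x + w ≡ F (5 + c) × N + x < F (7 + c)
least-moved {N} A {c} {v} 2≤c iv lo hi fixed {w} to-v moved {x} x+v =
  2x , x+w , ≰⇒> λ large →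
    no-path (m∸n+n≡m (≤-trans x≤ x-small)) (m∸n+n≡m (≤-trans (m≤n+m w x) (≤-trans (≤-reflexive x+w) w-small))) large
  where
  open LeastMoved A 2≤c iv lo hi fixed to-v moved x+v
  2x : x + x ≡ F (1 + c)
  2x = proj₁ tripled
  x+w : x + w ≡ F (5 + c)
  x+w = proj₂ tripled
  x-small : F (1 + c) ≤ F (7 + c)
  x-small = linear (F (suc c) ∷ F c ∷ [])
            (λ F₁ F₀ → [] ⊢ F₁ ≼ 𝔽 7 F₁ F₀)
            0 []
  w-small : F (5 + c) ≤ F (7 + c)
  w-small = linear (F (suc c) ∷ F c ∷ [])
            (λ F₁ F₀ → [] ⊢ 𝔽 5 F₁ F₀ ≼ 𝔽 7 F₁ F₀)
            0 []

  -- The inverse has the same least moved vertex, and x + _ = F (5 + c) has one solution; hence `A`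
  -- exchanges `v` and `w`.
  from-v : from v ≡ w
  from-v = +-cancelˡ-≡ x _ _ (trans (proj₂ inverse-tripled) (sym x+w))
    where
    inverse-tripled = LeastMoved.tripled (inverse A) 2≤c iv lo hi from-fixed refl
      (λ eq → moved (trans (sym to-v) (trans (cong to (sym eq)) (to-from iv)))) x+v

  to-w : to w ≡ v
  to-w = trans (cong to (sym from-v)) (to-from iv)

  -- The preimages of the path w – t – s – x, if it exists, form a path v – p – q – x,
  -- and the only such path has q = w; but A maps w to v, not to s.
  no-path : ∀ {s t} → s + x ≡ F (7 + c) → t + w ≡ F (7 + c) → F (7 + c) ≤ N + x → ⊥
  no-path {s} {t} s+x t+w large =
    let j , _ , p-v = A⁻¹.adjacent-to (7 + c) it iw t≢w from-w t+w
        i , _ , q-x = A⁻¹.adjacent-to (7 + c) is ix s≢x (from-fixed 1≤x x<v) s+x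
        l , _ , p-q = A⁻¹.adjacent (8 + c) it is t≢s t+s
    in conclude {from t} {from s} {i} {j} {l} (to-from it) (to-from is)
         (proj₁ (from-in it)) (proj₁ (from-in is)) p-v q-x p-q
    where
    t≢w : t ≢ w
    t≢w eq = n≮0 (linear (t ∷ w ∷ F (suc c) ∷ F c ∷ x ∷ [])
              (λ t w F₁ F₀ x → t ≼ w ∷ 𝔽 7 F₁ F₀ ≼ t ⊕ w ∷ x ⊕ w ≼ 𝔽 5 F₁ F₀ ∷ κ 1 ≼ F₀ ∷ []
                ⊢ κ 1 ≼ κ 0)
              0 (1 ∷ 1 ∷ 2 ∷ 2 ∷ []) (≤-reflexive eq) (≤-reflexive (sym t+w)) (≤-reflexive x+w) F-c-pos)
    s≢x : s ≢ x
    s≢x eq = n≮0 (linear (s ∷ x ∷ F (suc c) ∷ F c ∷ [])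
              (λ s x F₁ F₀ → s ≼ x ∷ 𝔽 7 F₁ F₀ ≼ s ⊕ x ∷ x ⊕ x ≼ F₁ ∷ κ 1 ≼ F₀ ∷ [] ⊢ κ 1 ≼ κ 0)
              0 (1 ∷ 1 ∷ 1 ∷ 8 ∷ []) (≤-reflexive eq) (≤-reflexive (sym s+x)) (≤-reflexive 2x) F-c-pos)
    t≢s : t ≢ s
    t≢s eq = n≮0 (linear (s ∷ t ∷ F (suc c) ∷ F c ∷ x ∷ w ∷ [])
              (λ s t F₁ F₀ x w →
                s ≼ t ∷ 𝔽 7 F₁ F₀ ≼ s ⊕ x ∷ t ⊕ w ≼ 𝔽 7 F₁ F₀ ∷ 𝔽 5 F₁ F₀ ≼ x ⊕ w ∷ x ⊕ x ≼ F₁ ∷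
                κ 1 ≼ F₀ ∷ []
                ⊢ κ 1 ≼ κ 0)
              0 (1 ∷ 1 ∷ 1 ∷ 1 ∷ 1 ∷ 3 ∷ []) (≤-reflexive (sym eq)) (≤-reflexive (sym s+x)) (≤-reflexive t+w) (≤-reflexive (sym x+w)) (≤-reflexive 2x) F-c-pos)
    t+s : t + s ≡ F (8 + c)
    t+s = ≤-antisym (linear (s ∷ x ∷ F (suc c) ∷ F c ∷ t ∷ w ∷ [])
              (λ s x F₁ F₀ t w → s ⊕ x ≼ 𝔽 7 F₁ F₀ ∷ t ⊕ w ≼ 𝔽 7 F₁ F₀ ∷ 𝔽 5 F₁ F₀ ≼ x ⊕ w ∷ []
                ⊢ t ⊕ s ≼ 𝔽 8 F₁ F₀)
              0 (1 ∷ 1 ∷ 1 ∷ []) (≤-reflexive s+x) (≤-reflexive t+w) (≤-reflexive (sym x+w)))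
            (linear (F (suc c) ∷ F c ∷ s ∷ x ∷ t ∷ w ∷ [])
              (λ F₁ F₀ s x t w → 𝔽 7 F₁ F₀ ≼ s ⊕ x ∷ 𝔽 7 F₁ F₀ ≼ t ⊕ w ∷ x ⊕ w ≼ 𝔽 5 F₁ F₀ ∷ []
                ⊢ 𝔽 8 F₁ F₀ ≼ t ⊕ s)
              0 (1 ∷ 1 ∷ 1 ∷ []) (≤-reflexive (sym s+x)) (≤-reflexive (sym t+w)) (≤-reflexive x+w))
    it : In N t
    it = (linear (F (suc c) ∷ F c ∷ t ∷ w ∷ x ∷ [])
              (λ F₁ F₀ t w x → 𝔽 7 F₁ F₀ ≼ t ⊕ w ∷ x ⊕ w ≼ 𝔽 5 F₁ F₀ ∷ κ 1 ≼ F₀ ∷ [] ⊢ κ 1 ≼ t)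
              0 (1 ∷ 1 ∷ 5 ∷ []) (≤-reflexive (sym t+w)) (≤-reflexive x+w) F-c-pos) , (linear (t ∷ w ∷ F (suc c) ∷ F c ∷ x ∷ N ∷ [])
              (λ t w F₁ F₀ x N →
                t ⊕ w ≼ 𝔽 7 F₁ F₀ ∷ 𝔽 5 F₁ F₀ ≼ x ⊕ w ∷ x ⊕ x ≼ F₁ ∷ 𝔽 7 F₁ F₀ ≼ N ⊕ x ∷ κ 1 ≼ F₀ ∷
                []
                ⊢ t ≼ N)
              0 (1 ∷ 1 ∷ 1 ∷ 1 ∷ 3 ∷ []) (≤-reflexive t+w) (≤-reflexive (sym x+w)) (≤-reflexive 2x) large F-c-pos)
    is : In N s
    is = (linear (F (suc c) ∷ F c ∷ s ∷ x ∷ [])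
              (λ F₁ F₀ s x → 𝔽 7 F₁ F₀ ≼ s ⊕ x ∷ x ⊕ x ≼ F₁ ∷ κ 1 ≼ F₀ ∷ [] ⊢ κ 1 ≼ s)
              1 (2 ∷ 1 ∷ 16 ∷ []) (≤-reflexive (sym s+x)) (≤-reflexive 2x) F-c-pos) , (linear (s ∷ x ∷ F (suc c) ∷ F c ∷ N ∷ [])
              (λ s x F₁ F₀ N → s ⊕ x ≼ 𝔽 7 F₁ F₀ ∷ 𝔽 7 F₁ F₀ ≼ N ⊕ x ∷ [] ⊢ s ≼ N)
              0 (1 ∷ 1 ∷ []) (≤-reflexive s+x) large)
    conclude : ∀ {p q i j l} → to p ≡ t → to q ≡ s → 1 ≤ p → 1 ≤ q →
               p + v ≡ F j → q + x ≡ F i → p + q ≡ F l → ⊥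
    conclude {p} {q} {i} {j} {l} to-p to-q 1≤p 1≤q p-v q-x p-q =
      cases (<-cmp i (3 + c)) (≤-total i j)
      where
      -- The outer edges q + x and p + v of the preimage path add up to the middle edge p + q plus x
      -- + v.
      eq : F i + F j ≡ F l + F (3 + c)
      eq = ≤-antisym (linear (F j ∷ p ∷ v ∷ F i ∷ q ∷ x ∷ F l ∷ F (suc c) ∷ F c ∷ [])
                (λ F₀ p v G₀ q x H₀ K₁ K₀ →
                  F₀ ≼ p ⊕ v ∷ G₀ ≼ q ⊕ x ∷ p ⊕ q ≼ H₀ ∷ x ⊕ v ≼ 𝔽 3 K₁ K₀ ∷ []
                  ⊢ G₀ ⊕ F₀ ≼ H₀ ⊕ 𝔽 3 K₁ K₀)
                0 (1 ∷ 1 ∷ 1 ∷ 1 ∷ []) (≤-reflexive (sym p-v)) (≤-reflexive (sym q-x)) (≤-reflexive p-q) (≤-reflexive x+v))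
              (linear (p ∷ v ∷ F j ∷ q ∷ x ∷ F i ∷ F l ∷ F (suc c) ∷ F c ∷ [])
                (λ p v F₀ q x G₀ H₀ K₁ K₀ →
                  p ⊕ v ≼ F₀ ∷ q ⊕ x ≼ G₀ ∷ H₀ ≼ p ⊕ q ∷ 𝔽 3 K₁ K₀ ≼ x ⊕ v ∷ []
                  ⊢ H₀ ⊕ 𝔽 3 K₁ K₀ ≼ G₀ ⊕ F₀)
                0 (1 ∷ 1 ∷ 1 ∷ 1 ∷ []) (≤-reflexive p-v) (≤-reflexive q-x) (≤-reflexive (sym p-q)) (≤-reflexive (sym x+v)))
      p≢x : p ≢ x
      p≢x refl = n≮0 (linear (t ∷ x ∷ F (suc c) ∷ F c ∷ w ∷ [])
                (λ t x F₁ F₀ w → t ≼ x ∷ 𝔽 7 F₁ F₀ ≼ t ⊕ w ∷ x ⊕ w ≼ 𝔽 5 F₁ F₀ ∷ κ 1 ≼ F₀ ∷ []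
                  ⊢ κ 1 ≼ κ 0)
                0 (1 ∷ 1 ∷ 1 ∷ 5 ∷ []) (≤-reflexive (sym (trans (sym (fixed 1≤x x<v)) to-p))) (≤-reflexive (sym t+w)) (≤-reflexive x+w) F-c-pos)
      q≢x : q ≢ x
      q≢x refl = n≮0 (linear (s ∷ x ∷ F (suc c) ∷ F c ∷ [])
                (λ s x F₁ F₀ → s ≼ x ∷ 𝔽 7 F₁ F₀ ≼ s ⊕ x ∷ x ⊕ x ≼ F₁ ∷ κ 1 ≼ F₀ ∷ [] ⊢ κ 1 ≼ κ 0)
                0 (1 ∷ 1 ∷ 1 ∷ 8 ∷ []) (≤-reflexive (sym (trans (sym (fixed 1≤x x<v)) to-q))) (≤-reflexive (sym s+x)) (≤-reflexive 2x) F-c-pos)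
      q≢v : q ≢ v
      q≢v refl = n≮0 (linear (s ∷ w ∷ F (suc c) ∷ F c ∷ x ∷ [])
                (λ s w F₁ F₀ x → s ≼ w ∷ 𝔽 7 F₁ F₀ ≼ s ⊕ x ∷ x ⊕ w ≼ 𝔽 5 F₁ F₀ ∷ κ 1 ≼ F₀ ∷ []
                  ⊢ κ 1 ≼ κ 0)
                0 (1 ∷ 1 ∷ 1 ∷ 5 ∷ []) (≤-reflexive (sym (trans (sym to-v) to-q))) (≤-reflexive (sym s+x)) (≤-reflexive x+w) F-c-pos)
      q≢w : q ≢ w
      q≢w refl = n≮0 (linear (s ∷ v ∷ F (suc c) ∷ F c ∷ x ∷ [])
                (λ s v F₁ F₀ x → s ≼ v ∷ 𝔽 7 F₁ F₀ ≼ s ⊕ x ∷ x ⊕ v ≼ 𝔽 3 F₁ F₀ ∷ κ 1 ≼ F₀ ∷ []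
                  ⊢ κ 1 ≼ κ 0)
                0 (1 ∷ 1 ∷ 1 ∷ 7 ∷ []) (≤-reflexive (sym (trans (sym to-w) to-q))) (≤-reflexive (sym s+x)) (≤-reflexive x+v) F-c-pos)
      3+c≤j : 3 + c ≤ j
      3+c≤j = F-cancel-< {2 + c} {j} (linear (p ∷ v ∷ F j ∷ F (suc c) ∷ F c ∷ [])
                (λ p v F₀ G₁ G₀ → p ⊕ v ≼ F₀ ∷ 𝔽 2 G₁ G₀ ≼ v ∷ κ 1 ≼ p ∷ []
                  ⊢ κ 1 ⊕ 𝔽 2 G₁ G₀ ≼ F₀)
                0 (1 ∷ 1 ∷ 1 ∷ []) (≤-reflexive p-v) lo 1≤p)
      3+c<j : 3 + c < j
      3+c<j = ≤∧≢⇒< 3+c≤j λ 3+c≡j → p≢x (+-cancelʳ-≡ v p x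
        (trans p-v (trans (cong F (sym 3+c≡j)) (sym x+v))))
      2≤i : 2 ≤ i
      2≤i = F-cancel-< {1} {i} (linear (q ∷ x ∷ F i ∷ [])
                (λ q x F₀ → q ⊕ x ≼ F₀ ∷ κ 1 ≼ q ∷ κ 1 ≼ x ∷ [] ⊢ κ 2 ≼ F₀)
                0 (1 ∷ 1 ∷ 1 ∷ []) (≤-reflexive q-x) 1≤q 1≤x)
      q≡w : i ≡ 5 + c → q ≡ w
      q≡w i≡ = +-cancelʳ-≡ x q w (trans q-x (trans (cong F i≡) (trans (sym x+w) (+-comm x w))))
      -- The index 3 + c yields q = v. A smaller `i` gives q + x = F (1 + c) = 2 x by `two-sums`, so
      -- q = x. A larger `i` gives i = j = 5 + c by `two-large-sums`, so q = w. None of these maps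
      -- to `s`.
      cases : _ → i ≤ j ⊎ j ≤ i → ⊥
      cases (tri≈ _ i≡ _) _ = q≢v (+-cancelʳ-≡ x q v
        (trans q-x (trans (cong F i≡) (trans (sym x+v) (+-comm x v)))))
      cases (tri< i< _ _) _ =
        let _ , k , 3+c≡ , F≡ = two-sums {i} {l} {j} {3 + c} 2≤i i< 3+c<j (trans (+-comm (F j) (F i)) eq)
        in q≢x (+-cancelʳ-≡ x q x (trans q-x (trans F≡
             (trans (cong F (sym (suc-injective (suc-injective 3+c≡)))) (sym 2x)))))
      cases (tri> _ _ 3+c<i) (inj₁ i≤j) =
        q≢w (q≡w (proj₂ (two-large-sums {i} {j} {l} {3 + c} (s≤s (s≤s (s≤s z≤n))) 3+c<i i≤j eq)))
      cases (tri> _ _ 3+c<i) (inj₂ j≤i) =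
        let j≡i , j≡ = two-large-sums {j} {i} {l} {3 + c} (s≤s (s≤s (s≤s z≤n))) 3+c<j j≤i
                         (trans (+-comm (F j) (F i)) eq)
        in q≢w (q≡w (trans (sym j≡i) j≡))

-- Vertices 1 and 2

finite : ∀ {m n} (P : ℕ → ℕ → Set) → (∀ (i : Fin m) (j : Fin n) → P (toℕ i) (toℕ j)) →
         ∀ {i j} → i < m → j < n → P i j
finite P p i<m j<n = subst₂ P (toℕ-fromℕ< i<m) (toℕ-fromℕ< j<n) (p (fromℕ< i<m) (fromℕ< j<n))

Neighbours : ℕ → (ℕ → Set) → ℕ → ℕ → Set
Neighbours k P u j = 1 ≤ u → u ≢ k → u + k ≡ F j → P u

neighbours? : ∀ k {P : ℕ → Set} → (∀ u → Dec (P u)) →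
              Dec (∀ (i j : Fin 8) → Neighbours k P (toℕ i) (toℕ j))
neighbours? k P? = all? λ i → all? λ j →
  1 ≤? toℕ i →-dec (¬? (toℕ i ≟ k) →-dec (toℕ i + k ≟ F (toℕ j) →-dec P? (toℕ i)))

small-neighbour : ∀ k {P : ℕ → Set} (P? : ∀ u → Dec (P u)) {_ : True (neighbours? k P?)}
                  {_ : True (k ≤? 5)} → ∀ {u} j → In 7 u → u ≢ k → u + k ≡ F j → P u
small-neighbour k {P} P? {t} {k≤5} {u} j (1≤u , u≤7) u≢k eq =
  finite (Neighbours k P) (toWitness t) (s≤s u≤7)
    -- The sum is at most 7 + 5 < 21 = F 8, so eight indices suffice for the finite check.
    (F-cancel-< {j} {8} (linear (F j ∷ u ∷ k ∷ [])
              (λ F₀ u k → F₀ ≼ u ⊕ k ∷ u ≼ κ 7 ∷ k ≼ κ 5 ∷ [] ⊢ κ 1 ⊕ F₀ ≼ κ 21)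
              0 (1 ∷ 1 ∷ 1 ∷ []) (≤-reflexive (sym eq)) u≤7 (toWitness k≤5))) 1≤u u≢k eq

module _ {u i j : ℕ} (1≤u : 1 ≤ u) where

  -- Any Fibonacci number beyond F (1 + i) exceeds it by at least F i, so a gap of at most 3 forces
  -- F i < 5 = F 5.
  gap-small : ∀ {d} → 1 ≤ d → d ≤ 3 → F i + d ≡ F j → 1 < i → i < 6 × j < 7
  gap-small {d} 1≤d d≤3 eq 1<i = helper i eq 1<i
    where
    helper : ∀ i → F i + d ≡ F j → 1 < i → i < 6 × j < 7
    helper (suc i) eq _ = s≤s i<5 , F-cancel-< {j} {7} (linear (F j ∷ F (suc i) ∷ d ∷ [])
              (λ F₀ G₁ d → F₀ ≼ G₁ ⊕ d ∷ d ≼ κ 3 ∷ G₁ ≼ κ 5 ∷ [] ⊢ κ 1 ⊕ F₀ ≼ κ 13)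
              0 (1 ∷ 1 ∷ 1 ∷ []) (≤-reflexive (sym eq)) d≤3 (F-mono i<5))
      where
      1+i<j : suc i < j
      1+i<j = F-cancel-< {suc i} {j} (linear (F (suc i) ∷ d ∷ F j ∷ [])
                (λ F₁ d G₀ → F₁ ⊕ d ≼ G₀ ∷ κ 1 ≼ d ∷ [] ⊢ κ 1 ⊕ F₁ ≼ G₀)
                0 (1 ∷ 1 ∷ []) (≤-reflexive eq) 1≤d)
      i<5 : i < 5
      i<5 = F-cancel-< {i} {5} (linear (F j ∷ F (suc i) ∷ d ∷ F i ∷ [])
                (λ F₀ G₁ d G₀ → F₀ ≼ G₁ ⊕ d ∷ d ≼ κ 3 ∷ 𝔽 2 G₁ G₀ ≼ F₀ ∷ [] ⊢ κ 1 ⊕ G₀ ≼ κ 5)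
                0 (1 ∷ 1 ∷ 1 ∷ []) (≤-reflexive (sym eq)) d≤3 (F-mono 1+i<j))

  common-neighbour-of-1-and-3 : u + 1 ≡ F i → u + 3 ≡ F j → u ≡ 2
  common-neighbour-of-1-and-3 p q =
    let i<6 , j<7 = gap-small (s≤s z≤n) (s≤s (s≤s z≤n)) eq (F-cancel-< {1} {i} (linear (u ∷ F i ∷ [])
              (λ u F₀ → u ⊕ κ 1 ≼ F₀ ∷ κ 1 ≼ u ∷ [] ⊢ κ 2 ≼ F₀)
              0 (1 ∷ 1 ∷ []) (≤-reflexive p) 1≤u))
    in +-cancelʳ-≡ 1 u 2 (trans p (finite (λ i j → F i + 2 ≡ F j → 2 ≤ F i → F i ≡ 3)
         (from-yes (all? {6} λ i → all? {7} λ j →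
           F (toℕ i) + 2 ≟ F (toℕ j) →-dec (2 ≤? F (toℕ i) →-dec F (toℕ i) ≟ 3)))
         i<6 j<7 eq (linear (u ∷ F i ∷ [])
                   (λ u F₀ → u ⊕ κ 1 ≼ F₀ ∷ κ 1 ≼ u ∷ [] ⊢ κ 2 ≼ F₀)
                   0 (1 ∷ 1 ∷ []) (≤-reflexive p) 1≤u)))
    where
    eq : F i + 2 ≡ F j
    eq = ≤-antisym (linear (F i ∷ u ∷ F j ∷ [])
              (λ F₀ u G₀ → F₀ ≼ u ⊕ κ 1 ∷ u ⊕ κ 3 ≼ G₀ ∷ [] ⊢ F₀ ⊕ κ 2 ≼ G₀)
              0 (1 ∷ 1 ∷ []) (≤-reflexive (sym p)) (≤-reflexive q))
            (linear (u ∷ F i ∷ F j ∷ [])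
              (λ u F₀ G₀ → u ⊕ κ 1 ≼ F₀ ∷ G₀ ≼ u ⊕ κ 3 ∷ [] ⊢ G₀ ≼ F₀ ⊕ κ 2)
              0 (1 ∷ 1 ∷ []) (≤-reflexive p) (≤-reflexive (sym q)))

  common-neighbour-of-2-and-5 : u + 2 ≡ F i → u + 5 ≡ F j → u ≡ 3
  common-neighbour-of-2-and-5 p q =
    let i<6 , j<7 = gap-small (s≤s z≤n) ≤-refl eq (F-cancel-< {1} {i} (linear (u ∷ F i ∷ [])
              (λ u F₀ → u ⊕ κ 2 ≼ F₀ ∷ κ 1 ≼ u ∷ [] ⊢ κ 2 ≼ F₀)
              0 (1 ∷ 1 ∷ []) (≤-reflexive p) 1≤u))
    in +-cancelʳ-≡ 2 u 3 (trans p (finite (λ i j → F i + 3 ≡ F j → 3 ≤ F i → F i ≡ 5)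
         (from-yes (all? {6} λ i → all? {7} λ j →
           F (toℕ i) + 3 ≟ F (toℕ j) →-dec (3 ≤? F (toℕ i) →-dec F (toℕ i) ≟ 5)))
         i<6 j<7 eq (linear (u ∷ F i ∷ [])
                   (λ u F₀ → u ⊕ κ 2 ≼ F₀ ∷ κ 1 ≼ u ∷ [] ⊢ κ 3 ≼ F₀)
                   0 (1 ∷ 1 ∷ []) (≤-reflexive p) 1≤u)))
    where
    eq : F i + 3 ≡ F j
    eq = ≤-antisym (linear (F i ∷ u ∷ F j ∷ [])
              (λ F₀ u G₀ → F₀ ≼ u ⊕ κ 2 ∷ u ⊕ κ 5 ≼ G₀ ∷ [] ⊢ F₀ ⊕ κ 3 ≼ G₀)
              0 (1 ∷ 1 ∷ []) (≤-reflexive (sym p)) (≤-reflexive q))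
            (linear (u ∷ F i ∷ F j ∷ [])
              (λ u F₀ G₀ → u ⊕ κ 2 ≼ F₀ ∷ G₀ ≼ u ⊕ κ 5 ∷ [] ⊢ G₀ ≼ F₀ ⊕ κ 3)
              0 (1 ∷ 1 ∷ []) (≤-reflexive p) (≤-reflexive (sym q)))

-- `F M` is the largest Fibonacci sum available at vertex 1, so `M` governs all degrees compared
-- here. The bound 34 = F 9 makes room for the small vertices and keeps `F M` at 34 or more.
module SmallVertices {N : ℕ} (A : Auto N) (34≤N : 34 ≤ N) {M : ℕ}
                     (M-lo : F M ≤ 1 + N) (M-hi : 1 + N < F (1 + M)) where
  open Images A
  module A⁻¹ = Images (inverse A)

  34≤FM : 34 ≤ F M
  34≤FM = F-mono {9} (≤-pred (F-cancel-< {9} {1 + M} (≤-trans (s≤s (m≤n⇒m≤1+n 34≤N)) M-hi)))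

  5≤M : 5 ≤ M
  5≤M = <⇒≤ (F-cancel-< {5} {M} (linear (F M ∷ [])
            (λ F₀ → κ 34 ≼ F₀ ∷ [] ⊢ κ 6 ≼ F₀)
            0 (1 ∷ []) 34≤FM))

  vertex-in : ∀ u {_ : True (1 ≤? u)} {_ : True (u ≤? 34)} → In N u
  vertex-in u {p} {q} = toWitness p , ≤-trans (toWitness q) 34≤N

  -- At a vertex of size at least F b, every sum exceeds F b, so the image indices lie between b + 1
  -- and `B`.
  image-bound : ∀ {v a J} b B → In N v → 2 ≤ a → a ≤ J → v < F a → F J ≤ N + v →
                (∀ i → a ≤ i → F i ≢ v + v) → F b ≤ to v → N + to v < F (1 + B) →
                J + suc b ≤ B + a
  image-bound {v} {a} {J} b B iv 2≤a a≤J lo hi no-loop b-lo B-hi = degree iv 2≤a a≤J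
    (λ i a≤i i≤J → <-≤-trans lo (F-mono a≤i) , ≤-trans (F-mono i≤J) hi , no-loop i a≤i ∘ sym)
    λ {i} {j} {u} _ _ iu _ _ eq →
      F-cancel-< {b} {j} (linear (F b ∷ _ ∷ _ ∷ F j ∷ [])
                (λ F₀ t₁ t₂ G₀ → F₀ ≼ t₁ ∷ t₂ ⊕ t₁ ≼ G₀ ∷ κ 1 ≼ t₂ ∷ [] ⊢ κ 1 ⊕ F₀ ≼ G₀)
                0 (1 ∷ 1 ∷ 1 ∷ []) b-lo (≤-reflexive eq) (proj₁ (to-in iu))) ,
      ≤-pred (F-cancel-< {j} {1 + B} (linear (N ∷ _ ∷ F (suc B) ∷ F j ∷ _ ∷ [])
                (λ N t₁ F₁ G₀ t₂ → κ 1 ⊕ (N ⊕ t₁) ≼ F₁ ∷ G₀ ≼ t₂ ⊕ t₁ ∷ t₂ ≼ N ∷ []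
                  ⊢ κ 1 ⊕ G₀ ≼ F₁)
                0 (1 ∷ 1 ∷ 1 ∷ []) B-hi (≤-reflexive (sym eq)) (proj₂ (to-in iu))))

  -- A vertex from 13 = F 7 on loses all indices up to 7 and reaches at most 2 + M, as its sums are
  -- at most 2 N. A vertex from 8 to 12 loses the indices up to 6 and reaches at most 1 + M. Either
  -- way too few indices remain.
  image-≤-7 : ∀ {v a J} → In N v → 2 ≤ a → a ≤ J → v < F a → F J ≤ N + v →
              (∀ i → a ≤ i → F i ≢ v + v) → M + a < J + 6 → to v ≤ 7
  image-≤-7 {v} {a} {J} iv 2≤a a≤J lo hi no-loop M< = ≮⇒≥ λ 8≤w → cases 8≤w (≤-<-connex 13 (to v))
    where
    cases : 8 ≤ to v → 13 ≤ to v ⊎ to v < 13 → ⊥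
    cases 8≤w (inj₁ 13≤w) = <⇒≱ M<
      (≤-pred (≤-pred (excess (image-bound 7 (2 + M) iv 2≤a a≤J lo hi no-loop 13≤w below))))
      where
      below : N + to v < F (3 + M)
      below = linear (_ ∷ N ∷ F (suc M) ∷ F M ∷ [])
                (λ t₁ N F₁ F₀ → t₁ ≼ N ∷ κ 1 ⊕ (κ 1 ⊕ N) ≼ F₁ ∷ [] ⊢ κ 1 ⊕ (N ⊕ t₁) ≼ 𝔽 3 F₁ F₀)
                0 (1 ∷ 2 ∷ []) (proj₂ (to-in iv)) M-hi
      excess : J + 8 ≤ 2 + M + a → 2 + (J + 6) ≤ 2 + (M + a)
      excess p = linear (J ∷ M ∷ a ∷ [])
                (λ J M a → J ⊕ κ 8 ≼ κ 1 ⊕ (κ 1 ⊕ (M ⊕ a)) ∷ []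
                  ⊢ κ 1 ⊕ (κ 1 ⊕ (J ⊕ κ 6)) ≼ κ 1 ⊕ (κ 1 ⊕ (M ⊕ a)))
                0 (1 ∷ []) p
    cases 8≤w (inj₂ w<13) = <⇒≱ M<
      (≤-pred (excess (image-bound 6 (1 + M) iv 2≤a a≤J lo hi no-loop 8≤w below)))
      where
      below : N + to v < F (2 + M)
      below = linear (_ ∷ N ∷ F (suc M) ∷ F M ∷ [])
                (λ t₁ N F₁ F₀ → κ 1 ⊕ t₁ ≼ κ 13 ∷ κ 1 ⊕ (κ 1 ⊕ N) ≼ F₁ ∷ κ 34 ≼ F₀ ∷ []
                  ⊢ κ 1 ⊕ (N ⊕ t₁) ≼ 𝔽 2 F₁ F₀)
                0 (1 ∷ 1 ∷ 1 ∷ []) w<13 M-hi 34≤FM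
      excess : J + 7 ≤ 1 + M + a → 1 + (J + 6) ≤ 1 + (M + a)
      excess p = linear (J ∷ M ∷ a ∷ [])
                (λ J M a → J ⊕ κ 7 ≼ κ 1 ⊕ (M ⊕ a) ∷ [] ⊢ κ 1 ⊕ (J ⊕ κ 6) ≼ κ 1 ⊕ (M ⊕ a))
                0 (1 ∷ []) p

  -- Counting at vertex 1 starts at index 4 because 1 + 1 = F 3 is a loop.
  no-loop-1 : ∀ i → 4 ≤ i → F i ≢ 2
  no-loop-1 i 4≤i = >⇒≢ (F-mono 4≤i)

  no-loop-2 : ∀ i → 4 ≤ i → F i ≢ 4
  no-loop-2 i _ = between-not-Fibonacci 4 ≤-refl ≤-refl i

  module _ {v : ℕ} (iv : In N v) (v≤2 : v ≤ 2) (no-loop : ∀ i → 4 ≤ i → F i ≢ v + v) where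

    private
      bound : ∀ b B → F b ≤ to v → N + to v < F (1 + B) → M + suc b ≤ B + 4
      bound b B = image-bound b B iv (s≤s (s≤s z≤n)) (<⇒≤ 5≤M) (s≤s v≤2)
        (≤-trans M-lo (linear (v ∷ N ∷ [])
                  (λ v N → κ 1 ≼ v ∷ [] ⊢ κ 1 ⊕ N ≼ N ⊕ v)
                  0 (1 ∷ []) (proj₁ iv))) no-loop

    image-≤-4 : to v ≤ 4
    image-≤-4 = ≮⇒≥ λ 5≤w → excess (bound 5 (1 + M) 5≤w below)
      where
      excess : M + 6 ≤ 1 + M + 4 → ⊥
      excess p = n≮0 (linear (M ∷ [])
                (λ M → M ⊕ κ 6 ≼ κ 1 ⊕ (M ⊕ κ 4) ∷ [] ⊢ κ 1 ≼ κ 0)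
                0 (1 ∷ []) p)
      w≤7 : to v ≤ 7
      w≤7 = image-≤-7 iv (s≤s (s≤s z≤n)) (<⇒≤ 5≤M) (s≤s v≤2) (≤-trans M-lo (linear (v ∷ N ∷ [])
                (λ v N → κ 1 ≼ v ∷ [] ⊢ κ 1 ⊕ N ≼ N ⊕ v)
                0 (1 ∷ []) (proj₁ iv)))
              no-loop (+-monoʳ-< M (s≤s (s≤s (s≤s (s≤s (s≤s z≤n))))))
      below : N + to v < F (2 + M)
      below = linear (_ ∷ N ∷ F (suc M) ∷ F M ∷ [])
                (λ t₁ N F₁ F₀ → t₁ ≼ κ 7 ∷ κ 1 ⊕ (κ 1 ⊕ N) ≼ F₁ ∷ κ 34 ≼ F₀ ∷ []
                  ⊢ κ 1 ⊕ (N ⊕ t₁) ≼ 𝔽 2 F₁ F₀)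
                0 (1 ∷ 1 ∷ 1 ∷ []) w≤7 M-hi 34≤FM

    -- An image from 3 = F 4 on loses index 4, and only the additional top index 1 + M can make up
    -- for it.
    image-3-or-4 : 3 ≤ to v → F (1 + M) ≤ N + to v
    image-3-or-4 3≤w = ≮⇒≥ λ small → excess (bound 4 M 3≤w small)
      where
      excess : M + 5 ≤ M + 4 → ⊥
      excess p = n≮0 (linear (M ∷ [])
                (λ M → M ⊕ κ 5 ≼ M ⊕ κ 4 ∷ [] ⊢ κ 1 ≼ κ 0)
                0 (1 ∷ []) p)

  image-1 : In 4 (to 1)
  image-1 = proj₁ (to-in (vertex-in 1)) , image-≤-4 (vertex-in 1) (s≤s z≤n) no-loop-1

  image-2 : In 4 (to 2)
  image-2 = proj₁ (to-in (vertex-in 2)) , image-≤-4 (vertex-in 2) ≤-refl no-loop-2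

  image-3 : In 7 (to 3)
  image-3 = proj₁ (to-in (vertex-in 3)) ,
    image-≤-7 (vertex-in 3) (s≤s (s≤s z≤n)) 5≤M (≤ᵇ⇒≤ 4 5 tt) (≤-trans M-lo (linear (N ∷ []) (λ N → [] ⊢ κ 1 ⊕ N ≼ N ⊕ κ 3) 0 []))
      (λ i _ → between-not-Fibonacci 5 (≤ᵇ⇒≤ 6 6 tt) (≤ᵇ⇒≤ 7 8 tt) i)
      (+-monoʳ-< M ≤-refl)

  -- The hypothesis provides index 1 + M at vertex 5, which compensates for its first index being 6
  -- and brings it within reach of `image-≤-7`.
  image-5 : F (1 + M) ≤ N + 5 → In 7 (to 5)
  image-5 large = proj₁ (to-in (vertex-in 5)) ,
    image-≤-7 (vertex-in 5) (s≤s (s≤s z≤n)) (s≤s 5≤M) (≤ᵇ⇒≤ 6 8 tt) large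
      (λ i _ → between-not-Fibonacci 6 (≤ᵇ⇒≤ 9 10 tt) (≤ᵇ⇒≤ 11 13 tt) i) (linear (M ∷ [])
                (λ M → [] ⊢ κ 1 ⊕ (M ⊕ κ 6) ≼ κ 1 ⊕ (M ⊕ κ 6))
                0 [])

  image-7 : F (1 + M) ≤ N + 7 → In 7 (to 7)
  image-7 large = proj₁ (to-in (vertex-in 7)) ,
    image-≤-7 (vertex-in 7) (s≤s (s≤s z≤n)) (s≤s 5≤M) (≤ᵇ⇒≤ 8 8 tt) large
      (λ i _ → between-not-Fibonacci 7 (≤ᵇ⇒≤ 14 14 tt) (≤ᵇ⇒≤ 15 21 tt) i) (linear (M ∷ [])
                (λ M → [] ⊢ κ 1 ⊕ (M ⊕ κ 6) ≼ κ 1 ⊕ (M ⊕ κ 6))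
                0 [])

  to-adjacent : ∀ {u v v′} i → (iu : In N u) (iv : In N v) → u ≢ v → u + v ≡ F i → to v ≡ v′ →
                to u ≢ v′ × ∃ λ j → to u + v′ ≡ F j
  to-adjacent i iu iv u≢v eq refl =
    (u≢v ∘ to-injective iu iv) , proj₁ adj , proj₂ (proj₂ adj)
    where adj = adjacent i iu iv u≢v eq

  clash : ∀ {u v w} → In N u → In N v → to u ≡ w → to v ≡ w → u ≢ v → ⊥
  clash iu iv p q u≢v = u≢v (to-injective iu iv (trans p (sym q)))

  from-image : ∀ {u w} → In N u → to u ≡ w → from w ≡ u
  from-image iu refl = from-to iu

  -- This transposition preserves the edge between 1 and 2, so it must be refuted through 3: as a
  -- neighbour of 2, it goes to a neighbour of 1 not above 7, that is 2, 4 or 7.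
  not-21 : to 1 ≡ 2 → to 2 ≡ 1 → ⊥
  not-21 p q =
    let 3≢ , j , eq = to-adjacent 5 (vertex-in 3) (vertex-in 2) (λ ()) refl q
    in cases (small-neighbour 1 (λ u → u ≟ 2 ⊎-dec (u ≟ 4 ⊎-dec u ≟ 7)) j image-3 3≢ eq)
    where
    cases : to 3 ≡ 2 ⊎ to 3 ≡ 4 ⊎ to 3 ≡ 7 → ⊥
    cases (inj₁ r) = clash (vertex-in 1) (vertex-in 3) p r (λ ())
    cases (inj₂ (inj₂ r)) =
      -- The vertex 6 is joined to 2 and 7, so its preimage is joined to 1 and 3. This leaves only
      -- 2, whose image is 1.
      let i , _ , a = A⁻¹.adjacent-to 6 (vertex-in 6) (vertex-in 2) (λ ()) (from-image (vertex-in 1) p) refl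
          j , _ , b = A⁻¹.adjacent-to 7 (vertex-in 6) (vertex-in 7) (λ ()) (from-image (vertex-in 3) r) refl
          6↦2 = common-neighbour-of-1-and-3 {i = i} {j} (proj₁ (from-in (vertex-in 6))) a b
      in contradiction (trans (sym (to-from (vertex-in 6))) (trans (cong to 6↦2) q)) λ ()
    cases (inj₂ (inj₁ r)) with ≤-<-connex (F (1 + M)) (N + 4)
    ... | inj₁ large =
      let 5≢ , j , eq = to-adjacent 6 (vertex-in 5) (vertex-in 3) (λ ()) refl r
      in clash (vertex-in 5) (vertex-in 2)
           (small-neighbour 4 (_≟ 1) j (image-5 (linear (F (suc M) ∷ N ∷ [])
                     (λ F₁ N → F₁ ≼ N ⊕ κ 4 ∷ [] ⊢ F₁ ≼ N ⊕ κ 5)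
                     0 (1 ∷ []) large)) 5≢ eq) q (λ ())
    -- No index above `M` is available at 4. Indices 5 and 6 at 4 belong to vertex 1, the image of
    -- 2, and to the loop 4 + 4, so the neighbours of 3 from index 6 on must land on indices from 7
    -- to `M`, one too few.
    ... | inj₂ small = excess (degree {3} {6} {M} {7} {M} (vertex-in 3) (s≤s (s≤s z≤n)) 6≤M good target)
      where
      excess : M + 7 ≤ M + 6 → ⊥
      excess p = n≮0 (linear (M ∷ [])
                (λ M → M ⊕ κ 7 ≼ M ⊕ κ 6 ∷ [] ⊢ κ 1 ≼ κ 0)
                0 (1 ∷ []) p)
      6≤M : 6 ≤ M
      6≤M = <⇒≤ (F-cancel-< {6} {M} (linear (F M ∷ [])
                (λ F₀ → κ 34 ≼ F₀ ∷ [] ⊢ κ 9 ≼ F₀)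
                0 (1 ∷ []) 34≤FM))
      good : ∀ i → 6 ≤ i → i ≤ M → 3 < F i × F i ≤ N + 3 × 6 ≢ F i
      good i 6≤i i≤M = <-≤-trans (≤ᵇ⇒≤ 4 8 tt) (F-mono 6≤i) ,
        ≤-trans (F-mono i≤M) (≤-trans M-lo (linear (N ∷ []) (λ N → [] ⊢ κ 1 ⊕ N ≼ N ⊕ κ 3) 0 [])) ,
        <⇒≢ (<-≤-trans (≤ᵇ⇒≤ 7 8 tt) (F-mono 6≤i))
      target : ∀ {i j u} → 6 ≤ i → i ≤ M → In N u → u ≢ 3 → u + 3 ≡ F i →
               to u + to 3 ≡ F j → 7 ≤ j × j ≤ M
      target {i} {j} {u} 6≤i _ iu u≢3 u+3 eq = ≤∧≢⇒< (≤∧≢⇒< 5≤j 5≢j) 6≢j ,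
        ≤-pred (F-cancel-< {j} {1 + M} (linear (F j ∷ _ ∷ _ ∷ N ∷ F (suc M) ∷ [])
                  (λ F₀ t₁ t₂ N G₁ → F₀ ≼ t₁ ⊕ t₂ ∷ t₂ ≼ κ 4 ∷ κ 1 ⊕ (N ⊕ κ 4) ≼ G₁ ∷ t₁ ≼ N ∷ []
                    ⊢ κ 1 ⊕ F₀ ≼ G₁)
                  0 (1 ∷ 1 ∷ 1 ∷ 1 ∷ []) (≤-reflexive (sym eq)) (≤-reflexive r) small (proj₂ (to-in iu))))
        where
        5≤j : 5 ≤ j
        5≤j = F-cancel-< {4} {j} (linear (_ ∷ _ ∷ F j ∷ [])
                  (λ t₁ t₂ F₀ → t₁ ⊕ t₂ ≼ F₀ ∷ κ 4 ≼ t₂ ∷ κ 1 ≼ t₁ ∷ [] ⊢ κ 4 ≼ F₀)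
                  0 (1 ∷ 1 ∷ 1 ∷ []) (≤-reflexive eq) (≤-reflexive (sym r)) (proj₁ (to-in iu)))
        5≢j : 5 ≢ j
        5≢j refl = n≮0 (linear (u ∷ F i ∷ [])
                  (λ u F₀ → u ≼ κ 2 ∷ F₀ ≼ u ⊕ κ 3 ∷ κ 8 ≼ F₀ ∷ [] ⊢ κ 1 ≼ κ 0)
                  0 (1 ∷ 1 ∷ 1 ∷ []) (≤-reflexive (to-injective iu (vertex-in 2) (trans to-u (sym q)))) (≤-reflexive (sym u+3)) (F-mono 6≤i))
          where
          to-u : to u ≡ 1
          to-u = ≤-antisym (linear (_ ∷ _ ∷ [])
                    (λ t₁ t₂ → t₁ ⊕ t₂ ≼ κ 5 ∷ κ 4 ≼ t₂ ∷ [] ⊢ t₁ ≼ κ 1)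
                    0 (1 ∷ 1 ∷ []) (≤-reflexive eq) (≤-reflexive (sym r)))
                  (linear (_ ∷ _ ∷ [])
                    (λ t₁ t₂ → κ 5 ≼ t₁ ⊕ t₂ ∷ t₂ ≼ κ 4 ∷ [] ⊢ κ 1 ≼ t₁)
                    0 (1 ∷ 1 ∷ []) (≤-reflexive (sym eq)) (≤-reflexive r))
        6≢j : 6 ≢ j
        6≢j refl = u≢3 (to-injective iu (vertex-in 3) to-u)
          where
          to-u : to u ≡ to 3
          to-u = ≤-antisym (linear (_ ∷ _ ∷ [])
                    (λ t₁ t₂ → t₁ ⊕ t₂ ≼ κ 8 ∷ κ 4 ≼ t₂ ∷ [] ⊢ t₁ ≼ t₂)
                    0 (1 ∷ 2 ∷ []) (≤-reflexive eq) (≤-reflexive (sym r)))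
                  (linear (_ ∷ _ ∷ [])
                    (λ t₁ t₂ → κ 8 ≼ t₁ ⊕ t₂ ∷ t₂ ≼ κ 4 ∷ [] ⊢ t₂ ≼ t₁)
                    0 (1 ∷ 2 ∷ []) (≤-reflexive (sym eq)) (≤-reflexive r))

  not-14 : to 1 ≡ 1 → to 2 ≡ 4 → ⊥
  not-14 p q =
    let 3≢ , j , eq = to-adjacent 5 (vertex-in 3) (vertex-in 2) (λ ()) refl q
    in clash (vertex-in 3) (vertex-in 1) (small-neighbour 4 (_≟ 1) j image-3 3≢ eq) p (λ ())

  large-1 : ∀ {w} → to 1 ≡ w → 3 ≤ w → F (1 + M) ≤ N + w
  large-1 refl 3≤w = image-3-or-4 (vertex-in 1) (s≤s z≤n) no-loop-1 3≤w

  large-2 : ∀ {w} → to 2 ≡ w → 3 ≤ w → F (1 + M) ≤ N + w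
  large-2 refl 3≤w = image-3-or-4 (vertex-in 2) ≤-refl no-loop-2 3≤w

  not-41 : to 1 ≡ 4 → to 2 ≡ 1 → ⊥
  not-41 p q =
    let 7≢ , j , eq = to-adjacent 6 (vertex-in 7) (vertex-in 1) (λ ()) refl p
    in clash (vertex-in 7) (vertex-in 2)
         (small-neighbour 4 (_≟ 1) j (image-7 (linear (F (suc M) ∷ N ∷ [])
                   (λ F₁ N → F₁ ≼ N ⊕ κ 4 ∷ [] ⊢ F₁ ≼ N ⊕ κ 7)
                   0 (1 ∷ []) (large-1 p (n≤1+n 3)))) 7≢ eq) q (λ ())

  not-23 : to 1 ≡ 2 → to 2 ≡ 3 → ⊥
  not-23 p q =
    let 3≢ , j , eq = to-adjacent 5 (vertex-in 3) (vertex-in 2) (λ ()) refl q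
    in cases (small-neighbour 3 (λ u → u ≟ 2 ⊎-dec u ≟ 5) j image-3 3≢ eq)
    where
    cases : to 3 ≡ 2 ⊎ to 3 ≡ 5 → ⊥
    cases (inj₁ r) = clash (vertex-in 1) (vertex-in 3) p r (λ ())
    cases (inj₂ r) =
      let 5≢ , j , eq = to-adjacent 6 (vertex-in 5) (vertex-in 3) (λ ()) refl r
      in clash (vertex-in 5) (vertex-in 2)
           (small-neighbour 5 (_≟ 3) j (image-5 (linear (F (suc M) ∷ N ∷ [])
                     (λ F₁ N → F₁ ≼ N ⊕ κ 3 ∷ [] ⊢ F₁ ≼ N ⊕ κ 5)
                     0 (1 ∷ []) (large-2 q ≤-refl))) 5≢ eq) q (λ ())

  -- The neighbour 7 of 1 goes to 2 or 5. If it goes to 5, then 6, joined to 2 and 7, goes to the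
  -- only common neighbour 3 of 2 and 5, already the image of 1.
  not-32 : to 1 ≡ 3 → to 2 ≡ 2 → ⊥
  not-32 p q =
    let 7≢ , j , eq = to-adjacent 6 (vertex-in 7) (vertex-in 1) (λ ()) refl p
    in cases (small-neighbour 3 (λ u → u ≟ 2 ⊎-dec u ≟ 5) j (image-7 (linear (F (suc M) ∷ N ∷ [])
              (λ F₁ N → F₁ ≼ N ⊕ κ 3 ∷ [] ⊢ F₁ ≼ N ⊕ κ 7)
              0 (1 ∷ []) (large-1 p ≤-refl))) 7≢ eq)
    where
    cases : to 7 ≡ 2 ⊎ to 7 ≡ 5 → ⊥
    cases (inj₁ r) = clash (vertex-in 7) (vertex-in 2) r q (λ ())
    cases (inj₂ r) =
      let i , _ , a = adjacent-to 6 (vertex-in 6) (vertex-in 2) (λ ()) q refl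
          j , _ , b = adjacent-to 7 (vertex-in 6) (vertex-in 7) (λ ()) r refl
      in clash (vertex-in 6) (vertex-in 1)
           (common-neighbour-of-2-and-5 {i = i} {j} (proj₁ (to-in (vertex-in 6))) a b) p (λ ())

  -- The edge from 1 to 2 goes to an edge inside {1, 2, 3, 4}. These are 12, 23 and 14, and five of
  -- their six orientations have been refuted.
  1-and-2-fixed : to 1 ≡ 1 × to 2 ≡ 2
  1-and-2-fixed =
    let _ , j , eq = to-adjacent 4 (vertex-in 1) (vertex-in 2) (λ ()) refl refl
    in cases j image-1 image-2 refl refl eq
    where
    small : ∀ {u} → In 4 u → In 7 u
    small (1≤u , u≤4) = 1≤u , ≤-trans u≤4 (≤ᵇ⇒≤ 4 7 tt)
    cases : ∀ {u v} j → In 4 u → In 4 v → to 1 ≡ u → to 2 ≡ v → u + v ≡ F j → to 1 ≡ 1 × to 2 ≡ 2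
    cases {1} {v} j _ iv p q eq
      with small-neighbour 1 (λ u → u ≟ 2 ⊎-dec (u ≟ 4 ⊎-dec u ≟ 7)) j (small iv)
             (λ v≡1 → clash (vertex-in 1) (vertex-in 2) p (trans q v≡1) (λ ())) (trans (+-comm v 1) eq)
    ... | inj₁ refl        = p , q
    ... | inj₂ (inj₁ refl) = ⊥-elim (not-14 p q)
    ... | inj₂ (inj₂ refl) = contradiction (proj₂ iv) (<⇒≱ (≤ᵇ⇒≤ 5 7 tt))
    cases {2} {v} j _ iv p q eq
      with small-neighbour 2 (λ u → u ≟ 1 ⊎-dec (u ≟ 3 ⊎-dec u ≟ 6)) j (small iv)
             (λ v≡2 → clash (vertex-in 1) (vertex-in 2) p (trans q v≡2) (λ ())) (trans (+-comm v 2) eq)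
    ... | inj₁ refl        = ⊥-elim (not-21 p q)
    ... | inj₂ (inj₁ refl) = ⊥-elim (not-23 p q)
    ... | inj₂ (inj₂ refl) = contradiction (proj₂ iv) (<⇒≱ (≤ᵇ⇒≤ 5 6 tt))
    cases {3} {v} j _ iv p q eq
      with small-neighbour 3 (λ u → u ≟ 2 ⊎-dec u ≟ 5) j (small iv)
             (λ v≡3 → clash (vertex-in 1) (vertex-in 2) p (trans q v≡3) (λ ())) (trans (+-comm v 3) eq)
    ... | inj₁ refl = ⊥-elim (not-32 p q)
    ... | inj₂ refl = contradiction (proj₂ iv) (<⇒≱ ≤-refl)
    cases {4} {v} j _ iv p q eq
      with small-neighbour 4 (_≟ 1) j (small iv)
             (λ v≡4 → clash (vertex-in 1) (vertex-in 2) p (trans q v≡4) (λ ())) (trans (+-comm v 4) eq)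
    ... | refl = ⊥-elim (not-41 p q)
    cases {suc (suc (suc (suc (suc _))))} _ (_ , s≤s (s≤s (s≤s (s≤s ())))) _ _ _ _

-- Rigidity up to one exceptional pair

record Exceptional {N : ℕ} (A : Auto N) (c : ℕ) : Set where
  open Auto A
  field
    v x   : ℕ
    v-in  : In N v
    x-in  : In N x
    to-x  : to x ≡ x
    2x    : x + x ≡ F (1 + c)
    x+v   : x + v ≡ F (3 + c)
    x+w   : x + to v ≡ F (5 + c)
    N+x<F : N + x < F (7 + c)

IsIdentity : ∀ {N} → Auto N → Set
IsIdentity {N} A = ∀ u → In N u → Auto.to A u ≡ u

fixed-or-exceptional : ∀ {N} (A : Auto N) → 34 ≤ N → IsIdentity A ⊎ ∃ (Exceptional A)
fixed-or-exceptional {N} A 34≤N = map₁ (λ p u iu → p iu (s≤s (proj₂ iu))) (search (suc N))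
  where
  open Images A
  small : to 1 ≡ 1 × to 2 ≡ 2
  small with locate (1 + N) (s≤s z≤n)
  ... | M , _ , M-lo , M-hi = SmallVertices.1-and-2-fixed A 34≤N {M} M-lo M-hi

  FixedBelow : ℕ → Set
  FixedBelow k = ∀ {u} → In N u → u < k → to u ≡ u

  extend : ∀ {k} → FixedBelow k → (In N k → to k ≡ k) → FixedBelow (suc k)
  extend p q iu (s≤s u≤k) with m≤n⇒m<n∨m≡n u≤k
  ... | inj₁ u<k  = p iu u<k
  ... | inj₂ refl = q iu

  -- Starting at 3 = F 4 supplies the hypothesis 2 ≤ c of `least-moved`; the vertices below are
  -- settled by `small`.
  exceptional : ∀ {k} → 3 ≤ k → FixedBelow k → In N k → to k ≢ k → ∃ (Exceptional A)
  exceptional {k} 3≤k p ik moved with locate k (proj₁ ik)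
  ... | m , _ , lo , hi with m≤n⇒∃[o]m+o≡n {2} {m} (≤-trans (s≤s (s≤s z≤n)) (4≤m m hi))
    where
    4≤m : ∀ m → k < F (1 + m) → 4 ≤ m
    4≤m m hi = ≤-pred (F-cancel-< {4} {1 + m} (≤-<-trans 3≤k hi))
  ...   | c , refl = c , record
          { v = k ; x = x ; v-in = ik ; x-in = L.ix ; to-x = L.to-x ; 2x = proj₁ result ; x+v = x+v
          ; x+w = proj₁ (proj₂ result) ; N+x<F = proj₂ (proj₂ result) }
    where
    x : ℕ
    x = F (3 + c) ∸ k
    x+v : x + k ≡ F (3 + c)
    x+v = m∸n+n≡m (<⇒≤ hi)
    2≤c : 2 ≤ c
    2≤c = ≤-pred (≤-pred (≤-pred (F-cancel-< {4} {3 + c} (≤-<-trans 3≤k hi))))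
    fixed : ∀ {u} → 1 ≤ u → u < k → to u ≡ u
    fixed 1≤u u<k = p (1≤u , ≤-trans (<⇒≤ u<k) (proj₂ ik)) u<k
    module L = LeastMoved A 2≤c ik lo hi fixed refl moved x+v
    result = least-moved A 2≤c ik lo hi fixed refl moved x+v

  search : ∀ k → FixedBelow k ⊎ ∃ (Exceptional A)
  search 0 = inj₁ λ _ ()
  search 1 = inj₁ λ { (s≤s _ , _) (s≤s ()) }
  search 2 = inj₁ (extend {1} (λ { (s≤s _ , _) (s≤s ()) }) (λ _ → proj₁ small))
  search 3 = inj₁ (extend {2} (extend {1} (λ { (s≤s _ , _) (s≤s ()) }) (λ _ → proj₁ small)) (λ _ → proj₂ small))
  search (suc k@(suc (suc (suc _)))) with search k
  ... | inj₂ e = inj₂ e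
  ... | inj₁ p with k ≤? N | to k ≟ k
  ...   | no k≰N | _         = inj₁ (extend {k} p (λ ik → ⊥-elim (k≰N (proj₂ ik))))
  ...   | yes _  | yes fixed = inj₁ (extend {k} p (λ _ → fixed))
  ...   | yes k≤N | no moved = inj₂ (exceptional {k} (s≤s (s≤s (s≤s z≤n))) p (s≤s z≤n , k≤N) moved)

-- Parity of Fibonacci numbers

Even-F : ∀ q → ∃ λ h → h + h ≡ F (q * 3)
Even-F zero    = 0 , refl
Even-F (suc q) = let h , eq = Even-F q in F (1 + q * 3) + h , (≤-antisym (linear (_ ∷ F (q * 3) ∷ F (suc (q * 3)) ∷ [])
          (λ t₁ F₀ F₁ → t₁ ⊕ t₁ ≼ F₀ ∷ [] ⊢ F₁ ⊕ t₁ ⊕ (F₁ ⊕ t₁) ≼ 𝔽 3 F₁ F₀)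
          0 (1 ∷ []) (≤-reflexive eq))
        (linear (F (q * 3) ∷ _ ∷ F (suc (q * 3)) ∷ [])
          (λ F₀ t₁ F₁ → F₀ ≼ t₁ ⊕ t₁ ∷ [] ⊢ 𝔽 3 F₁ F₀ ≼ F₁ ⊕ t₁ ⊕ (F₁ ⊕ t₁))
          0 (1 ∷ []) (≤-reflexive (sym eq))))

-- Descent: the difference of two consecutive even Fibonacci numbers is the preceding one, again
-- even, and this ends at F 1 = 1.
no-consecutive-even : ∀ m {a b} → a + a ≡ F m → b + b ≡ F (1 + m) → ⊥
no-consecutive-even zero {a} {b} _ q = absurd (linear (b ∷ [])
          (λ b → b ⊕ b ≼ κ 1 ∷ [] ⊢ b ≼ κ 0)
          1 (1 ∷ []) (≤-reflexive q))
  where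
  absurd : b ≤ 0 → ⊥
  absurd b≤0 = n≮0 (linear (b ∷ [])
            (λ b → b ≼ κ 0 ∷ κ 1 ≼ b ⊕ b ∷ [] ⊢ κ 1 ≼ κ 0)
            0 (2 ∷ 1 ∷ []) b≤0 (≤-reflexive (sym q)))
no-consecutive-even (suc m) {a} {b} p q = no-consecutive-even m {b ∸ a} {a} halves p
  where
  a≤b : a ≤ b
  a≤b = linear (a ∷ F (suc m) ∷ F m ∷ b ∷ [])
            (λ a F₁ F₀ b → a ⊕ a ≼ F₁ ∷ 𝔽 2 F₁ F₀ ≼ b ⊕ b ∷ [] ⊢ a ≼ b)
            1 (1 ∷ 1 ∷ []) (≤-reflexive p) (≤-reflexive (sym q))
  difference : b ∸ a + a ≡ b
  difference = m∸n+n≡m a≤b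
  halves : b ∸ a + (b ∸ a) ≡ F m
  halves = ≤-antisym (linear (b ∸ a ∷ a ∷ b ∷ F (suc m) ∷ F m ∷ [])
            (λ t₁ a b F₁ F₀ → t₁ ⊕ a ≼ b ∷ F₁ ≼ a ⊕ a ∷ b ⊕ b ≼ 𝔽 2 F₁ F₀ ∷ [] ⊢ t₁ ⊕ t₁ ≼ F₀)
            0 (2 ∷ 1 ∷ 1 ∷ []) (≤-reflexive difference) (≤-reflexive (sym p)) (≤-reflexive q))
          (linear (b ∷ b ∸ a ∷ a ∷ F (suc m) ∷ F m ∷ [])
            (λ b t₁ a F₁ F₀ → b ≼ t₁ ⊕ a ∷ a ⊕ a ≼ F₁ ∷ 𝔽 2 F₁ F₀ ≼ b ⊕ b ∷ [] ⊢ F₀ ≼ t₁ ⊕ t₁)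
            0 (2 ∷ 1 ∷ 1 ∷ []) (≤-reflexive (sym difference)) (≤-reflexive p) (≤-reflexive (sym q)))

-- At distance two, the difference of the two even numbers is the Fibonacci number between them,
-- which reduces to consecutive indices.
even-within-2 : ∀ o {m a b} → o ≤ 2 → a + a ≡ F m → b + b ≡ F (o + m) → o ≡ 0
even-within-2 0 _ _ _ = refl
even-within-2 1 {m} {a} {b} _ p q = ⊥-elim (no-consecutive-even m {a} {b} p q)
even-within-2 2 {m} {a} {b} _ p q =
  ⊥-elim (no-consecutive-even (1 + m) {b ∸ a} {b} halves q)
  where
  a≤b : a ≤ b
  a≤b = linear (a ∷ F m ∷ F (suc m) ∷ b ∷ [])
            (λ a F₀ F₁ b → a ⊕ a ≼ F₀ ∷ 𝔽 2 F₁ F₀ ≼ b ⊕ b ∷ [] ⊢ a ≼ b)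
            1 (1 ∷ 1 ∷ []) (≤-reflexive p) (≤-reflexive (sym q))
  difference : b ∸ a + a ≡ b
  difference = m∸n+n≡m a≤b
  halves : b ∸ a + (b ∸ a) ≡ F (1 + m)
  halves = ≤-antisym (linear (b ∸ a ∷ a ∷ b ∷ F m ∷ F (suc m) ∷ [])
            (λ t₁ a b F₀ F₁ → t₁ ⊕ a ≼ b ∷ F₀ ≼ a ⊕ a ∷ b ⊕ b ≼ 𝔽 2 F₁ F₀ ∷ [] ⊢ t₁ ⊕ t₁ ≼ F₁)
            0 (2 ∷ 1 ∷ 1 ∷ []) (≤-reflexive difference) (≤-reflexive (sym p)) (≤-reflexive q))
          (linear (b ∷ b ∸ a ∷ a ∷ F m ∷ F (suc m) ∷ [])
            (λ b t₁ a F₀ F₁ → b ≼ t₁ ⊕ a ∷ a ⊕ a ≼ F₀ ∷ 𝔽 2 F₁ F₀ ≼ b ⊕ b ∷ [] ⊢ F₁ ≼ t₁ ⊕ t₁)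
            0 (2 ∷ 1 ∷ 1 ∷ []) (≤-reflexive (sym difference)) (≤-reflexive p) (≤-reflexive (sym q)))
even-within-2 (suc (suc (suc _))) (s≤s (s≤s ())) _ _

offset : ∀ {m n} → m ≤ n → ∃ λ o → o + m ≡ n
offset m≤n = _ , m∸n+n≡m m≤n

even-close : ∀ {c e a b} → a + a ≡ F (4 + c) → b + b ≡ F (4 + e) → e ≤ 2 + c → c ≤ 2 + e → e ≡ c
even-close {c} {e} {a} {b} p q e≤ c≤ with ≤-total c e
... | inj₁ c≤e with offset c≤e
...   | o , refl with even-within-2 o {4 + c} {a} {b} (+-cancelʳ-≤ c o 2 e≤) p (trans q (cong F (move o c)))
  where
  move : ∀ o c → 4 + (o + c) ≡ o + (4 + c)
  move = solve-∀
...     | refl = refl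
even-close {c} {e} {a} {b} p q e≤ c≤ | inj₂ e≤c with offset e≤c
...   | o , refl with even-within-2 o {4 + e} {b} {a} (+-cancelʳ-≤ e o 2 c≤) q (trans p (cong F (move o e)))
  where
  move : ∀ o c → 4 + (o + c) ≡ o + (4 + c)
  move = solve-∀
...     | refl = refl

double-injective : ∀ {a b} → a + a ≡ b + b → a ≡ b
double-injective {a} {b} eq = ≤-antisym (linear (a ∷ b ∷ [])
          (λ a b → a ⊕ a ≼ b ⊕ b ∷ [] ⊢ a ≼ b)
          1 (1 ∷ []) (≤-reflexive eq))
        (linear (b ∷ a ∷ [])
          (λ b a → b ⊕ b ≼ a ⊕ a ∷ [] ⊢ b ≼ a)
          1 (1 ∷ []) (≤-reflexive (sym eq)))

-- n = 4 + c, h = F n / 2, k = F (n - 3) / 2, t = 3 F n / 2.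
module Range {N c h k : ℕ} (5≤c : 5 ≤ c) (2h : h + h ≡ F (4 + c)) (k+h : k + h ≡ F (3 + c))
             (N-lo : F (4 + c) ≤ N) (N-hi : N < F (7 + c)) where

  t : ℕ
  t = h + F (4 + c)

  F-c-pos : 1 ≤ F c
  F-c-pos = F-pos (≤-trans (s≤s z≤n) 5≤c)

  F-c-≤ : F c ≤ F (1 + c)
  F-c-≤ = F-step c

  34≤N : 34 ≤ N
  34≤N = ≤-trans (F-mono {9} (s≤s (s≤s (s≤s (s≤s 5≤c))))) N-lo

  h-in : In N h
  h-in = (linear (F (suc c) ∷ F c ∷ h ∷ [])
            (λ F₁ F₀ h → 𝔽 4 F₁ F₀ ≼ h ⊕ h ∷ κ 1 ≼ F₀ ∷ [] ⊢ κ 1 ≼ h)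
            1 (1 ∷ 2 ∷ []) (≤-reflexive (sym 2h)) F-c-pos) , (linear (h ∷ F (suc c) ∷ F c ∷ N ∷ [])
            (λ h F₁ F₀ N → h ⊕ h ≼ 𝔽 4 F₁ F₀ ∷ 𝔽 4 F₁ F₀ ≼ N ∷ [] ⊢ h ≼ N)
            1 (1 ∷ 1 ∷ []) (≤-reflexive 2h) N-lo)

  record Swapped (A : Auto N) : Set where
    open Images A
    field
      h-to-t : to h ≡ t
      k-in   : In N k
      k-to-k : to k ≡ k
      N+k<F  : N + k < F (7 + c)

    t≤N : t ≤ N
    t≤N = subst (_≤ N) h-to-t (proj₂ (to-in h-in))

    -- At `h` the count starts at 5 + c, above `k` and the loop h + h = F (4 + c). At `t` index 5 +
    -- c belongs to `k`, which is fixed, so the images start at 6 + c and must reach one index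
    -- further.
    index-gap : ∀ {J B} → 5 + c ≤ J → F J ≤ N + h → N + t < F (1 + B) → J < B
    index-gap {J} {B} 5+c≤J J-hi B-hi =
      excess (degree {h} {5 + c} {J} {6 + c} {B} h-in (s≤s (s≤s z≤n)) 5+c≤J good target)
      where
      excess : J + (6 + c) ≤ B + (5 + c) → J < B
      excess p = linear (J ∷ c ∷ B ∷ [])
                (λ J c B →
                  J ⊕ (κ 1 ⊕ (κ 1 ⊕ (κ 1 ⊕ (κ 1 ⊕ (κ 1 ⊕ (κ 1 ⊕ c)))))) ≼ B ⊕ (κ 1 ⊕ (κ 1 ⊕ (κ 1 ⊕ (κ 1 ⊕ (κ 1 ⊕ c))))) ∷
                  []
                  ⊢ κ 1 ⊕ J ≼ B)
                0 (1 ∷ []) p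
      good : ∀ i → 5 + c ≤ i → i ≤ J → h < F i × F i ≤ N + h × h + h ≢ F i
      good i lo hi = <-≤-trans h<F (F-mono lo) , ≤-trans (F-mono hi) J-hi , <⇒≢ (<-≤-trans 2h<F (F-mono lo))
        where
        h<F : h < F (5 + c)
        h<F = linear (h ∷ F (suc c) ∷ F c ∷ [])
                  (λ h F₁ F₀ → h ⊕ h ≼ 𝔽 4 F₁ F₀ ∷ κ 1 ≼ F₀ ∷ [] ⊢ κ 1 ⊕ h ≼ 𝔽 5 F₁ F₀)
                  1 (1 ∷ 4 ∷ []) (≤-reflexive 2h) F-c-pos
        2h<F : h + h < F (5 + c)
        2h<F = linear (h ∷ F (suc c) ∷ F c ∷ [])
                  (λ h F₁ F₀ → h ⊕ h ≼ 𝔽 4 F₁ F₀ ∷ κ 1 ≼ F₀ ∷ F₀ ≼ F₁ ∷ []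
                    ⊢ κ 1 ⊕ (h ⊕ h) ≼ 𝔽 5 F₁ F₀)
                  0 (1 ∷ 3 ∷ 2 ∷ []) (≤-reflexive 2h) F-c-pos F-c-≤
      target : ∀ {i j u} → 5 + c ≤ i → i ≤ J → In N u → u ≢ h → u + h ≡ F i →
               to u + to h ≡ F j → 6 + c ≤ j × j ≤ B
      target {i} {j} {u} lo _ iu _ u+h eq rewrite h-to-t =
        ≤∧≢⇒< (F-cancel-< {4 + c} {j} (linear (_ ∷ h ∷ F (suc c) ∷ F c ∷ F j ∷ [])
                  (λ t₁ h F₁ F₀ G₀ → t₁ ⊕ (h ⊕ 𝔽 4 F₁ F₀) ≼ G₀ ∷ κ 1 ≼ t₁ ∷ []
                    ⊢ κ 1 ⊕ 𝔽 4 F₁ F₀ ≼ G₀)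
                  0 (1 ∷ 1 ∷ []) (≤-reflexive eq) (proj₁ (to-in iu)))) 5+c≢j ,
        ≤-pred (F-cancel-< {j} {1 + B} (linear (F j ∷ _ ∷ h ∷ F (suc c) ∷ F c ∷ N ∷ F (suc B) ∷ [])
                  (λ F₀ t₁ h G₁ G₀ N H₁ →
                    F₀ ≼ t₁ ⊕ (h ⊕ 𝔽 4 G₁ G₀) ∷ t₁ ≼ N ∷ κ 1 ⊕ (N ⊕ (h ⊕ 𝔽 4 G₁ G₀)) ≼ H₁ ∷ []
                    ⊢ κ 1 ⊕ F₀ ≼ H₁)
                  0 (1 ∷ 1 ∷ 1 ∷ []) (≤-reflexive (sym eq)) (proj₂ (to-in iu)) B-hi))
        where
        5+c≢j : 5 + c ≢ j
        5+c≢j refl = n≮0 (linear (u ∷ k ∷ F i ∷ h ∷ F (suc c) ∷ F c ∷ [])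
                  (λ u k F₀ h G₁ G₀ →
                    u ≼ k ∷ F₀ ≼ u ⊕ h ∷ 𝔽 5 G₁ G₀ ≼ F₀ ∷ k ⊕ h ≼ 𝔽 3 G₁ G₀ ∷ κ 1 ≼ G₀ ∷ []
                    ⊢ κ 1 ≼ κ 0)
                  0 (1 ∷ 1 ∷ 1 ∷ 1 ∷ 2 ∷ []) (≤-reflexive (to-injective iu k-in (trans to-u (sym k-to-k)))) (≤-reflexive (sym u+h)) (F-mono lo) (≤-reflexive k+h) F-c-pos)
          where
          to-u : to u ≡ k
          to-u = ≤-antisym (linear (_ ∷ h ∷ F (suc c) ∷ F c ∷ k ∷ [])
                    (λ t₁ h F₁ F₀ k → t₁ ⊕ (h ⊕ 𝔽 4 F₁ F₀) ≼ 𝔽 5 F₁ F₀ ∷ 𝔽 3 F₁ F₀ ≼ k ⊕ h ∷ []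
                      ⊢ t₁ ≼ k)
                    0 (1 ∷ 1 ∷ []) (≤-reflexive eq) (≤-reflexive (sym k+h)))
                  (linear (F (suc c) ∷ F c ∷ _ ∷ h ∷ k ∷ [])
                    (λ F₁ F₀ t₁ h k → 𝔽 5 F₁ F₀ ≼ t₁ ⊕ (h ⊕ 𝔽 4 F₁ F₀) ∷ k ⊕ h ≼ 𝔽 3 F₁ F₀ ∷ []
                      ⊢ k ≼ t₁)
                    0 (1 ∷ 1 ∷ []) (≤-reflexive (sym eq)) (≤-reflexive k+h))

  fixed-or-swapped : (A : Auto N) → IsIdentity A ⊎ Swapped A
  fixed-or-swapped A = map₂ (λ { (_ , E) → swapped E }) (fixed-or-exceptional A 34≤N)
    where
    open Images A
    located : ∀ {e v x} → In N v → In N x → to x ≡ x → x + x ≡ F (1 + e) → x + v ≡ F (3 + e) →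
              x + to v ≡ F (5 + e) → N + x < F (7 + e) → Swapped A
    located {e} {v} {x} iv ix to-x 2x x+v x+w N+x<F = result e≡c v≡h x≡k
      where
      2v : v + v ≡ F (4 + e)
      2v = ≤-antisym (linear (F (suc e) ∷ x ∷ v ∷ F e ∷ [])
                (λ F₁ x v F₀ → F₁ ≼ x ⊕ x ∷ x ⊕ v ≼ 𝔽 3 F₁ F₀ ∷ [] ⊢ v ⊕ v ≼ 𝔽 4 F₁ F₀)
                0 (1 ∷ 2 ∷ []) (≤-reflexive (sym 2x)) (≤-reflexive x+v))
              (linear (x ∷ F (suc e) ∷ F e ∷ v ∷ [])
                (λ x F₁ F₀ v → x ⊕ x ≼ F₁ ∷ 𝔽 3 F₁ F₀ ≼ x ⊕ v ∷ [] ⊢ 𝔽 4 F₁ F₀ ≼ v ⊕ v)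
                0 (1 ∷ 2 ∷ []) (≤-reflexive 2x) (≤-reflexive (sym x+v)))
      x≤F : x ≤ F (1 + e)
      x≤F = linear (x ∷ F (suc e) ∷ [])
                (λ x F₁ → x ⊕ x ≼ F₁ ∷ [] ⊢ x ≼ F₁)
                1 (1 ∷ []) (≤-reflexive 2x)
      1≤F : 1 ≤ F (1 + e)
      1≤F = F-pos {1 + e} (s≤s z≤n)
      -- The images lie in {1, ..., N}, which bounds `e` above, and the bound on N + x bounds it
      -- below. Within this window of two on each side, parity leaves one value.
      e≡c : e ≡ c
      e≡c = even-close {c} {e} {h} {v} 2h 2v
        (≤-pred (+-cancelˡ-< 4 _ _ (F-cancel-< {4 + e} {7 + c} (linear (F (suc e) ∷ F e ∷ x ∷ _ ∷ N ∷ F (suc c) ∷ F c ∷ [])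
                  (λ F₁ F₀ x t₁ N G₁ G₀ →
                    𝔽 5 F₁ F₀ ≼ x ⊕ t₁ ∷ x ≼ F₁ ∷ t₁ ≼ N ∷ κ 1 ⊕ N ≼ 𝔽 7 G₁ G₀ ∷ κ 1 ≼ F₁ ∷ []
                    ⊢ κ 1 ⊕ 𝔽 4 F₁ F₀ ≼ 𝔽 7 G₁ G₀)
                  0 (1 ∷ 1 ∷ 1 ∷ 1 ∷ 1 ∷ []) (≤-reflexive (sym x+w)) x≤F (proj₂ (to-in iv)) N-hi 1≤F))))
        (≤-pred (+-cancelˡ-< 4 _ _ (F-cancel-< {4 + c} {7 + e} (linear (N ∷ x ∷ F (suc e) ∷ F e ∷ F (suc c) ∷ F c ∷ [])
                  (λ N x F₁ F₀ G₁ G₀ → κ 1 ⊕ (N ⊕ x) ≼ 𝔽 7 F₁ F₀ ∷ 𝔽 4 G₁ G₀ ≼ N ∷ []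
                    ⊢ κ 1 ⊕ 𝔽 4 G₁ G₀ ≼ 𝔽 7 F₁ F₀)
                  0 (1 ∷ 1 ∷ []) N+x<F N-lo))))
      v≡h : v ≡ h
      v≡h = double-injective {v} {h} (trans 2v (trans (cong (λ e → F (4 + e)) e≡c) (sym 2h)))
      x≡k : x ≡ k
      x≡k = +-cancelʳ-≡ v x k (trans x+v (trans (cong (λ e → F (3 + e)) e≡c)
        (trans (sym k+h) (cong (k +_) (sym v≡h)))))
      result : e ≡ c → v ≡ h → x ≡ k → Swapped A
      result refl refl refl = record
        { h-to-t = (≤-antisym (linear (k ∷ _ ∷ F (suc c) ∷ F c ∷ h ∷ [])
                  (λ k t₁ F₁ F₀ h → k ⊕ t₁ ≼ 𝔽 5 F₁ F₀ ∷ 𝔽 3 F₁ F₀ ≼ k ⊕ h ∷ []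
                    ⊢ t₁ ≼ h ⊕ 𝔽 4 F₁ F₀)
                  0 (1 ∷ 1 ∷ []) (≤-reflexive x+w) (≤-reflexive (sym x+v)))
                (linear (F (suc c) ∷ F c ∷ k ∷ _ ∷ h ∷ [])
                  (λ F₁ F₀ k t₁ h → 𝔽 5 F₁ F₀ ≼ k ⊕ t₁ ∷ k ⊕ h ≼ 𝔽 3 F₁ F₀ ∷ []
                    ⊢ h ⊕ 𝔽 4 F₁ F₀ ≼ t₁)
                  0 (1 ∷ 1 ∷ []) (≤-reflexive (sym x+w)) (≤-reflexive x+v))) ; k-in = ix ; k-to-k = to-x ; N+k<F = N+x<F }
    swapped : ∀ {e} → Exceptional A e → Swapped A
    swapped {e} E = located {e} {v} {x} v-in x-in to-x 2x x+v x+w N+x<F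
      where open Exceptional E

  rigid : (∀ {A} → Swapped A → ⊥) → (A : Auto N) → IsIdentity A
  rigid absurd A = [ (λ p → p) , (λ s → ⊥-elim (absurd {A} s)) ]′ (fixed-or-swapped A)

  trivial-below-3h : 2 * N < 3 * F (4 + c) → ∀ {A} → Swapped A → ⊥
  trivial-below-3h small S = n≮0 (linear (N ∷ F (suc c) ∷ F c ∷ h ∷ [])
            (λ N F₁ F₀ h →
              κ 1 ⊕ (N ⊕ (N ⊕ κ 0)) ≼ 𝔽 4 F₁ F₀ ⊕ (𝔽 4 F₁ F₀ ⊕ (𝔽 4 F₁ F₀ ⊕ κ 0)) ∷
              h ⊕ 𝔽 4 F₁ F₀ ≼ N ∷ 𝔽 4 F₁ F₀ ≼ h ⊕ h ∷ []
              ⊢ κ 1 ≼ κ 0)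
            0 (1 ∷ 2 ∷ 1 ∷ []) small (Swapped.t≤N S) (≤-reflexive (sym 2h)))

  -- Here F (6 + c) - h is a vertex but F (7 + c) - t is not: `h` reaches index 6 + c and `t`
  -- nothing higher.
  trivial-middle : F (7 + c) ≤ 2 * N → 2 * N < 2 * F (6 + c) + F (1 + c) → ∀ {A} → Swapped A → ⊥
  trivial-middle large small S =
    n≮n (6 + c) (Swapped.index-gap S {6 + c} {6 + c} (n≤1+n (5 + c)) lower upper)
    where
    lower : F (6 + c) ≤ N + h
    lower = linear (F (suc c) ∷ F c ∷ N ∷ h ∷ [])
              (λ F₁ F₀ N h → 𝔽 7 F₁ F₀ ≼ N ⊕ (N ⊕ κ 0) ∷ 𝔽 4 F₁ F₀ ≼ h ⊕ h ∷ []
                ⊢ 𝔽 6 F₁ F₀ ≼ N ⊕ h)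
              1 (1 ∷ 1 ∷ []) large (≤-reflexive (sym 2h))
    upper : N + t < F (7 + c)
    upper = linear (N ∷ F (suc c) ∷ F c ∷ h ∷ [])
              (λ N F₁ F₀ h →
                κ 1 ⊕ (N ⊕ (N ⊕ κ 0)) ≼ 𝔽 6 F₁ F₀ ⊕ (𝔽 6 F₁ F₀ ⊕ κ 0) ⊕ F₁ ∷ h ⊕ h ≼ 𝔽 4 F₁ F₀ ∷ []
                ⊢ κ 1 ⊕ (N ⊕ (h ⊕ 𝔽 4 F₁ F₀)) ≼ 𝔽 7 F₁ F₀)
              1 (1 ∷ 1 ∷ []) small (≤-reflexive 2h)

  -- Now `h` has gained the neighbour F (7 + c) - h, while `t` still stops short of index 8 + c.
  trivial-top : 2 * F (7 + c) ≤ 2 * N + F (4 + c) → ∀ {A} → Swapped A → ⊥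
  trivial-top large S =
    n≮n (7 + c) (Swapped.index-gap S {7 + c} {7 + c} (m≤n⇒m≤1+n (n≤1+n (5 + c))) lower upper)
    where
    lower : F (7 + c) ≤ N + h
    lower = linear (F (suc c) ∷ F c ∷ N ∷ h ∷ [])
              (λ F₁ F₀ N h →
                𝔽 7 F₁ F₀ ⊕ (𝔽 7 F₁ F₀ ⊕ κ 0) ≼ N ⊕ (N ⊕ κ 0) ⊕ 𝔽 4 F₁ F₀ ∷ 𝔽 4 F₁ F₀ ≼ h ⊕ h ∷ []
                ⊢ 𝔽 7 F₁ F₀ ≼ N ⊕ h)
              1 (1 ∷ 1 ∷ []) large (≤-reflexive (sym 2h))
    upper : N + t < F (8 + c)
    upper = linear (N ∷ F (suc c) ∷ F c ∷ h ∷ [])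
              (λ N F₁ F₀ h → κ 1 ⊕ N ≼ 𝔽 7 F₁ F₀ ∷ h ⊕ h ≼ 𝔽 4 F₁ F₀ ∷ []
                ⊢ κ 1 ⊕ (N ⊕ (h ⊕ 𝔽 4 F₁ F₀)) ≼ 𝔽 8 F₁ F₀)
              3 (5 ∷ 2 ∷ []) N-hi (≤-reflexive 2h)

-- The exceptional automorphism

swapℕ-left : ∀ a b → swapℕ a b a ≡ b
swapℕ-left a b with a ≟ a
... | yes _  = refl
... | no a≢a = ⊥-elim (a≢a refl)

swapℕ-right : ∀ a b → swapℕ a b b ≡ a
swapℕ-right a b with b ≟ a
... | yes b≡a = b≡a
... | no _ with b ≟ b
...   | yes _  = refl
...   | no b≢b = ⊥-elim (b≢b refl)

swapℕ-other : ∀ {a b u} → u ≢ a → u ≢ b → swapℕ a b u ≡ u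
swapℕ-other {a} {b} {u} u≢a u≢b with u ≟ a
... | yes u≡a = ⊥-elim (u≢a u≡a)
... | no _ with u ≟ b
...   | yes u≡b = ⊥-elim (u≢b u≡b)
...   | no _    = refl

record ExchangesPairs (h t s r : ℕ) (φ : ℕ → ℕ) : Set where
  field
    φ-h     : φ h ≡ t
    φ-t     : φ t ≡ h
    φ-s     : φ s ≡ r
    φ-r     : φ r ≡ s
    φ-other : ∀ {u} → u ≢ h → u ≢ t → u ≢ s → u ≢ r → φ u ≡ u

swaps-exchange : ∀ {h t s r} → h < t → t < s → s < r →
                 ExchangesPairs h t s r (λ u → swapℕ h t (swapℕ r s u))
swaps-exchange {h} {t} {s} {r} h<t t<s s<r = record
  { φ-h = trans (cong (swapℕ h t) (swapℕ-other (<⇒≢ (<-trans h<s s<r)) (<⇒≢ h<s))) (swapℕ-left h t)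
  ; φ-t = trans (cong (swapℕ h t) (swapℕ-other (<⇒≢ (<-trans t<s s<r)) (<⇒≢ t<s))) (swapℕ-right h t)
  ; φ-s = trans (cong (swapℕ h t) (swapℕ-right r s)) (swapℕ-other (>⇒≢ (<-trans h<s s<r)) (>⇒≢ (<-trans t<s s<r)))
  ; φ-r = trans (cong (swapℕ h t) (swapℕ-left r s)) (swapℕ-other (>⇒≢ h<s) (>⇒≢ t<s))
  ; φ-other = λ ≢h ≢t ≢s ≢r → trans (cong (swapℕ h t) (swapℕ-other ≢r ≢s)) (swapℕ-other ≢h ≢t)
  }
  where
  h<s : h < s
  h<s = <-trans h<t t<s

-- In the notation of the statement, h = F n / 2, t = 3 F n / 2, s = F (n + 3) / 2 and
-- r = F (n + 2) + F (n - 3) / 2. When s > N only the exchange of h and t is visible.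
module Reflection {N c h k t s r : ℕ} (2≤c : 2 ≤ c) (2h : h + h ≡ F (4 + c)) (k+h : k + h ≡ F (3 + c))
                  (t≡ : t ≡ h + F (4 + c)) (s≡ : s ≡ F (5 + c) + h) (r≡ : r ≡ F (6 + c) + k)
                  {φ : ℕ → ℕ} (exchanges : ExchangesPairs h t s r φ)
                  (t≤N : t ≤ N) (N+h<F : N + h < F (7 + c)) (r≤N : s ≤ N → r ≤ N) where
  open ExchangesPairs exchanges

  F-c-pos : 1 ≤ F c
  F-c-pos = F-pos (≤-trans (s≤s z≤n) 2≤c)

  F-c-< : F c < F (1 + c)
  F-c-< = F-strict 2≤c ≤-refl

  k<h : k < h
  k<h = linear (F (suc c) ∷ F c ∷ h ∷ k ∷ [])
            (λ F₁ F₀ h k → 𝔽 4 F₁ F₀ ≼ h ⊕ h ∷ k ⊕ h ≼ 𝔽 3 F₁ F₀ ∷ κ 1 ≼ F₀ ∷ [] ⊢ κ 1 ⊕ k ≼ h)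
            0 (1 ∷ 1 ∷ 1 ∷ []) (≤-reflexive (sym 2h)) (≤-reflexive k+h) F-c-pos

  h<t : h < t
  h<t = linear (h ∷ F (suc c) ∷ F c ∷ t ∷ [])
            (λ h F₁ F₀ t → h ⊕ 𝔽 4 F₁ F₀ ≼ t ∷ κ 1 ≼ F₀ ∷ [] ⊢ κ 1 ⊕ h ≼ t)
            0 (1 ∷ 2 ∷ []) (≤-reflexive (sym t≡)) F-c-pos

  t<s : t < s
  t<s = linear (t ∷ h ∷ F (suc c) ∷ F c ∷ s ∷ [])
            (λ t h F₁ F₀ s → t ≼ h ⊕ 𝔽 4 F₁ F₀ ∷ 𝔽 5 F₁ F₀ ⊕ h ≼ s ∷ κ 1 ⊕ F₀ ≼ F₁ ∷ []
              ⊢ κ 1 ⊕ t ≼ s)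
            0 (1 ∷ 1 ∷ 2 ∷ []) (≤-reflexive t≡) (≤-reflexive (sym s≡)) F-c-<

  s<r : s < r
  s<r = linear (s ∷ F (suc c) ∷ F c ∷ h ∷ k ∷ r ∷ [])
            (λ s F₁ F₀ h k r →
              s ≼ 𝔽 5 F₁ F₀ ⊕ h ∷ 𝔽 6 F₁ F₀ ⊕ k ≼ r ∷ h ⊕ h ≼ 𝔽 4 F₁ F₀ ∷ κ 1 ≼ F₀ ∷ []
              ⊢ κ 1 ⊕ s ≼ r)
            1 (2 ∷ 2 ∷ 1 ∷ 2 ∷ []) (≤-reflexive s≡) (≤-reflexive (sym r≡)) (≤-reflexive 2h) F-c-pos

  h≤N : h ≤ N
  h≤N = ≤-trans (<⇒≤ h<t) t≤N

  φ-k : φ k ≡ k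
  φ-k = φ-other (<⇒≢ k<h) (<⇒≢ k<t) (<⇒≢ (<-trans k<t t<s)) (<⇒≢ (<-trans k<t (<-trans t<s s<r)))
    where
    k<t : k < t
    k<t = <-trans k<h h<t

  -- F (3 + c) + h is, besides `k`, the other common neighbour of `h` and `t`.
  φ-g : ∀ {g} → g ≡ F (3 + c) + h → φ g ≡ g
  φ-g {g} g≡ = φ-other (>⇒≢ h<g) (<⇒≢ g<t) (<⇒≢ (<-trans g<t t<s)) (<⇒≢ (<-trans g<t (<-trans t<s s<r)))
    where
    h<g : h < g
    h<g = linear (F (suc c) ∷ F c ∷ h ∷ g ∷ [])
              (λ F₁ F₀ h g → 𝔽 3 F₁ F₀ ⊕ h ≼ g ∷ κ 1 ≼ F₀ ∷ [] ⊢ κ 1 ⊕ h ≼ g)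
              0 (1 ∷ 1 ∷ []) (≤-reflexive (sym g≡)) F-c-pos
    g<t : g < t
    g<t = linear (g ∷ F (suc c) ∷ F c ∷ h ∷ t ∷ [])
              (λ g F₁ F₀ h t → g ≼ 𝔽 3 F₁ F₀ ⊕ h ∷ h ⊕ 𝔽 4 F₁ F₀ ≼ t ∷ κ 1 ⊕ F₀ ≼ F₁ ∷ []
                ⊢ κ 1 ⊕ g ≼ t)
              0 (1 ∷ 1 ∷ 1 ∷ []) (≤-reflexive g≡) (≤-reflexive (sym t≡)) F-c-<

  data Kind (u : ℕ) : Set where
    is-h  : u ≡ h → Kind u
    is-t  : u ≡ t → Kind u
    is-s  : u ≡ s → Kind u
    is-r  : u ≡ r → Kind u
    other : φ u ≡ u → Kind u

  kind : ∀ u → Kind u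
  kind u with u ≟ h | u ≟ t | u ≟ s | u ≟ r
  ... | yes p | _     | _     | _     = is-h p
  ... | no _  | yes p | _     | _     = is-t p
  ... | no _  | no _  | yes p | _     = is-s p
  ... | no _  | no _  | no _  | yes p = is-r p
  ... | no ≢h | no ≢t | no ≢s | no ≢r = other (φ-other ≢h ≢t ≢s ≢r)

  φ-in : ∀ {u} → In N u → In N (φ u)
  φ-in {u} iu@(1≤u , u≤N) with kind u
  ... | is-h refl = subst (In N) (sym φ-h) (≤-trans 1≤u (<⇒≤ h<t) , t≤N)
  ... | is-t refl = subst (In N) (sym φ-t) ((linear (k ∷ h ∷ [])
            (λ k h → κ 1 ⊕ k ≼ h ∷ [] ⊢ κ 1 ≼ h)
            0 (1 ∷ []) k<h) , h≤N)
  ... | is-s refl = subst (In N) (sym φ-s) (≤-trans 1≤u (<⇒≤ s<r) , r≤N u≤N)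
  ... | is-r refl = subst (In N) (sym φ-r) (≤-trans (s≤s z≤n) t<s , ≤-trans (<⇒≤ s<r) u≤N)
  ... | other p   = subst (In N) (sym p) iu

  φ-involutive : ∀ u → φ (φ u) ≡ u
  φ-involutive u with kind u
  ... | is-h refl = trans (cong φ φ-h) φ-t
  ... | is-t refl = trans (cong φ φ-t) φ-h
  ... | is-s refl = trans (cong φ φ-s) φ-r
  ... | is-r refl = trans (cong φ φ-r) φ-s
  ... | other p   = trans (cong φ p) p

  -- Leaves four candidate indices, so that the neighbours of each moved vertex can be listed index
  -- by index.
  index-range : ∀ a {j y} → F a < y → y < F (5 + a) → y ≡ F j → ∃ λ o → o < 4 × j ≡ o + suc a
  index-range a {j} lo hi refl with offset (F-cancel-< {a} {j} lo)
  ... | o , o+a≡j = o , +-cancelʳ-< (suc a) o 4 (subst (_< 5 + a) (sym o+a≡j) j<) , sym o+a≡j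
    where
    j< : j < 5 + a
    j< = F-cancel-< {j} {5 + a} hi

  module _ {v : ℕ} (iv : In N v) where

    -- The indices 3 + c to 6 + c give `k`, the loop, F (3 + c) + h and `s`. Index 7 + c is out of
    -- reach because N + h < F (7 + c).
    neighbour-of-h : v ≢ h → IsFibonacci (v + h) → v ≡ k ⊎ v ≡ F (3 + c) + h ⊎ v ≡ s
    neighbour-of-h v≢h (j , eq) = cases (index-range (2 + c) {j} lower upper (sym eq))
      where
      lower : F (2 + c) < v + h
      lower = linear (v ∷ F (suc c) ∷ F c ∷ h ∷ [])
                (λ v F₁ F₀ h → κ 1 ≼ v ∷ 𝔽 4 F₁ F₀ ≼ h ⊕ h ∷ [] ⊢ κ 1 ⊕ 𝔽 2 F₁ F₀ ≼ v ⊕ h)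
                1 (2 ∷ 1 ∷ []) (proj₁ iv) (≤-reflexive (sym 2h))
      upper : v + h < F (7 + c)
      upper = ≤-<-trans (+-monoˡ-≤ h (proj₂ iv)) N+h<F
      cases : ∃ (λ o → o < 4 × j ≡ o + (3 + c)) → v ≡ k ⊎ v ≡ F (3 + c) + h ⊎ v ≡ s
      cases (0 , _ , refl) = inj₁ (≤-antisym (linear (v ∷ h ∷ F (suc c) ∷ F c ∷ k ∷ [])
                (λ v h F₁ F₀ k → v ⊕ h ≼ 𝔽 3 F₁ F₀ ∷ 𝔽 3 F₁ F₀ ≼ k ⊕ h ∷ [] ⊢ v ≼ k)
                0 (1 ∷ 1 ∷ []) (≤-reflexive (sym eq)) (≤-reflexive (sym k+h)))
              (linear (F (suc c) ∷ F c ∷ v ∷ h ∷ k ∷ [])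
                (λ F₁ F₀ v h k → 𝔽 3 F₁ F₀ ≼ v ⊕ h ∷ k ⊕ h ≼ 𝔽 3 F₁ F₀ ∷ [] ⊢ k ≼ v)
                0 (1 ∷ 1 ∷ []) (≤-reflexive eq) (≤-reflexive k+h)))
      cases (1 , _ , refl) = ⊥-elim (v≢h (≤-antisym (linear (v ∷ h ∷ F (suc c) ∷ F c ∷ [])
                (λ v h F₁ F₀ → v ⊕ h ≼ 𝔽 4 F₁ F₀ ∷ 𝔽 4 F₁ F₀ ≼ h ⊕ h ∷ [] ⊢ v ≼ h)
                0 (1 ∷ 1 ∷ []) (≤-reflexive (sym eq)) (≤-reflexive (sym 2h)))
              (linear (F (suc c) ∷ F c ∷ v ∷ h ∷ [])
                (λ F₁ F₀ v h → 𝔽 4 F₁ F₀ ≼ v ⊕ h ∷ h ⊕ h ≼ 𝔽 4 F₁ F₀ ∷ [] ⊢ h ≼ v)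
                0 (1 ∷ 1 ∷ []) (≤-reflexive eq) (≤-reflexive 2h))))
      cases (2 , _ , refl) = inj₂ (inj₁ (≤-antisym (linear (v ∷ h ∷ F (suc c) ∷ F c ∷ [])
                (λ v h F₁ F₀ → v ⊕ h ≼ 𝔽 5 F₁ F₀ ∷ 𝔽 4 F₁ F₀ ≼ h ⊕ h ∷ [] ⊢ v ≼ 𝔽 3 F₁ F₀ ⊕ h)
                0 (1 ∷ 1 ∷ []) (≤-reflexive (sym eq)) (≤-reflexive (sym 2h)))
              (linear (F (suc c) ∷ F c ∷ v ∷ h ∷ [])
                (λ F₁ F₀ v h → 𝔽 5 F₁ F₀ ≼ v ⊕ h ∷ h ⊕ h ≼ 𝔽 4 F₁ F₀ ∷ [] ⊢ 𝔽 3 F₁ F₀ ⊕ h ≼ v)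
                0 (1 ∷ 1 ∷ []) (≤-reflexive eq) (≤-reflexive 2h))))
      cases (3 , _ , refl) = inj₂ (inj₂ (≤-antisym (linear (v ∷ h ∷ F (suc c) ∷ F c ∷ s ∷ [])
                (λ v h F₁ F₀ s → v ⊕ h ≼ 𝔽 6 F₁ F₀ ∷ 𝔽 4 F₁ F₀ ≼ h ⊕ h ∷ 𝔽 5 F₁ F₀ ⊕ h ≼ s ∷ []
                  ⊢ v ≼ s)
                0 (1 ∷ 1 ∷ 1 ∷ []) (≤-reflexive (sym eq)) (≤-reflexive (sym 2h)) (≤-reflexive (sym s≡)))
              (linear (F (suc c) ∷ F c ∷ v ∷ h ∷ s ∷ [])
                (λ F₁ F₀ v h s → 𝔽 6 F₁ F₀ ≼ v ⊕ h ∷ h ⊕ h ≼ 𝔽 4 F₁ F₀ ∷ s ≼ 𝔽 5 F₁ F₀ ⊕ h ∷ []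
                  ⊢ s ≼ v)
                0 (1 ∷ 1 ∷ 1 ∷ []) (≤-reflexive eq) (≤-reflexive 2h) (≤-reflexive s≡))))
      cases (suc (suc (suc (suc _))) , s≤s (s≤s (s≤s (s≤s ()))) , _)

    neighbour-of-t : v ≢ t → IsFibonacci (v + t) → v ≡ k ⊎ v ≡ F (3 + c) + h ⊎ v ≡ r
    neighbour-of-t v≢t (j , eq) = cases (index-range (4 + c) {j} lower upper (sym eq))
      where
      lower : F (4 + c) < v + t
      lower = linear (v ∷ h ∷ F (suc c) ∷ F c ∷ t ∷ [])
                (λ v h F₁ F₀ t → κ 1 ≼ v ∷ h ⊕ 𝔽 4 F₁ F₀ ≼ t ∷ [] ⊢ κ 1 ⊕ 𝔽 4 F₁ F₀ ≼ v ⊕ t)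
                0 (1 ∷ 1 ∷ []) (proj₁ iv) (≤-reflexive (sym t≡))
      upper : v + t < F (9 + c)
      upper = linear (v ∷ N ∷ h ∷ F (suc c) ∷ F c ∷ t ∷ [])
                (λ v N h F₁ F₀ t → v ≼ N ∷ κ 1 ⊕ (N ⊕ h) ≼ 𝔽 7 F₁ F₀ ∷ t ≼ h ⊕ 𝔽 4 F₁ F₀ ∷ []
                  ⊢ κ 1 ⊕ (v ⊕ t) ≼ 𝔽 9 F₁ F₀)
                7 (8 ∷ 19 ∷ 8 ∷ []) (proj₂ iv) N+h<F (≤-reflexive t≡)
      below : v + t < F (8 + c)
      below = linear (v ∷ N ∷ h ∷ F (suc c) ∷ F c ∷ t ∷ [])
                (λ v N h F₁ F₀ t →
                  v ≼ N ∷ κ 1 ⊕ (N ⊕ h) ≼ 𝔽 7 F₁ F₀ ∷ κ 1 ≼ F₀ ∷ t ≼ h ⊕ 𝔽 4 F₁ F₀ ∷ []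
                  ⊢ κ 1 ⊕ (v ⊕ t) ≼ 𝔽 8 F₁ F₀)
                0 (1 ∷ 1 ∷ 3 ∷ 1 ∷ []) (proj₂ iv) N+h<F F-c-pos (≤-reflexive t≡)
      cases : ∃ (λ o → o < 4 × j ≡ o + (5 + c)) → v ≡ k ⊎ v ≡ F (3 + c) + h ⊎ v ≡ r
      cases (0 , _ , refl) = inj₁ (≤-antisym (linear (v ∷ t ∷ F (suc c) ∷ F c ∷ k ∷ h ∷ [])
                (λ v t F₁ F₀ k h → v ⊕ t ≼ 𝔽 5 F₁ F₀ ∷ 𝔽 3 F₁ F₀ ≼ k ⊕ h ∷ h ⊕ 𝔽 4 F₁ F₀ ≼ t ∷ []
                  ⊢ v ≼ k)
                0 (1 ∷ 1 ∷ 1 ∷ []) (≤-reflexive (sym eq)) (≤-reflexive (sym k+h)) (≤-reflexive (sym t≡)))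
              (linear (F (suc c) ∷ F c ∷ v ∷ t ∷ k ∷ h ∷ [])
                (λ F₁ F₀ v t k h → 𝔽 5 F₁ F₀ ≼ v ⊕ t ∷ k ⊕ h ≼ 𝔽 3 F₁ F₀ ∷ t ≼ h ⊕ 𝔽 4 F₁ F₀ ∷ []
                  ⊢ k ≼ v)
                0 (1 ∷ 1 ∷ 1 ∷ []) (≤-reflexive eq) (≤-reflexive k+h) (≤-reflexive t≡)))
      cases (1 , _ , refl) = inj₂ (inj₁ (≤-antisym (linear (v ∷ t ∷ F (suc c) ∷ F c ∷ h ∷ [])
                (λ v t F₁ F₀ h → v ⊕ t ≼ 𝔽 6 F₁ F₀ ∷ 𝔽 4 F₁ F₀ ≼ h ⊕ h ∷ h ⊕ 𝔽 4 F₁ F₀ ≼ t ∷ []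
                  ⊢ v ≼ 𝔽 3 F₁ F₀ ⊕ h)
                0 (1 ∷ 1 ∷ 1 ∷ []) (≤-reflexive (sym eq)) (≤-reflexive (sym 2h)) (≤-reflexive (sym t≡)))
              (linear (F (suc c) ∷ F c ∷ v ∷ t ∷ h ∷ [])
                (λ F₁ F₀ v t h → 𝔽 6 F₁ F₀ ≼ v ⊕ t ∷ h ⊕ h ≼ 𝔽 4 F₁ F₀ ∷ t ≼ h ⊕ 𝔽 4 F₁ F₀ ∷ []
                  ⊢ 𝔽 3 F₁ F₀ ⊕ h ≼ v)
                0 (1 ∷ 1 ∷ 1 ∷ []) (≤-reflexive eq) (≤-reflexive 2h) (≤-reflexive t≡))))
      cases (2 , _ , refl) = inj₂ (inj₂ (≤-antisym (linear (v ∷ t ∷ F (suc c) ∷ F c ∷ k ∷ h ∷ r ∷ [])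
                (λ v t F₁ F₀ k h r →
                  v ⊕ t ≼ 𝔽 7 F₁ F₀ ∷ 𝔽 3 F₁ F₀ ≼ k ⊕ h ∷ h ⊕ 𝔽 4 F₁ F₀ ≼ t ∷ 𝔽 6 F₁ F₀ ⊕ k ≼ r ∷ []
                  ⊢ v ≼ r)
                0 (1 ∷ 1 ∷ 1 ∷ 1 ∷ []) (≤-reflexive (sym eq)) (≤-reflexive (sym k+h)) (≤-reflexive (sym t≡)) (≤-reflexive (sym r≡)))
              (linear (F (suc c) ∷ F c ∷ v ∷ t ∷ k ∷ h ∷ r ∷ [])
                (λ F₁ F₀ v t k h r →
                  𝔽 7 F₁ F₀ ≼ v ⊕ t ∷ k ⊕ h ≼ 𝔽 3 F₁ F₀ ∷ t ≼ h ⊕ 𝔽 4 F₁ F₀ ∷ r ≼ 𝔽 6 F₁ F₀ ⊕ k ∷ []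
                  ⊢ r ≼ v)
                0 (1 ∷ 1 ∷ 1 ∷ 1 ∷ []) (≤-reflexive eq) (≤-reflexive k+h) (≤-reflexive t≡) (≤-reflexive r≡))))
      cases (3 , _ , refl) = ⊥-elim (<-irrefl (sym eq) below)
      cases (suc (suc (suc (suc _))) , s≤s (s≤s (s≤s (s≤s ()))) , _)

    -- Index 6 + c gives `h`, and s + s = F (7 + c) is a loop.
    neighbour-of-s : v ≢ s → IsFibonacci (v + s) → v ≡ h
    neighbour-of-s v≢s (j , eq) = cases (index-range (5 + c) {j} lower upper (sym eq))
      where
      lower : F (5 + c) < v + s
      lower = linear (v ∷ F (suc c) ∷ F c ∷ h ∷ s ∷ [])
                (λ v F₁ F₀ h s → κ 1 ≼ v ∷ 𝔽 5 F₁ F₀ ⊕ h ≼ s ∷ [] ⊢ κ 1 ⊕ 𝔽 5 F₁ F₀ ≼ v ⊕ s)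
                0 (1 ∷ 1 ∷ []) (proj₁ iv) (≤-reflexive (sym s≡))
      below : v + s < F (8 + c)
      below = linear (v ∷ N ∷ h ∷ F (suc c) ∷ F c ∷ s ∷ [])
                (λ v N h F₁ F₀ s →
                  v ≼ N ∷ κ 1 ⊕ (N ⊕ h) ≼ 𝔽 7 F₁ F₀ ∷ κ 1 ≼ F₀ ∷ s ≼ 𝔽 5 F₁ F₀ ⊕ h ∷ []
                  ⊢ κ 1 ⊕ (v ⊕ s) ≼ 𝔽 8 F₁ F₀)
                0 (1 ∷ 1 ∷ 2 ∷ 1 ∷ []) (proj₂ iv) N+h<F F-c-pos (≤-reflexive s≡)
      upper : v + s < F (10 + c)
      upper = <-≤-trans below (F-mono (m≤n⇒m≤1+n (n≤1+n (8 + c))))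
      cases : ∃ (λ o → o < 4 × j ≡ o + (6 + c)) → v ≡ h
      cases (0 , _ , refl) = ≤-antisym (linear (v ∷ s ∷ F (suc c) ∷ F c ∷ h ∷ [])
                (λ v s F₁ F₀ h → v ⊕ s ≼ 𝔽 6 F₁ F₀ ∷ 𝔽 4 F₁ F₀ ≼ h ⊕ h ∷ 𝔽 5 F₁ F₀ ⊕ h ≼ s ∷ []
                  ⊢ v ≼ h)
                0 (1 ∷ 1 ∷ 1 ∷ []) (≤-reflexive (sym eq)) (≤-reflexive (sym 2h)) (≤-reflexive (sym s≡)))
              (linear (F (suc c) ∷ F c ∷ v ∷ s ∷ h ∷ [])
                (λ F₁ F₀ v s h → 𝔽 6 F₁ F₀ ≼ v ⊕ s ∷ h ⊕ h ≼ 𝔽 4 F₁ F₀ ∷ s ≼ 𝔽 5 F₁ F₀ ⊕ h ∷ []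
                  ⊢ h ≼ v)
                0 (1 ∷ 1 ∷ 1 ∷ []) (≤-reflexive eq) (≤-reflexive 2h) (≤-reflexive s≡))
      cases (1 , _ , refl) = ⊥-elim (v≢s (≤-antisym (linear (v ∷ s ∷ F (suc c) ∷ F c ∷ h ∷ [])
                (λ v s F₁ F₀ h → v ⊕ s ≼ 𝔽 7 F₁ F₀ ∷ 𝔽 4 F₁ F₀ ≼ h ⊕ h ∷ 𝔽 5 F₁ F₀ ⊕ h ≼ s ∷ []
                  ⊢ v ≼ s)
                0 (1 ∷ 1 ∷ 2 ∷ []) (≤-reflexive (sym eq)) (≤-reflexive (sym 2h)) (≤-reflexive (sym s≡)))
              (linear (F (suc c) ∷ F c ∷ v ∷ s ∷ h ∷ [])
                (λ F₁ F₀ v s h → 𝔽 7 F₁ F₀ ≼ v ⊕ s ∷ h ⊕ h ≼ 𝔽 4 F₁ F₀ ∷ s ≼ 𝔽 5 F₁ F₀ ⊕ h ∷ []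
                  ⊢ s ≼ v)
                0 (1 ∷ 1 ∷ 2 ∷ []) (≤-reflexive eq) (≤-reflexive 2h) (≤-reflexive s≡))))
      cases (suc (suc o) , _ , refl) = ⊥-elim (<⇒≱ below
        (≤-trans (F-mono (s≤s (s≤s (m≤n+m (6 + c) o)))) (≤-reflexive eq)))

    neighbour-of-r : IsFibonacci (v + r) → v ≡ t
    neighbour-of-r (j , eq) = cases (index-range (6 + c) {j} lower upper (sym eq))
      where
      lower : F (6 + c) < v + r
      lower = linear (v ∷ F (suc c) ∷ F c ∷ k ∷ r ∷ [])
                (λ v F₁ F₀ k r → κ 1 ≼ v ∷ 𝔽 6 F₁ F₀ ⊕ k ≼ r ∷ [] ⊢ κ 1 ⊕ 𝔽 6 F₁ F₀ ≼ v ⊕ r)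
                0 (1 ∷ 1 ∷ []) (proj₁ iv) (≤-reflexive (sym r≡))
      below : v + r < F (8 + c)
      below = linear (v ∷ N ∷ h ∷ F (suc c) ∷ F c ∷ k ∷ r ∷ [])
                (λ v N h F₁ F₀ k r →
                  v ≼ N ∷ κ 1 ⊕ (N ⊕ h) ≼ 𝔽 7 F₁ F₀ ∷ κ 1 ⊕ k ≼ h ∷ r ≼ 𝔽 6 F₁ F₀ ⊕ k ∷ []
                  ⊢ κ 1 ⊕ (v ⊕ r) ≼ 𝔽 8 F₁ F₀)
                0 (1 ∷ 1 ∷ 1 ∷ 1 ∷ []) (proj₂ iv) N+h<F k<h (≤-reflexive r≡)
      upper : v + r < F (11 + c)
      upper = <-≤-trans below (F-mono (m≤n⇒m≤1+n (m≤n⇒m≤1+n (n≤1+n (8 + c)))))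
      cases : ∃ (λ o → o < 4 × j ≡ o + (7 + c)) → v ≡ t
      cases (0 , _ , refl) = ≤-antisym (linear (v ∷ r ∷ F (suc c) ∷ F c ∷ k ∷ h ∷ t ∷ [])
                (λ v r F₁ F₀ k h t →
                  v ⊕ r ≼ 𝔽 7 F₁ F₀ ∷ 𝔽 3 F₁ F₀ ≼ k ⊕ h ∷ 𝔽 6 F₁ F₀ ⊕ k ≼ r ∷ h ⊕ 𝔽 4 F₁ F₀ ≼ t ∷ []
                  ⊢ v ≼ t)
                0 (1 ∷ 1 ∷ 1 ∷ 1 ∷ []) (≤-reflexive (sym eq)) (≤-reflexive (sym k+h)) (≤-reflexive (sym r≡)) (≤-reflexive (sym t≡)))
              (linear (F (suc c) ∷ F c ∷ v ∷ r ∷ k ∷ h ∷ t ∷ [])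
                (λ F₁ F₀ v r k h t →
                  𝔽 7 F₁ F₀ ≼ v ⊕ r ∷ k ⊕ h ≼ 𝔽 3 F₁ F₀ ∷ r ≼ 𝔽 6 F₁ F₀ ⊕ k ∷ t ≼ h ⊕ 𝔽 4 F₁ F₀ ∷ []
                  ⊢ t ≼ v)
                0 (1 ∷ 1 ∷ 1 ∷ 1 ∷ []) (≤-reflexive eq) (≤-reflexive k+h) (≤-reflexive r≡) (≤-reflexive t≡))
      cases (suc o , _ , refl) = ⊥-elim (<⇒≱ below
        (≤-trans (F-mono (s≤s (m≤n+m (7 + c) o))) (≤-reflexive eq)))

  images-adjacent : ∀ {u v u′ v′} i → φ u ≡ u′ → φ v ≡ v′ → F i ≡ u′ + v′ → IsFibonacci (φ u + φ v)
  images-adjacent i p q eq = i , trans eq (cong₂ _+_ (sym p) (sym q))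

  φ-adjacent : ∀ {u v} → In N u → In N v → u ≢ v → IsFibonacci (u + v) → IsFibonacci (φ u + φ v)
  φ-adjacent {u} {v} iu iv u≢v fib = cases (kind u) (kind v)
    where
    -- A moved endpoint has one of the listed neighbours, and each such edge is checked to go to an
    -- edge. If neither endpoint is moved there is nothing to check.
    from-kind : ∀ {u v} → In N v → v ≢ u → IsFibonacci (v + u) → Kind u →
                IsFibonacci (φ u + φ v) ⊎ φ u ≡ u
    from-kind iv v≢u fib (is-h refl) with neighbour-of-h iv v≢u fib
    ... | inj₁ refl        = inj₁ (images-adjacent (5 + c) φ-h φ-k (≤-antisym (linear (F (suc c) ∷ F c ∷ k ∷ h ∷ t ∷ [])
              (λ F₁ F₀ k h t → 𝔽 3 F₁ F₀ ≼ k ⊕ h ∷ h ⊕ 𝔽 4 F₁ F₀ ≼ t ∷ [] ⊢ 𝔽 5 F₁ F₀ ≼ t ⊕ k)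
              0 (1 ∷ 1 ∷ []) (≤-reflexive (sym k+h)) (≤-reflexive (sym t≡)))
            (linear (k ∷ h ∷ F (suc c) ∷ F c ∷ t ∷ [])
              (λ k h F₁ F₀ t → k ⊕ h ≼ 𝔽 3 F₁ F₀ ∷ t ≼ h ⊕ 𝔽 4 F₁ F₀ ∷ [] ⊢ t ⊕ k ≼ 𝔽 5 F₁ F₀)
              0 (1 ∷ 1 ∷ []) (≤-reflexive k+h) (≤-reflexive t≡))))
    ... | inj₂ (inj₁ v≡)   = inj₁ (images-adjacent (6 + c) φ-h (φ-g v≡) (≤-antisym (linear (F (suc c) ∷ F c ∷ h ∷ t ∷ _ ∷ [])
              (λ F₁ F₀ h t v₁ → 𝔽 4 F₁ F₀ ≼ h ⊕ h ∷ h ⊕ 𝔽 4 F₁ F₀ ≼ t ∷ 𝔽 3 F₁ F₀ ⊕ h ≼ v₁ ∷ []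
                ⊢ 𝔽 6 F₁ F₀ ≼ t ⊕ v₁)
              0 (1 ∷ 1 ∷ 1 ∷ []) (≤-reflexive (sym 2h)) (≤-reflexive (sym t≡)) (≤-reflexive (sym v≡)))
            (linear (h ∷ F (suc c) ∷ F c ∷ t ∷ _ ∷ [])
              (λ h F₁ F₀ t v₁ → h ⊕ h ≼ 𝔽 4 F₁ F₀ ∷ t ≼ h ⊕ 𝔽 4 F₁ F₀ ∷ v₁ ≼ 𝔽 3 F₁ F₀ ⊕ h ∷ []
                ⊢ t ⊕ v₁ ≼ 𝔽 6 F₁ F₀)
              0 (1 ∷ 1 ∷ 1 ∷ []) (≤-reflexive 2h) (≤-reflexive t≡) (≤-reflexive v≡))))
    ... | inj₂ (inj₂ refl) = inj₁ (images-adjacent (7 + c) φ-h φ-s (≤-antisym (linear (F (suc c) ∷ F c ∷ k ∷ h ∷ t ∷ r ∷ [])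
              (λ F₁ F₀ k h t r → 𝔽 3 F₁ F₀ ≼ k ⊕ h ∷ h ⊕ 𝔽 4 F₁ F₀ ≼ t ∷ 𝔽 6 F₁ F₀ ⊕ k ≼ r ∷ []
                ⊢ 𝔽 7 F₁ F₀ ≼ t ⊕ r)
              0 (1 ∷ 1 ∷ 1 ∷ []) (≤-reflexive (sym k+h)) (≤-reflexive (sym t≡)) (≤-reflexive (sym r≡)))
            (linear (k ∷ h ∷ F (suc c) ∷ F c ∷ t ∷ r ∷ [])
              (λ k h F₁ F₀ t r → k ⊕ h ≼ 𝔽 3 F₁ F₀ ∷ t ≼ h ⊕ 𝔽 4 F₁ F₀ ∷ r ≼ 𝔽 6 F₁ F₀ ⊕ k ∷ []
                ⊢ t ⊕ r ≼ 𝔽 7 F₁ F₀)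
              0 (1 ∷ 1 ∷ 1 ∷ []) (≤-reflexive k+h) (≤-reflexive t≡) (≤-reflexive r≡))))
    from-kind iv v≢u fib (is-t refl) with neighbour-of-t iv v≢u fib
    ... | inj₁ refl        = inj₁ (images-adjacent (3 + c) φ-t φ-k (≤-antisym (linear (F (suc c) ∷ F c ∷ k ∷ h ∷ [])
              (λ F₁ F₀ k h → 𝔽 3 F₁ F₀ ≼ k ⊕ h ∷ [] ⊢ 𝔽 3 F₁ F₀ ≼ h ⊕ k)
              0 (1 ∷ []) (≤-reflexive (sym k+h)))
            (linear (k ∷ h ∷ F (suc c) ∷ F c ∷ [])
              (λ k h F₁ F₀ → k ⊕ h ≼ 𝔽 3 F₁ F₀ ∷ [] ⊢ h ⊕ k ≼ 𝔽 3 F₁ F₀)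
              0 (1 ∷ []) (≤-reflexive k+h))))
    ... | inj₂ (inj₁ v≡)   = inj₁ (images-adjacent (5 + c) φ-t (φ-g v≡) (≤-antisym (linear (F (suc c) ∷ F c ∷ h ∷ _ ∷ [])
              (λ F₁ F₀ h v₁ → 𝔽 4 F₁ F₀ ≼ h ⊕ h ∷ 𝔽 3 F₁ F₀ ⊕ h ≼ v₁ ∷ [] ⊢ 𝔽 5 F₁ F₀ ≼ h ⊕ v₁)
              0 (1 ∷ 1 ∷ []) (≤-reflexive (sym 2h)) (≤-reflexive (sym v≡)))
            (linear (h ∷ F (suc c) ∷ F c ∷ _ ∷ [])
              (λ h F₁ F₀ v₁ → h ⊕ h ≼ 𝔽 4 F₁ F₀ ∷ v₁ ≼ 𝔽 3 F₁ F₀ ⊕ h ∷ [] ⊢ h ⊕ v₁ ≼ 𝔽 5 F₁ F₀)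
              0 (1 ∷ 1 ∷ []) (≤-reflexive 2h) (≤-reflexive v≡))))
    ... | inj₂ (inj₂ refl) = inj₁ (images-adjacent (6 + c) φ-t φ-r (≤-antisym (linear (F (suc c) ∷ F c ∷ h ∷ s ∷ [])
              (λ F₁ F₀ h s → 𝔽 4 F₁ F₀ ≼ h ⊕ h ∷ 𝔽 5 F₁ F₀ ⊕ h ≼ s ∷ [] ⊢ 𝔽 6 F₁ F₀ ≼ h ⊕ s)
              0 (1 ∷ 1 ∷ []) (≤-reflexive (sym 2h)) (≤-reflexive (sym s≡)))
            (linear (h ∷ F (suc c) ∷ F c ∷ s ∷ [])
              (λ h F₁ F₀ s → h ⊕ h ≼ 𝔽 4 F₁ F₀ ∷ s ≼ 𝔽 5 F₁ F₀ ⊕ h ∷ [] ⊢ h ⊕ s ≼ 𝔽 6 F₁ F₀)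
              0 (1 ∷ 1 ∷ []) (≤-reflexive 2h) (≤-reflexive s≡))))
    from-kind iv v≢u fib (is-s refl) with neighbour-of-s iv v≢u fib
    ... | refl = inj₁ (images-adjacent (7 + c) φ-s φ-h (≤-antisym (linear (F (suc c) ∷ F c ∷ k ∷ h ∷ t ∷ r ∷ [])
              (λ F₁ F₀ k h t r → 𝔽 3 F₁ F₀ ≼ k ⊕ h ∷ h ⊕ 𝔽 4 F₁ F₀ ≼ t ∷ 𝔽 6 F₁ F₀ ⊕ k ≼ r ∷ []
                ⊢ 𝔽 7 F₁ F₀ ≼ r ⊕ t)
              0 (1 ∷ 1 ∷ 1 ∷ []) (≤-reflexive (sym k+h)) (≤-reflexive (sym t≡)) (≤-reflexive (sym r≡)))
            (linear (k ∷ h ∷ F (suc c) ∷ F c ∷ t ∷ r ∷ [])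
              (λ k h F₁ F₀ t r → k ⊕ h ≼ 𝔽 3 F₁ F₀ ∷ t ≼ h ⊕ 𝔽 4 F₁ F₀ ∷ r ≼ 𝔽 6 F₁ F₀ ⊕ k ∷ []
                ⊢ r ⊕ t ≼ 𝔽 7 F₁ F₀)
              0 (1 ∷ 1 ∷ 1 ∷ []) (≤-reflexive k+h) (≤-reflexive t≡) (≤-reflexive r≡))))
    from-kind iv v≢u fib (is-r refl) with neighbour-of-r iv fib
    ... | refl = inj₁ (images-adjacent (6 + c) φ-r φ-t (≤-antisym (linear (F (suc c) ∷ F c ∷ h ∷ s ∷ [])
              (λ F₁ F₀ h s → 𝔽 4 F₁ F₀ ≼ h ⊕ h ∷ 𝔽 5 F₁ F₀ ⊕ h ≼ s ∷ [] ⊢ 𝔽 6 F₁ F₀ ≼ s ⊕ h)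
              0 (1 ∷ 1 ∷ []) (≤-reflexive (sym 2h)) (≤-reflexive (sym s≡)))
            (linear (h ∷ F (suc c) ∷ F c ∷ s ∷ [])
              (λ h F₁ F₀ s → h ⊕ h ≼ 𝔽 4 F₁ F₀ ∷ s ≼ 𝔽 5 F₁ F₀ ⊕ h ∷ [] ⊢ s ⊕ h ≼ 𝔽 6 F₁ F₀)
              0 (1 ∷ 1 ∷ []) (≤-reflexive 2h) (≤-reflexive s≡))))
    from-kind _ _ _ (other p) = inj₂ p
    cases : Kind u → Kind v → IsFibonacci (φ u + φ v)
    cases ku kv with from-kind iv (u≢v ∘ sym) (subst IsFibonacci (+-comm u v) fib) ku
    ... | inj₁ fib′ = fib′
    ... | inj₂ p with from-kind iu u≢v fib kv
    ...   | inj₁ fib′ = subst IsFibonacci (+-comm (φ v) (φ u)) fib′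
    ...   | inj₂ q    = subst IsFibonacci (cong₂ _+_ (sym p) (sym q)) fib

  Φ : Auto N
  Φ = record
    { to = φ ; from = φ ; to-in = φ-in ; from-in = φ-in
    ; from-to = λ {u} _ → φ-involutive u ; to-from = λ {u} _ → φ-involutive u
    ; to-adj = φ-adjacent ; from-adj = φ-adjacent }

-- Automorphisms as permutations of Fin N

index-of : ∀ {N u} → In N u → Fin N
index-of {u = suc u} (_ , u<N) = fromℕ< u<N

vertex-index-of : ∀ {N u} (iu : In N u) → vertex (index-of iu) ≡ u
vertex-index-of {u = suc u} (_ , u<N) = cong suc (toℕ-fromℕ< u<N)

vertex-in-range : ∀ {N} (i : Fin N) → In N (vertex i)
vertex-in-range i = s≤s z≤n , toℕ<n i

vertex-injective : ∀ {N} {i j : Fin N} → vertex i ≡ vertex j → i ≡ j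
vertex-injective = toℕ-injective ∘ suc-injective

onVertices : ∀ {N} → (Fin N → Fin N) → ℕ → ℕ
onVertices {N} f zero    = zero
onVertices {N} f (suc m) with m <? N
... | yes m<N = vertex (f (fromℕ< m<N))
... | no _    = suc m

onVertices-vertex : ∀ {N} (f : Fin N → Fin N) i → onVertices f (vertex i) ≡ vertex (f i)
onVertices-vertex {N} f i with toℕ i <? N
... | yes i<N = cong (vertex ∘ f) (fromℕ<-toℕ i i<N)
... | no i≮N  = ⊥-elim (i≮N (toℕ<n i))

module _ {N : ℕ} where

  onVertices-in : ∀ (f : Fin N → Fin N) {u} → In N u → In N (onVertices f u)
  onVertices-in f iu = subst (In N ∘ onVertices f) (vertex-index-of iu)
    (subst (In N) (sym (onVertices-vertex f i)) (vertex-in-range (f i)))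
    where i = index-of iu

  onVertices-inverse : ∀ {f g : Fin N → Fin N} → (∀ i → f (g i) ≡ i) → ∀ {u} → In N u →
                       onVertices f (onVertices g u) ≡ u
  onVertices-inverse {f} {g} f∘g iu = subst (λ u → onVertices f (onVertices g u) ≡ u) (vertex-index-of iu)
    (trans (cong (onVertices f) (onVertices-vertex g i))
      (trans (onVertices-vertex f (g i)) (cong vertex (f∘g i))))
    where i = index-of iu

  onVertices-adjacent : ∀ {f : Fin N → Fin N} → (∀ i j → Adj N i j → Adj N (f i) (f j)) →
                        ∀ {u v} → In N u → In N v → u ≢ v → IsFibonacci (u + v) →
                        IsFibonacci (onVertices f u + onVertices f v)
  onVertices-adjacent {f} f-adj iu iv =
    subst₂ (λ u v → u ≢ v → IsFibonacci (u + v) → IsFibonacci (onVertices f u + onVertices f v))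
      (vertex-index-of iu) (vertex-index-of iv)
      λ u≢v fib → subst₂ (λ a b → IsFibonacci (a + b))
        (sym (onVertices-vertex f i)) (sym (onVertices-vertex f j))
        (proj₂ (f-adj i j ((λ i≡j → u≢v (cong vertex i≡j)) , fib)))
    where
    i = index-of iu
    j = index-of iv

  toAuto : (σ : Permutation′ N) → IsAutomorphism N σ → Auto N
  toAuto σ aut = record
    { to       = onVertices (σ ⟨$⟩ʳ_)
    ; from     = onVertices (σ ⟨$⟩ˡ_)
    ; to-in    = onVertices-in (σ ⟨$⟩ʳ_)
    ; from-in  = onVertices-in (σ ⟨$⟩ˡ_)
    ; from-to  = onVertices-inverse (λ i → inverseˡ σ)
    ; to-from  = onVertices-inverse (λ i → inverseʳ σ)
    ; to-adj   = onVertices-adjacent λ i j → Equivalence.to (aut i j)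
    ; from-adj = onVertices-adjacent λ i j a → Equivalence.from (aut (σ ⟨$⟩ˡ i) (σ ⟨$⟩ˡ j))
                   (subst₂ (Adj N) (sym (inverseʳ σ)) (sym (inverseʳ σ)) a)
    }

  module _ (A : Auto N) where
    open Images A
    private
      f g : Fin N → Fin N
      f i = index-of (to-in (vertex-in-range i))
      g i = index-of (from-in (vertex-in-range i))
      vertex-f : ∀ i → vertex (f i) ≡ to (vertex i)
      vertex-f i = vertex-index-of (to-in (vertex-in-range i))
      vertex-g : ∀ i → vertex (g i) ≡ from (vertex i)
      vertex-g i = vertex-index-of (from-in (vertex-in-range i))

    toPermutation : Permutation′ N
    toPermutation = permutation f g
      (λ i → vertex-injective (trans (vertex-f (g i)) (trans (cong to (vertex-g i)) (to-from (vertex-in-range i)))))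
      (λ i → vertex-injective (trans (vertex-g (f i)) (trans (cong from (vertex-f i)) (from-to (vertex-in-range i)))))

    vertex-toPermutation : ∀ i → vertex (toPermutation ⟨$⟩ʳ i) ≡ to (vertex i)
    vertex-toPermutation = vertex-f

    toPermutation-isAutomorphism : IsAutomorphism N toPermutation
    toPermutation-isAutomorphism i j = mk⇔ forwards backwards
      where
      forwards : Adj N i j → Adj N (f i) (f j)
      forwards (i≢j , fib) =
        (λ fi≡fj → i≢j (vertex-injective (to-injective (vertex-in-range i) (vertex-in-range j)
          (trans (sym (vertex-f i)) (trans (cong vertex fi≡fj) (vertex-f j)))))) ,
        subst₂ (λ a b → IsFibonacci (a + b)) (sym (vertex-f i)) (sym (vertex-f j))
          (to-adj (vertex-in-range i) (vertex-in-range j) (i≢j ∘ vertex-injective) fib)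
      backwards : Adj N (f i) (f j) → Adj N i j
      backwards (fi≢fj , fib) =
        (λ i≡j → fi≢fj (cong f i≡j)) ,
        subst₂ (λ a b → IsFibonacci (a + b)) (back i) (back j)
          (from-adj (vertex-in-range (f i)) (vertex-in-range (f j)) (fi≢fj ∘ vertex-injective) fib)
        where
        back : ∀ i → from (vertex (f i)) ≡ vertex i
        back i = trans (cong from (vertex-f i)) (from-to (vertex-in-range i))

  trivial : (∀ A → IsIdentity {N} A) → AutTrivial N
  trivial identity σ aut i = vertex-injective
    (trans (sym (onVertices-vertex (σ ⟨$⟩ʳ_) i)) (identity (toAuto σ aut) (vertex i) (vertex-in-range i)))

  identity-or : ∀ (B : Auto N) (ψ : ℕ → ℕ) → (∀ {u} → In N u → Auto.to B u ≡ ψ u) →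
                (∀ A → IsIdentity A ⊎ (∀ u → In N u → Auto.to A u ≡ Auto.to B u)) → AutIsIdAnd N ψ
  identity-or B ψ B≡ψ classify =
    (toPermutation B , toPermutation-isAutomorphism B ,
      λ i → trans (vertex-toPermutation B i) (B≡ψ (vertex-in-range i))) ,
    λ σ aut → [ (λ id → inj₁ λ i → vertex-injective (trans (sym (onVertices-vertex (σ ⟨$⟩ʳ_) i))
                  (id (vertex i) (vertex-in-range i))))
              , (λ eq → inj₂ λ i → trans (sym (onVertices-vertex (σ ⟨$⟩ʳ_) i))
                  (trans (eq (vertex i) (vertex-in-range i)) (B≡ψ (vertex-in-range i)))) ]′
              (classify (toAuto σ aut))

-- Classification and the three groups of ranges

module Dichotomy {N c h k s r : ℕ} (5≤c : 5 ≤ c) (2h : h + h ≡ F (4 + c)) (k+h : k + h ≡ F (3 + c))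
                 (s≡ : s ≡ F (5 + c) + h) (r≡ : r ≡ F (6 + c) + k)
                 {φ : ℕ → ℕ} (exchanges : ExchangesPairs h (h + F (4 + c)) s r φ)
                 (t≤N : h + F (4 + c) ≤ N) (N+h<F : N + h < F (7 + c)) (r≤N : s ≤ N → r ≤ N) where
  open Range {N} {c} {h} {k} 5≤c 2h k+h (≤-trans (m≤n+m (F (4 + c)) h) t≤N) (≤-<-trans (m≤m+n N h) N+h<F)
    using (Swapped; fixed-or-swapped)
  open Reflection {N} {c} {h} {k} (≤-trans (s≤s (s≤s z≤n)) 5≤c) 2h k+h refl s≡ r≡ exchanges t≤N N+h<F r≤N
    using (φ-involutive; Φ; h<t)
  open ExchangesPairs exchanges

  classify : (A : Auto N) → IsIdentity A ⊎ (∀ u → In N u → Auto.to A u ≡ φ u)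
  classify A with fixed-or-swapped A
  ... | inj₁ id = inj₁ id
  ... | inj₂ S with fixed-or-swapped (Φ ⊙ A)
  ...   | inj₁ id = inj₂ λ u iu → trans (sym (φ-involutive _)) (cong φ (id u iu))
  -- If both `A` and its composite with φ carried `h` to `t`, then φ would fix `t`; but φ carries
  -- `t` to `h`.
  ...   | inj₂ S′ = ⊥-elim (<⇒≢ h<t
            (trans (sym φ-t) (trans (cong φ (sym (Swapped.h-to-t S))) (Swapped.h-to-t S′))))

  identity-or-φ : ∀ ψ → (∀ {u} → In N u → φ u ≡ ψ u) → AutIsIdAnd N ψ
  identity-or-φ ψ φ≡ψ = identity-or Φ ψ φ≡ψ classify

half : ∀ m h → m ≡ h + h → m / 2 ≡ h
half m h eq = trans (cong (_/ 2) (trans eq (double h))) (m*n/n≡m h 2)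
  where
  double : ∀ h → h + h ≡ h * 2
  double = solve-∀

-- `i` and `j` stand for n + 3 and n + 2, which do not reduce to 7 + c and 6 + c; the equations are
-- matched after passing commutativity of addition.
theorem15-at : ∀ c → 5 ≤ c → ∀ {h k} → h + h ≡ F (4 + c) → k + h ≡ F (3 + c) → ∀ N →
    ∀ {i j} → i ≡ 7 + c → j ≡ 6 + c →
    (((F (4 + c) ≤ N × 2 * N < 3 * F (4 + c))
    ⊎ (F i ≤ 2 * N × 2 * N < 2 * F j + F (1 + c))
    ⊎ (2 * F i ≤ 2 * N + F (4 + c) × N < F i))
    → AutTrivial N)
    × ((3 * F (4 + c) ≤ 2 * N × 2 * N < F i)
    → AutIsIdAnd N (swapℕ (F (4 + c) / 2) (3 * F (4 + c) / 2)))
    × ((2 * F j + F (1 + c) ≤ 2 * N × 2 * N + F (4 + c) < 2 * F i)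
    → AutIsIdAnd N (λ v → swapℕ (F (4 + c) / 2) (3 * F (4 + c) / 2)
    (swapℕ (F j + F (1 + c) / 2) (F i / 2) v)))
theorem15-at c 5≤c {h} {k} 2h k+h N refl refl = part1 , part2 , part3
  where
  t s r : ℕ
  t = h + F (4 + c)
  s = F (5 + c) + h
  r = F (6 + c) + k

  h≡ : h ≡ F (4 + c) / 2
  h≡ = sym (half (F (4 + c)) h (sym 2h))

  t≡ : t ≡ 3 * F (4 + c) / 2
  t≡ = sym (half (3 * F (4 + c)) t (≤-antisym (linear (F (suc c) ∷ F c ∷ h ∷ [])
            (λ F₁ F₀ h → 𝔽 4 F₁ F₀ ≼ h ⊕ h ∷ []
              ⊢ 𝔽 4 F₁ F₀ ⊕ (𝔽 4 F₁ F₀ ⊕ (𝔽 4 F₁ F₀ ⊕ κ 0)) ≼ h ⊕ 𝔽 4 F₁ F₀ ⊕ (h ⊕ 𝔽 4 F₁ F₀))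
            0 (1 ∷ []) (≤-reflexive (sym 2h)))
          (linear (h ∷ F (suc c) ∷ F c ∷ [])
            (λ h F₁ F₀ → h ⊕ h ≼ 𝔽 4 F₁ F₀ ∷ []
              ⊢ h ⊕ 𝔽 4 F₁ F₀ ⊕ (h ⊕ 𝔽 4 F₁ F₀) ≼ 𝔽 4 F₁ F₀ ⊕ (𝔽 4 F₁ F₀ ⊕ (𝔽 4 F₁ F₀ ⊕ κ 0)))
            0 (1 ∷ []) (≤-reflexive 2h))))

  s≡ : s ≡ F (7 + c) / 2
  s≡ = sym (half (F (7 + c)) s (≤-antisym (linear (F (suc c) ∷ F c ∷ h ∷ [])
            (λ F₁ F₀ h → 𝔽 4 F₁ F₀ ≼ h ⊕ h ∷ [] ⊢ 𝔽 7 F₁ F₀ ≼ 𝔽 5 F₁ F₀ ⊕ h ⊕ (𝔽 5 F₁ F₀ ⊕ h))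
            0 (1 ∷ []) (≤-reflexive (sym 2h)))
          (linear (h ∷ F (suc c) ∷ F c ∷ [])
            (λ h F₁ F₀ → h ⊕ h ≼ 𝔽 4 F₁ F₀ ∷ [] ⊢ 𝔽 5 F₁ F₀ ⊕ h ⊕ (𝔽 5 F₁ F₀ ⊕ h) ≼ 𝔽 7 F₁ F₀)
            0 (1 ∷ []) (≤-reflexive 2h))))

  r≡ : r ≡ F (6 + c) + F (1 + c) / 2
  r≡ = cong (F (6 + c) +_) (sym (half (F (1 + c)) k (≤-antisym (linear (h ∷ F (suc c) ∷ F c ∷ k ∷ [])
            (λ h F₁ F₀ k → h ⊕ h ≼ 𝔽 4 F₁ F₀ ∷ 𝔽 3 F₁ F₀ ≼ k ⊕ h ∷ [] ⊢ F₁ ≼ k ⊕ k)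
            0 (1 ∷ 2 ∷ []) (≤-reflexive 2h) (≤-reflexive (sym k+h)))
          (linear (F (suc c) ∷ F c ∷ h ∷ k ∷ [])
            (λ F₁ F₀ h k → 𝔽 4 F₁ F₀ ≼ h ⊕ h ∷ k ⊕ h ≼ 𝔽 3 F₁ F₀ ∷ [] ⊢ k ⊕ k ≼ F₁)
            0 (1 ∷ 2 ∷ []) (≤-reflexive (sym 2h)) (≤-reflexive k+h)))))

  F-c-pos : 1 ≤ F c
  F-c-pos = F-pos (≤-trans (s≤s z≤n) 5≤c)

  F-c-< : F c < F (1 + c)
  F-c-< = F-strict (≤-trans (s≤s (s≤s z≤n)) 5≤c) ≤-refl

  s<r : s < r
  s<r = linear (h ∷ F (suc c) ∷ F c ∷ k ∷ [])
            (λ h F₁ F₀ k → h ⊕ h ≼ 𝔽 4 F₁ F₀ ∷ κ 1 ≼ F₀ ∷ []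
              ⊢ κ 1 ⊕ (𝔽 5 F₁ F₀ ⊕ h) ≼ 𝔽 6 F₁ F₀ ⊕ k)
            1 (1 ∷ 2 ∷ []) (≤-reflexive 2h) F-c-pos

  exchanges : ExchangesPairs h t s r (λ u → swapℕ h t (swapℕ r s u))
  exchanges = swaps-exchange (linear (F c ∷ h ∷ F (suc c) ∷ [])
            (λ F₀ h F₁ → κ 1 ≼ F₀ ∷ [] ⊢ κ 1 ⊕ h ≼ h ⊕ 𝔽 4 F₁ F₀)
            0 (2 ∷ []) F-c-pos) (linear (F c ∷ F (suc c) ∷ h ∷ [])
            (λ F₀ F₁ h → κ 1 ⊕ F₀ ≼ F₁ ∷ [] ⊢ κ 1 ⊕ (h ⊕ 𝔽 4 F₁ F₀) ≼ 𝔽 5 F₁ F₀ ⊕ h)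
            0 (2 ∷ []) F-c-<) s<r

  part1 : (F (4 + c) ≤ N × 2 * N < 3 * F (4 + c))
        ⊎ (F (7 + c) ≤ 2 * N × 2 * N < 2 * F (6 + c) + F (1 + c))
        ⊎ (2 * F (7 + c) ≤ 2 * N + F (4 + c) × N < F (7 + c)) → AutTrivial N
  part1 (inj₁ (lo , hi)) = trivial (rigid λ {A} → trivial-below-3h hi {A})
    where open Range {N} {c} {h} {k} 5≤c 2h k+h lo (linear (N ∷ F (suc c) ∷ F c ∷ [])
              (λ N F₁ F₀ →
                κ 1 ⊕ (N ⊕ (N ⊕ κ 0)) ≼ 𝔽 4 F₁ F₀ ⊕ (𝔽 4 F₁ F₀ ⊕ (𝔽 4 F₁ F₀ ⊕ κ 0)) ∷ []
                ⊢ κ 1 ⊕ N ≼ 𝔽 7 F₁ F₀)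
              2 (4 ∷ []) hi)
  part1 (inj₂ (inj₁ (lo , hi))) = trivial (rigid λ {A} → trivial-middle lo hi {A})
    where open Range {N} {c} {h} {k} 5≤c 2h k+h (linear (F (suc c) ∷ F c ∷ N ∷ [])
              (λ F₁ F₀ N → 𝔽 7 F₁ F₀ ≼ N ⊕ (N ⊕ κ 0) ∷ [] ⊢ 𝔽 4 F₁ F₀ ≼ N)
              3 (1 ∷ []) lo) (linear (N ∷ F (suc c) ∷ F c ∷ [])
              (λ N F₁ F₀ → κ 1 ⊕ (N ⊕ (N ⊕ κ 0)) ≼ 𝔽 6 F₁ F₀ ⊕ (𝔽 6 F₁ F₀ ⊕ κ 0) ⊕ F₁ ∷ []
                ⊢ κ 1 ⊕ N ≼ 𝔽 7 F₁ F₀)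
              16 (13 ∷ []) hi)
  part1 (inj₂ (inj₂ (lo , hi))) = trivial (rigid λ {A} → trivial-top lo {A})
    where open Range {N} {c} {h} {k} 5≤c 2h k+h (linear (F (suc c) ∷ F c ∷ N ∷ [])
              (λ F₁ F₀ N → 𝔽 7 F₁ F₀ ⊕ (𝔽 7 F₁ F₀ ⊕ κ 0) ≼ N ⊕ (N ⊕ κ 0) ⊕ 𝔽 4 F₁ F₀ ∷ []
                ⊢ 𝔽 4 F₁ F₀ ≼ N)
              6 (1 ∷ []) lo) hi

  part2 : 3 * F (4 + c) ≤ 2 * N × 2 * N < F (7 + c) →
          AutIsIdAnd N (swapℕ (F (4 + c) / 2) (3 * F (4 + c) / 2))
  part2 (lo , hi) =
    Dichotomy.identity-or-φ {N} {c} {h} {k} 5≤c 2h k+h refl refl exchanges (linear (F (suc c) ∷ F c ∷ N ∷ h ∷ [])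
              (λ F₁ F₀ N h →
                𝔽 4 F₁ F₀ ⊕ (𝔽 4 F₁ F₀ ⊕ (𝔽 4 F₁ F₀ ⊕ κ 0)) ≼ N ⊕ (N ⊕ κ 0) ∷ h ⊕ h ≼ 𝔽 4 F₁ F₀ ∷ []
                ⊢ h ⊕ 𝔽 4 F₁ F₀ ≼ N)
              1 (1 ∷ 1 ∷ []) lo (≤-reflexive 2h)) (linear (N ∷ F (suc c) ∷ F c ∷ h ∷ [])
              (λ N F₁ F₀ h → κ 1 ⊕ (N ⊕ (N ⊕ κ 0)) ≼ 𝔽 7 F₁ F₀ ∷ h ⊕ h ≼ 𝔽 4 F₁ F₀ ∷ []
                ⊢ κ 1 ⊕ (N ⊕ h) ≼ 𝔽 7 F₁ F₀)
              7 (7 ∷ 4 ∷ []) hi (≤-reflexive 2h))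
      -- The same φ as in the third part serves here: with N < s its exchange of `r` and `s` happens
      -- outside the vertex set.
      (λ s≤N → ⊥-elim (<⇒≱ N<s s≤N))
      (swapℕ (F (4 + c) / 2) (3 * F (4 + c) / 2)) λ {u} iu → trans
        (cong (swapℕ h t) (swapℕ-other (<⇒≢ (≤-<-trans (proj₂ iu) (<-trans N<s s<r))) (<⇒≢ (≤-<-trans (proj₂ iu) N<s))))
        (cong₂ (λ a b → swapℕ a b u) h≡ t≡)
    where
    N<s : N < s
    N<s = linear (N ∷ F (suc c) ∷ F c ∷ h ∷ [])
              (λ N F₁ F₀ h → κ 1 ⊕ (N ⊕ (N ⊕ κ 0)) ≼ 𝔽 7 F₁ F₀ ∷ 𝔽 4 F₁ F₀ ≼ h ⊕ h ∷ []
                ⊢ κ 1 ⊕ N ≼ 𝔽 5 F₁ F₀ ⊕ h)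
              1 (1 ∷ 1 ∷ []) hi (≤-reflexive (sym 2h))

  part3 : 2 * F (6 + c) + F (1 + c) ≤ 2 * N × 2 * N + F (4 + c) < 2 * F (7 + c) →
          AutIsIdAnd N (λ v → swapℕ (F (4 + c) / 2) (3 * F (4 + c) / 2)
                                (swapℕ (F (6 + c) + F (1 + c) / 2) (F (7 + c) / 2) v))
  part3 (lo , hi) =
    Dichotomy.identity-or-φ {N} {c} {h} {k} 5≤c 2h k+h refl refl exchanges (linear (F (suc c) ∷ F c ∷ N ∷ h ∷ [])
              (λ F₁ F₀ N h →
                𝔽 6 F₁ F₀ ⊕ (𝔽 6 F₁ F₀ ⊕ κ 0) ⊕ F₁ ≼ N ⊕ (N ⊕ κ 0) ∷ h ⊕ h ≼ 𝔽 4 F₁ F₀ ∷ []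
                ⊢ h ⊕ 𝔽 4 F₁ F₀ ≼ N)
              9 (3 ∷ 5 ∷ []) lo (≤-reflexive 2h)) (linear (N ∷ F (suc c) ∷ F c ∷ h ∷ [])
              (λ N F₁ F₀ h →
                κ 1 ⊕ (N ⊕ (N ⊕ κ 0) ⊕ 𝔽 4 F₁ F₀) ≼ 𝔽 7 F₁ F₀ ⊕ (𝔽 7 F₁ F₀ ⊕ κ 0) ∷
                h ⊕ h ≼ 𝔽 4 F₁ F₀ ∷ []
                ⊢ κ 1 ⊕ (N ⊕ h) ≼ 𝔽 7 F₁ F₀)
              1 (1 ∷ 1 ∷ []) hi (≤-reflexive 2h))
      (λ _ → (linear (F (suc c) ∷ F c ∷ N ∷ h ∷ k ∷ [])
                (λ F₁ F₀ N h k →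
                  𝔽 6 F₁ F₀ ⊕ (𝔽 6 F₁ F₀ ⊕ κ 0) ⊕ F₁ ≼ N ⊕ (N ⊕ κ 0) ∷ 𝔽 4 F₁ F₀ ≼ h ⊕ h ∷
                  k ⊕ h ≼ 𝔽 3 F₁ F₀ ∷ []
                  ⊢ 𝔽 6 F₁ F₀ ⊕ k ≼ N)
                1 (1 ∷ 1 ∷ 2 ∷ []) lo (≤-reflexive (sym 2h)) (≤-reflexive k+h)))
      (λ v → swapℕ (F (4 + c) / 2) (3 * F (4 + c) / 2) (swapℕ (F (6 + c) + F (1 + c) / 2) (F (7 + c) / 2) v))
      λ {u} _ → cong₂ (λ f v → f v) (cong₂ swapℕ h≡ t≡) (cong₂ (λ a b → swapℕ a b u) r≡ s≡)

theorem15 : (n : ℕ) → 9 ≤ n → 3 ∣ n → (N : ℕ) → 1 ≤ N →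
    (((F n ≤ N × 2 * N < 3 * F n)
    ⊎ (F (n + 3) ≤ 2 * N × 2 * N < 2 * F (n + 2) + F (n ∸ 3))
    ⊎ (2 * F (n + 3) ≤ 2 * N + F n × N < F (n + 3)))
    → AutTrivial N)
    × ((3 * F n ≤ 2 * N × 2 * N < F (n + 3))
    → AutIsIdAnd N (swapℕ (F n / 2) (3 * F n / 2)))
    × ((2 * F (n + 2) + F (n ∸ 3) ≤ 2 * N × 2 * N + F n < 2 * F (n + 3))
    → AutIsIdAnd N (λ v → swapℕ (F n / 2) (3 * F n / 2)
    (swapℕ (F (n + 2) + F (n ∸ 3) / 2) (F (n + 3) / 2) v)))
theorem15 n 9≤n (divides q n≡q*3) N _ with m≤n⇒∃[o]m+o≡n 9≤n
... | o , refl with Even-F q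
...   | h , eq =
  -- Half of F (n - 3) is obtained by subtraction, from F n = 2 F (n - 2) + F (n - 3).
  theorem15-at (5 + o) (m≤m+n 5 o) {h} {h ∸ F (7 + o)} 2h k+h N (+-comm (9 + o) 3) (+-comm (9 + o) 2)
  where
  2h : h + h ≡ F (9 + o)
  2h = trans eq (cong F (sym n≡q*3))
  F≤h : F (7 + o) ≤ h
  -- The scale 34 and the weight 13 are the coefficients of F₁ in `𝔽 9` and `𝔽 7`.
  F≤h = linear (F (suc o) ∷ F o ∷ h ∷ [])
            (λ F₁ F₀ h → 𝔽 9 F₁ F₀ ≼ h ⊕ h ∷ [] ⊢ 𝔽 7 F₁ F₀ ≼ h)
            33 (13 ∷ []) (≤-reflexive (sym 2h))
  k+F : h ∸ F (7 + o) + F (7 + o) ≡ h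
  k+F = m∸n+n≡m F≤h
  k+h : h ∸ F (7 + o) + h ≡ F (8 + o)
  k+h = ≤-antisym (linear (h ∷ F (suc o) ∷ F o ∷ h ∸ (F (suc o) + F o + F (suc o) + (F (suc o) + F o) + (F (suc o) + F o + F (suc o)) + (F (suc o) + F o + F (suc o) + (F (suc o) + F o)) + (F (suc o) + F o + F (suc o) + (F (suc o) + F o) + (F (suc o) + F o + F (suc o)))) ∷ [])
            (λ h F₁ F₀ t₁ → h ⊕ h ≼ 𝔽 9 F₁ F₀ ∷ t₁ ⊕ 𝔽 7 F₁ F₀ ≼ h ∷ [] ⊢ t₁ ⊕ h ≼ 𝔽 8 F₁ F₀)
            0 (1 ∷ 1 ∷ []) (≤-reflexive 2h) (≤-reflexive k+F))
          (linear (F (suc o) ∷ F o ∷ h ∷ h ∸ (F (suc o) + F o + F (suc o) + (F (suc o) + F o) + (F (suc o) + F o + F (suc o)) + (F (suc o) + F o + F (suc o) + (F (suc o) + F o)) + (F (suc o) + F o + F (suc o) + (F (suc o) + F o) + (F (suc o) + F o + F (suc o)))) ∷ [])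
            (λ F₁ F₀ h t₁ → 𝔽 9 F₁ F₀ ≼ h ⊕ h ∷ h ≼ t₁ ⊕ 𝔽 7 F₁ F₀ ∷ [] ⊢ 𝔽 8 F₁ F₀ ≼ t₁ ⊕ h)
            0 (1 ∷ 1 ∷ []) (≤-reflexive (sym 2h)) (≤-reflexive (sym k+F)))
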